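{- Let $b\in\mathbb{Z}$ be such that $-b$ is not the square of an integer. For $x\geq1$ let $R_b(x)$ be the number of integers $n\in[1,x]$ such that $n^2+b$ has a primitive divisor (with respect to the sequence $A_n=n^2+b$, $n\geq1$). Then $R_b(x)>0.543x$ for all sufficiently large $x$.
   Context: For a sequence of integers $(A_n)_{n\geq1}$, an integer $e>1$ is a primitive divisor of $A_n$ if $e\mid A_n$ and $\gcd(e,A_m)=1$ for all $m<n$ with $A_m\neq0$. -}

module Defs where

open import Data.Nat as ℕ using (ℕ)
open import Data.Integer as ℤ using (ℤ; +_)
open import Data.Integer.Divisibility using (_∣_)
open import Data.Integer.GCD using (gcd)
open import Data.Product using (Σ; _×_)
open import Relation.Binary.PropositionalEquality using (_≡_; _≢_)
open import Relation.Nullary using (¬_)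
open import Data.Rational as ℚ using (ℚ)

A : ℤ → ℕ → ℤ
A b n = (+ n) ℤ.* (+ n) ℤ.+ b

IsSquare : ℤ → Set
IsSquare z = Σ ℤ (λ k → k ℤ.* k ≡ z)

IsPrimitiveDivisor : ℤ → ℕ → ℤ → Set
IsPrimitiveDivisor b n e =
  ℤ.1ℤ ℤ.< e × e ∣ A b n ×
  (∀ (m : ℕ) → 1 ℕ.≤ m → m ℕ.< n → A b m ≢ ℤ.0ℤ → gcd e (A b m) ≡ ℤ.1ℤ)

HasPrimitiveDivisor : ℤ → ℕ → Set
HasPrimitiveDivisor b n = Σ ℤ (IsPrimitiveDivisor b n)

ℕ→ℚ : ℕ → ℚ
ℕ→ℚ n = (+ n) ℚ./ 1

{-# OPTIONS --safe #-}

-- For n ≤ x let m and M be the sums of log p / log x over the primes p ≤ √x, respectively p ≤ 2x, that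
-- divide n² + b. A product of two primes below √x is at most x, so the averages E m = 1/2, E m² = 3/8 and
-- E M = 1 follow from counting solutions of n² + b ≡ 0 to moduli up to x. Put
--   W = 0.98 + 0.89 m - 0.5 m² - 0.69 M.
-- Then W ≤ 1 because m ≤ M, and W ≤ 0 when n² + b has no prime factor above 2n, since then M is about 2
-- for all but few n. A prime factor above 2n is a primitive divisor, so the density of the n in question is
-- at least E W = 0.98 + 0.445 - 0.1875 - 0.69 = 0.5475.
--
-- The averages rest on Mertens' theorem for the primes p modulo which - b is a square: the sum of
-- 2 log p / p over such p ≤ z is asymptotic to log z. Both bounds come from factoring u² + b v² over a box.
-- For such p the relation p ∣ u² + b v² defines two lattices of index p; the Cauchy-Schwarz inequality bounds
-- the number of differences of points of the box lying in them from below, and cutting the box into strips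
-- as wide as a shortest vector bounds the number of their points from above. The error, X divided by the
-- length of the shortest vector, is small on average since that vector is itself a zero of the form modulo p.
module Submission where

-- Markov's inequality for M alone, with mean 1 and value about 2 on the n without a large prime
-- factor, yields only density 1/2; the second moment of m supplies the rest. Its value 3/8 is
-- (1/2)² + 1/8, where 1/8 is the integral of t over [0, 1/2] and stems from pairs of equal primes.
-- The coefficients of W are tuned to two quadratics: 0.98 + 0.2 m - 0.5 m² ≤ 1 if only M ≥ m is
-- known, and - 0.4 + 0.89 m - 0.5 m² < 0 if M = 2. All estimates are inequalities between natural
-- numbers. Logarithms are scaled by a parameter T and rounded, relative errors are of order 1 / T,
-- and one fixed T suffices because 437 / 800 = 0.54625 lies between 0.543 and 0.5475. Two obstacles
-- shape the details. The form may be indefinite, so its absolute value is used, on boxes where u²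
-- dominates when a lower bound is wanted. And log N is the sum of log p over p dividing N only if N
-- has no large square factor and no high power of a small prime; a sieve makes the other values as
-- rare as prescribed.

open import Data.Nat using (ℕ; _≤_)

-- Polynomial identities over the integers and the naturals

module IntegerIdentities where
  open import Data.Integer
  open import Data.Integer.Tactic.RingSolver using (solve-∀)
  open import Relation.Binary.PropositionalEquality using (_≡_)

  abstract
    form-scale : ∀ b s t p → s * p * (s * p) + b * (t * p * (t * p)) ≡ (s * s + b * (t * t)) * (p * p)
    form-scale = solve-∀

    form-shift : ∀ b x y k p → (x * x + b * (y * y)) + p * (k * (k * p - x - x)) ≡ (x - k * p) * (x - k * p) + b * (y * y)
    form-shift = solve-∀

    form-factor : ∀ b x y r → (x + r * y) * (x - r * y) + y * y * (r * r + b) ≡ x * x + b * (y * y)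
    form-factor = solve-∀

    form-factor′ : ∀ b x y r → (x * x + b * (y * y)) - y * y * (r * r + b) ≡ (x + r * y) * (x - r * y)
    form-factor′ = solve-∀

    -- If `w * v` is congruent to 1 or to - 1, the second summand on the left vanishes, so a zero of
    -- the form with `v` invertible gives the root `u * w` of x² + b.
    form-inverse : ∀ b u v w → w * w * (u * u + b * (v * v)) + b * ((1ℤ - w * v) * (1ℤ + w * v)) ≡ u * w * (u * w) + b * (1ℤ * 1ℤ)
    form-inverse = solve-∀

    form-difference : ∀ b u v w → (u * u + b * (v * v)) - (w * w + b * (v * v)) ≡ (u - w) * (u + w)
    form-difference = solve-∀

    form-conj : ∀ b p r → (r * r + b * (1ℤ * 1ℤ)) + p * (p - r - r) ≡ (p - r) * (p - r) + b * (1ℤ * 1ℤ)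
    form-conj = solve-∀

    twice : ∀ x → x + x ≡ (+ 2) * x
    twice = solve-∀

    minus-class : ∀ u a d → (u - a) + (1ℤ + d) * a ≡ u + d * a
    minus-class = solve-∀

    sum-diff : ∀ u w → (u + w) + (u - w) ≡ u + u
    sum-diff = solve-∀

    key-identity : ∀ a c p x → (a - c) * p ≡ (x + a * p) - (x + c * p)
    key-identity = solve-∀

    key-difference : ∀ u v u′ v′ r → (u + r * v) - (u′ + r * v′) ≡ (u - u′) + r * (v - v′)
    key-difference = solve-∀

    shift-identity : ∀ y a i i′ → y * (a - i) - y * (a - i′) ≡ - (y * (i - i′))
    shift-identity = solve-∀

    shift-identity′ : ∀ y i i′ → y * i - y * i′ ≡ - ((- y) * (i - i′))
    shift-identity′ = solve-∀

    τ-identity : ∀ a k k′ s s′ → (a * k + s) - (a * k′ + s′) ≡ a * (k - k′) + (s - s′)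
    τ-identity = solve-∀

    τ-identity′ : ∀ x κ i₀ i i′ → x + - (κ * (i - i′)) ≡ x - κ * ((i₀ + i) - (i₀ + i′))
    τ-identity′ = solve-∀

    cancel-shift : ∀ i₀ i i′ → (i₀ + i) - (i₀ + i′) ≡ i - i′
    cancel-shift = solve-∀

    box-difference : ∀ s t r i k i′ k′ → ((s + i) + r * (t + k)) - ((s + i′) + r * (t + k′)) ≡ (i - i′) + r * (k - k′)
    box-difference = solve-∀

    cross-u : ∀ a κ r i k → k * (a + r * κ) - κ * (i + r * k) ≡ a * k - κ * i
    cross-u = solve-∀

    cross-v : ∀ a κ r i k → a * (i + r * k) - k * (κ + r * a) ≡ a * i - κ * k
    cross-v = solve-∀

    minus-out : ∀ a r y → a - r * y ≡ a + r * (- y)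
    minus-out = solve-∀

    minus-both : ∀ x r a → - (x - r * a) ≡ (- x) + r * a
    minus-both = solve-∀

module Identities where

  open import Data.Nat
  open import Data.Nat.Tactic.RingSolver using (solve-∀)
  open import Relation.Binary.PropositionalEquality using (_≡_)

  abstract
    ladder₁ : ∀ y R S g → y * (suc y * (R * (S + g))) ≡ suc y * (y * (R * S)) + R * (y * (suc y * g))
    ladder₁ = solve-∀

    ladder₂ : ∀ R k A → suc (R + k) * (k * A) + R * A ≡ (R + k) * (suc k * A)
    ladder₂ = solve-∀

    strip₁ : ∀ m a X p → m * (a * (X + a) + p) ≡ m * a * (X + a) + m * p
    strip₁ = solve-∀

    strip₂ : ∀ X a m p → (X + a) * (X + a) + m * p ≡ X * X + (2 * a * X + a * a + m * p)
    strip₂ = solve-∀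

    strip₃ : ∀ a m → 2 * a * (m * a) ≡ 2 * m * (a * a)
    strip₃ = solve-∀

    strip₄ : ∀ X q p → X * X + (2 * suc q * p + p + suc q * p) ≡ X * X + p * (3 * q + 4)
    strip₄ = solve-∀

    grid₁ : ∀ β X → suc β * X + X ≡ (β + 2) * X
    grid₁ = solve-∀

    grid₂ : ∀ β X → (β + 2) * X * ((β + 2) * X) + β * (X * X) ≡ ((β + 2) * (β + 2) + β) * (X * X)
    grid₂ = solve-∀

    grid₃ : ∀ β X → X * X + β * (X * X) + (β + β * β) * (X * X) ≡ suc β * X * (suc β * X)
    grid₃ = solve-∀

    grid₄ : ∀ β X → X * X + (4 + β) * (X * X) + ((β + 2) * (β + 2) + β) * (X * X) ≡ (β + 3) * X * ((β + 3) * X)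
    grid₄ = solve-∀

    grid₅ : ∀ β X → X + X + (β + 1) * X ≡ (β + 3) * X
    grid₅ = solve-∀

    grid₆ : ∀ q p l c → q * p * (1 * (l * c)) ≡ q * l * (p * c)
    grid₆ = solve-∀

    grid₇ : ∀ q l n p e → q * l * (2 * (n + p * e)) ≡ n * (1 * (2 * (l * q))) + 2 * (q * p) * (1 * (l * e))
    grid₇ = solve-∀

    grid₈ : ∀ s l q → s * (l * (3 * q + 4)) ≡ 3 * (s * (l * q)) + 4 * (s * l)
    grid₈ = solve-∀

    grid₉ : ∀ H W a l → 3 * (H * W + 4 * a * l) + 4 * W ≡ (3 * H + 4) * W + 12 * a * l
    grid₉ = solve-∀

    grid₁₀ : ∀ β X → (1 + β) * (X * X) + (3 + 4 * β + β * β) * (X * X) ≡ ((β + 2) * (β + 2) + β) * (X * X)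
    grid₁₀ = solve-∀

    core₁ : ∀ n T Q l k → n * (T * (Q * (2 * l + k))) ≡ Q * (n * (T * (2 * l))) + n * Q * (T * k)
    core₁ = solve-∀

    core₂ : ∀ Q T w n K l e k → Q * ((T + 1) * w + n * K + T * l * e) + n * Q * (T * k) ≡ (T + 1) * (Q * w) + n * Q * (K + T * k) + Q * l * (T * e)
    core₂ = solve-∀

    core₃ : ∀ T n s Q e l → (T + 1) * (n * s + 2 * (Q * e)) + n * Q * l + Q * l * n ≡ n * (T * s) + n * s + Q * (2 * (T + 1) * e) + 2 * (n * (Q * l))
    core₃ = solve-∀

    core₄ : ∀ n T s Q l → n * (T * s) + n * (2 * (Q * l)) + Q * (2 * (n * l)) + 2 * (n * (Q * l)) ≡ n * (T * s + 6 * (Q * l))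
    core₄ = solve-∀

    core₅ : ∀ C n → C * n + C * n ≡ 2 * C * n
    core₅ = solve-∀

    core₆ : ∀ c l → c + (l + l + 1) + 1 ≡ 2 * l + (c + 2)
    core₆ = solve-∀

    core₇ : ∀ T x → (T + T) * x ≡ T * (2 * x)
    core₇ = solve-∀

    core₈ : ∀ c e p → c * (e * p) ≡ e * c * p
    core₈ = solve-∀

    core₉ : ∀ T q X → 2 * (48 * T * (suc q * X)) ≡ (96 * T + q * (96 * T)) * X
    core₉ = solve-∀

    core₁₀ : ∀ X → (X + X) * X ≡ 2 * (X * X)
    core₁₀ = solve-∀

    core₁₁ : ∀ T → 2 * (T + T) ≡ 4 * T
    core₁₁ = solve-∀

    core₁₂ : ∀ T h p l a → 4 * T * (h * (p * l) + 12 * a * l) ≡ 4 * T * h * p * l + 48 * T * a * l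
    core₁₂ = solve-∀

    transfer₁ : ∀ T Q l → T * (Q * (2 * T + l)) ≡ T * (Q * l) + Q * (T * (2 * T))
    transfer₁ = solve-∀

    transfer₂ : ∀ a x → a + 6 * x + x ≡ a + 7 * x
    transfer₂ = solve-∀

    transfer₃ : ∀ X C → (X + X) * (X + X) * C ≡ 2 * (2 * (C * (X * X)))
    transfer₃ = solve-∀

    transfer₄ : ∀ T l → T + (T + l) ≡ 2 * T + l
    transfer₄ = solve-∀

    abel₁ : ∀ s n → 2 * (s + n) + suc n ≡ 2 * s + n + (2 * n + 1)
    abel₁ = solve-∀

    abel₂ : ∀ n → n * n + (2 * n + 1) ≡ suc n * suc n
    abel₂ = solve-∀

    abel₄ : ∀ T Q l → T * (Q * (l + T)) ≡ T * (Q * l) + T * (Q * T)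
    abel₄ = solve-∀

    abel₃ : ∀ T Q l s d p t t₁ →
      2 * (T * d) + (2 * (l * ((T + 1) * (Q * l))) + 2 * (T * p + (7 * (Q * t) + l * (T * (Q * t₁)))) + 7 * Q * (l * l) + T * Q * (2 * t + l) + 7 * Q * l * 1 + l * Q * l + 2 * T * (l * s))
      ≡ (T + 10) * (Q * (l * l)) + (2 * (l * (T * s)) + 2 * (T * (Q * t)) + 7 * Q * (2 * t + l) + T * Q * (l * l) + 7 * Q * l * 0 + l * Q * (T * (2 * t₁ + 1)) + 2 * T * (d + p))
    abel₃ = solve-∀

    moment₁ : ∀ p a c → (p * a + p) + (p * c + p) ≡ p * (a + c) + 2 * p
    moment₁ = solve-∀

    moment₂ : ∀ a a′ c c′ → (a + a′) * (c + c′) ≡ (a * c + a * c′) + (a′ * c + a′ * c′)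
    moment₂ = solve-∀

    moment₃ : ∀ d x y z w → d * ((x + y) + (z + w)) ≡ (d * x + d * y) + (d * z + d * w)
    moment₃ = solve-∀

    moment₄ : ∀ x → (x + x) + (x + x) ≡ 4 * x
    moment₄ = solve-∀

    moment₅ : ∀ q l X p → q * l * (2 * (X + p)) ≡ X * (1 * (2 * (l * q))) + 2 * (q * p) * (1 * l)
    moment₅ = solve-∀

    moment₆ : ∀ X l q → X * (1 * (2 * (l * q))) ≡ q * l * (2 * X)
    moment₆ = solve-∀

    moment₇ : ∀ q l p c → q * l * (p * c + 2 * p) ≡ q * p * (1 * (l * c)) + 2 * (q * p) * (1 * l)
    moment₇ = solve-∀

    moment₈ : ∀ s i l s′ i′ l′ → s * (i * l) * (s′ * (i′ * l′)) ≡ s * l * (s′ * l′) * (i * i′)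
    moment₈ = solve-∀

    moment₉ : ∀ q p q′ p′ l l′ c → q * p * (q′ * p′) * (1 * l * (1 * l′) * c) ≡ q * q′ * (l * l′) * (p * p′ * c)
    moment₉ = solve-∀

    moment₁₀ : ∀ q p q′ p′ l l′ X → q * q′ * (l * l′) * (4 * (X + p * p′)) ≡ X * (1 * (2 * (l * q)) * (1 * (2 * (l′ * q′)))) + 4 * (q * p * (q′ * p′)) * (1 * l * (1 * l′))
    moment₁₀ = solve-∀

    moment₁₁ : ∀ Q q p l c → Q * (q * p) * (1 * l * (1 * l) * c) ≡ Q * (q * (l * l)) * (p * c)
    moment₁₁ = solve-∀

    moment₁₂ : ∀ Q q l X p → Q * (q * (l * l)) * (2 * (X + p)) ≡ 1 * (Q * X * (1 * (2 * (l * q)) * l) + 2 * (Q * (q * p)) * (1 * l * l))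
    moment₁₂ = solve-∀

    scale₁ : ∀ Q T m → Q * (T * m) ≡ T * (Q * m)
    scale₁ = solve-∀

    scale₂ : ∀ T X s Q p l → T * (X * s + 2 * (Q * (p * l))) ≡ X * (T * s) + Q * (2 * T * p * l)
    scale₂ = solve-∀

    scale₃ : ∀ X T Q l → X * ((T + 1) * (Q * l)) + Q * (X * l) ≡ Q * ((T + 2) * (X * l))
    scale₃ = solve-∀

    scale₄ : ∀ Q T X l → Q * ((T + 2) * (X * (T + l))) ≡ Q * (X * ((T + 2) * T) + (T + 2) * (X * l))
    scale₄ = solve-∀

    scale₅ : ∀ Q X l T → Q * (X * l + (T + 2) * (X * l)) ≡ Q * ((T + 3) * (X * l))
    scale₅ = solve-∀

    scale₆ : ∀ T p → 2 * (2 * T * p) ≡ 4 * T * p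
    scale₆ = solve-∀

    scale₇ : ∀ T l → 2 * (T + l) ≡ 2 * T + (l + l)
    scale₇ = solve-∀

    scale₈ : ∀ T X Λ l m →
      T * (X * Λ) + (2 * (T * m + 8 * (X * l)) + T * X * (2 * l + 1) + 8 * X * (2 * T + Λ) + X * Λ)
      ≡ 2 * (T * m) + 9 * (X * Λ) + (2 * (X * (T * l)) + T * X * Λ + 8 * X * (2 * l) + X * (17 * T))
    scale₈ = solve-∀

    scale₉ : ∀ Q X T l → Q * (X * (T * l)) ≡ X * (T * (Q * l))
    scale₉ = solve-∀

    scale₁₀ : ∀ X T s Q l → X * (T * s + 7 * (Q * l)) ≡ T * (X * s) + 7 * (X * (Q * l))
    scale₁₀ = solve-∀

    scale₁₁ : ∀ T Q m p l X → T * (Q * m + 2 * (Q * (p * l))) + 7 * (X * (Q * l)) ≡ Q * (T * m) + Q * (2 * T * p * l) + 7 * (X * (Q * l))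
    scale₁₁ = solve-∀

    scale₁₂ : ∀ Q m X l → Q * m + Q * (X * l) + 7 * (X * (Q * l)) ≡ Q * (m + 8 * (X * l))
    scale₁₂ = solve-∀

    scale₁₃ : ∀ T m → 8 * (T * m) ≡ 4 * (2 * (T * m))
    scale₁₃ = solve-∀

    scale₁₄ : ∀ c X l → 4 * (c * (X * (l * l))) ≡ c * X * (2 * l * (2 * l))
    scale₁₄ = solve-∀

    scale₁₅ : ∀ c X T l → c * X * ((2 * T + l) * (2 * T + l)) ≡ c * X * (4 * T * l + 4 * T * T) + c * (X * (l * l))
    scale₁₅ = solve-∀

    scale₁₆ : ∀ c X T l → c * X * (4 * T * l + 4 * T * l) ≡ c * (8 * T) * (X * l)
    scale₁₆ = solve-∀

    scale₁₇ : ∀ l X T → l * (X * l) + (3 * T + 20) * (X * (l * l)) ≡ (3 * T + 21) * (X * (l * l))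
    scale₁₇ = solve-∀

    scale₁₈ : ∀ T p → 4 * T * T * (p * p) ≡ 2 * T * p * (2 * T * p)
    scale₁₈ = solve-∀

    scale₁₉ : ∀ Q T m → Q * Q * (2 * (T * (T * m))) ≡ 2 * (T * T) * (Q * Q * m)
    scale₁₉ = solve-∀

    scale₂₀ : ∀ T X s Q p l d →
      2 * (T * T) * (X * (s * s) + 4 * (Q * Q) * (p * l * (p * l)) + (Q * X * d + 2 * (Q * Q) * (l * (p * l))))
      ≡ 2 * X * (T * s * (T * s)) + 2 * (Q * Q * (l * l)) * (4 * T * T * (p * p)) + Q * X * T * (2 * (T * d)) + 2 * T * (Q * Q * (l * l)) * (2 * T * p)
    scale₂₀ = solve-∀

    scale₂₁ : ∀ X T Q l →
      2 * X * ((T + 1) * (Q * l) * ((T + 1) * (Q * l))) + 2 * (Q * Q * (l * l)) * X + Q * X * T * ((T + 10) * (Q * (l * l))) + 2 * T * (Q * Q * (l * l)) * X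
      ≡ Q * Q * (X * (l * l)) * (3 * T * T + 16 * T + 4)
    scale₂₁ = solve-∀

    scale₂₂ : ∀ Q X l T → Q * Q * (X * (l * l)) * (3 * T * T + 16 * T + 4 * T) ≡ Q * Q * (T * ((3 * T + 20) * (X * (l * l))))
    scale₂₂ = solve-∀

    scale₂₃ : ∀ T m → T * (2 * m) ≡ 2 * (T * m)
    scale₂₃ = solve-∀

    point₁ : ∀ m M l →
      98 * (l * l) + 89 * (m * l) + (2 * (5 * m * (5 * m) + l * l) + 69 * (M * l))
      ≡ 50 * (m * m) + 69 * (M * l) + 100 * (l * l) + (2 * (2 * (5 * m * l)) + 69 * (m * l))
    point₁ = solve-∀

    point₂ : ∀ m M l →
      200 * (98 * (l * l) + 89 * (m * l)) + (20 * l * (690 * M) + (100 * m * (100 * m) + 89 * l * (89 * l)) + 19 * (l * l) * 1)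
      ≡ 200 * (50 * (m * m) + 69 * (M * l)) + (20 * l * (1377 * l) + 2 * (100 * m * (89 * l)) + 19 * (l * l) * 0)
    point₂ = solve-∀

    point₃ : ∀ T l M →
      (T + 1) * (1377 * l) + (690 * ((T + 1) * M + l) + 3 * l * T)
      ≡ (T + 1) * (690 * M) + (690 * (2 * T * l) + 3 * l * 689)
    point₃ = solve-∀

    point₄ : ∀ n N β →
      n * n + (2 * (N + β * (1 * 1)) + n * n + 2 * β * n) ≡ 2 * N + (2 * (n * n) + n * (2 * β) + 2 * β * 1)
    point₄ = solve-∀

    point₅ : ∀ T l n t a c N M K →
      2 * T * l + (2 * T * (n + t + 1) + T * a + T * c + T * (T + N) + ((T + 1) * M + K) + l)
      ≡ (T + 1) * M + l + (2 * T * l + T * (n + n) + T * a + T * c + T * N + (K + T * (T + 2 * t + 2)))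
    point₅ = solve-∀

    point₆ : ∀ X → X * X + (X * X + 2 * (X * X)) ≡ 2 * X * (2 * X)
    point₆ = solve-∀

    final₁ : ∀ T X l m s M c e →
      l * l * T * (437 * X) + (8 * T * (50 * s + 69 * (M * l) + 100 * (l * l) * (c + e)) + 356 * l * (2 * (T * m) + 9 * (X * l)) + 50 * ((3 * T + 21) * (X * (l * l))) + 552 * l * ((T + 3) * (X * l)) + 800 * (l * l) * (3 * X) + X * (l * l) * T)
      ≡ l * l * T * (800 * c) + (8 * T * (X * (98 * (l * l)) + 89 * (m * l)) + 356 * l * (T * (X * l)) + 50 * (8 * (T * s)) + 552 * l * (T * M) + 800 * (l * l) * (T * e) + X * (l * l) * 8310)
    final₁ = solve-∀

    final₂ : ∀ X k → 800 * (543 * suc X) + (1000 * (800 * k) + 2172 * X + 428 * X) ≡ 800 * (1000 * k) + (1000 * (437 * X) + 2172 * 200 + 428 * 0)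
    final₂ = solve-∀

    final₃ : ∀ k d → 1000 * k * d ≡ k * (1000 * d)
    final₃ = solve-∀

-- Finite sums, spaced and dense sets, eventual statements

module Sums where

  open import Data.Nat
  open import Data.Nat.Properties
  open import Data.Nat.DivMod using (_/_; _%_; m≡m%n+[m/n]*n; m%n<n; m/n*n≤m)
  open import Data.Nat.Tactic.RingSolver using (solve-∀)
  open import Data.Product using (∃; _×_; _,_; proj₁; proj₂)
  open import Data.Sum using (_⊎_; inj₁; inj₂)
  open import Data.Empty using (⊥-elim)
  open import Relation.Nullary using (¬_; Dec; yes; no)
  open import Relation.Binary.PropositionalEquality

  -- An inequality x ≤ y transports along any identity expressing q - p = y - x.
  lin : ∀ {x y p q} → x ≤ y → p + y ≡ q + x → p ≤ q
  lin {x} {y} {p} {q} h e = +-cancelʳ-≤ y p q (≤-trans (≤-reflexive e) (+-monoʳ-≤ q h))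

  infixl 6 _⊕_
  infixr 6.5 _⊗_
  _⊕_ : ∀ {a b c d} → a ≤ b → c ≤ d → a + c ≤ b + d
  _⊕_ = +-mono-≤
  _⊗_ : ∀ k {a b} → a ≤ b → k * a ≤ k * b
  k ⊗ h = *-monoʳ-≤ k h

  ∑ : ℕ → (ℕ → ℕ) → ℕ
  ∑ zero f = 0
  ∑ (suc n) f = ∑ n f + f n

  ∑-mono : ∀ n {f g : ℕ → ℕ} → (∀ i → i < n → f i ≤ g i) → ∑ n f ≤ ∑ n g
  ∑-mono zero h = z≤n
  ∑-mono (suc n) h = +-mono-≤ (∑-mono n (λ i i<n → h i (m<n⇒m<1+n i<n))) (h n ≤-refl)

  ∑-cong : ∀ n {f g : ℕ → ℕ} → (∀ i → i < n → f i ≡ g i) → ∑ n f ≡ ∑ n g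
  ∑-cong zero h = refl
  ∑-cong (suc n) h = cong₂ _+_ (∑-cong n (λ i i<n → h i (m<n⇒m<1+n i<n))) (h n ≤-refl)

  ∑-+ : ∀ n (f g : ℕ → ℕ) → ∑ n (λ i → f i + g i) ≡ ∑ n f + ∑ n g
  ∑-+ zero f g = refl
  ∑-+ (suc n) f g = trans (cong (_+ (f n + g n)) (∑-+ n f g)) (r (∑ n f) (∑ n g) (f n) (g n))
    where
    r : ∀ a b c d → a + b + (c + d) ≡ a + c + (b + d)
    r = solve-∀

  ∑-* : ∀ n c (f : ℕ → ℕ) → ∑ n (λ i → c * f i) ≡ c * ∑ n f
  ∑-* zero c f = sym (*-zeroʳ c)
  ∑-* (suc n) c f = trans (cong (_+ c * f n) (∑-* n c f)) (sym (*-distribˡ-+ c (∑ n f) (f n)))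

  ∑-*ʳ : ∀ n (f : ℕ → ℕ) c → ∑ n (λ i → f i * c) ≡ ∑ n f * c
  ∑-*ʳ n f c = trans (∑-cong n (λ i _ → *-comm (f i) c)) (trans (∑-* n c f) (*-comm c (∑ n f)))

  ∑-const : ∀ n c → ∑ n (λ _ → c) ≡ n * c
  ∑-const zero c = refl
  ∑-const (suc n) c = trans (cong (_+ c) (∑-const n c)) (+-comm (n * c) c)

  ∑-≤const : ∀ n c {f : ℕ → ℕ} → (∀ i → i < n → f i ≤ c) → ∑ n f ≤ n * c
  ∑-≤const n c h = ≤-trans (∑-mono n h) (≤-reflexive (∑-const n c))

  ∑-zero : ∀ n → ∑ n (λ _ → 0) ≡ 0
  ∑-zero n = trans (∑-const n 0) (*-zeroʳ n)

  ∑-swap : ∀ m n (f : ℕ → ℕ → ℕ) → ∑ m (λ i → ∑ n (f i)) ≡ ∑ n (λ j → ∑ m (λ i → f i j))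
  ∑-swap zero n f = sym (∑-zero n)
  ∑-swap (suc m) n f =
    trans (cong (_+ ∑ n (f m)) (∑-swap m n f)) (sym (∑-+ n (λ j → ∑ m (λ i → f i j)) (f m)))

  ∑-split : ∀ m n (f : ℕ → ℕ) → ∑ (m + n) f ≡ ∑ m f + ∑ n (λ i → f (m + i))
  ∑-split m zero f = trans (cong (λ k → ∑ k f) (+-identityʳ m)) (sym (+-identityʳ _))
  ∑-split m (suc n) f = trans (cong (λ k → ∑ k f) (+-suc m n))
    (trans (cong (_+ f (m + n)) (∑-split m n f)) (+-assoc (∑ m f) _ _))

  ∑-monoˡ : ∀ {m n} (f : ℕ → ℕ) → m ≤ n → ∑ m f ≤ ∑ n f
  ∑-monoˡ {m} {n} f m≤n = ≤-trans (m≤m+n (∑ m f) _)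
    (≤-reflexive (trans (sym (∑-split m (n ∸ m) f)) (cong (λ k → ∑ k f) (m+[n∸m]≡n m≤n))))

  ∑-term : ∀ n (f : ℕ → ℕ) {i} → i < n → f i ≤ ∑ n f
  ∑-term n f {i} i<n = ≤-trans (m≤n+m (f i) (∑ i f)) (∑-monoˡ f i<n)

  ∑-pos : ∀ n (f : ℕ → ℕ) → 1 ≤ ∑ n f → ∃ λ i → i < n × 1 ≤ f i
  ∑-pos (suc n) f h with f n in e
  ... | suc k = n , ≤-refl , ≤-trans (s≤s z≤n) (≤-reflexive (sym e))
  ... | zero with ∑-pos n f (≤-trans h (≤-reflexive (+-identityʳ _)))
  ...   | i , i<n , p = i , m<n⇒m<1+n i<n , p

  ∑-*-∑ : ∀ m n (f g : ℕ → ℕ) → ∑ m f * ∑ n g ≡ ∑ m (λ i → ∑ n (λ j → f i * g j))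
  ∑-*-∑ m n f g = trans (sym (∑-*ʳ m f (∑ n g))) (∑-cong m (λ i _ → sym (∑-* n (f i) g)))

  ι : ∀ {P : Set} → Dec P → ℕ
  ι (yes _) = 1
  ι (no _) = 0

  ι≤1 : ∀ {P : Set} (d : Dec P) → ι d ≤ 1
  ι≤1 (yes _) = ≤-refl
  ι≤1 (no _) = z≤n

  ι-yes : ∀ {P : Set} (d : Dec P) → P → ι d ≡ 1
  ι-yes (yes _) p = refl
  ι-yes (no ¬p) p = ⊥-elim (¬p p)

  1≤ι : ∀ {P : Set} (d : Dec P) → P → 1 ≤ ι d
  1≤ι d p = ≤-reflexive (sym (ι-yes d p))

  ι-no : ∀ {P : Set} (d : Dec P) → ¬ P → ι d ≡ 0
  ι-no (yes p) ¬p = ⊥-elim (¬p p)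
  ι-no (no _) ¬p = refl

  ι-holds : ∀ {P : Set} (d : Dec P) → 1 ≤ ι d → P
  ι-holds (yes p) _ = p

  ι-mono : ∀ {P Q : Set} (d : Dec P) (e : Dec Q) → (P → Q) → ι d ≤ ι e
  ι-mono (yes p) e f = ≤-reflexive (sym (ι-yes e (f p)))
  ι-mono (no _) e f = z≤n

  ι-*≤ : ∀ {P : Set} (d : Dec P) {m n} → (P → m ≤ n) → ι d * m ≤ ι d * n
  ι-*≤ (yes p) h = *-monoʳ-≤ 1 (h p)
  ι-*≤ (no _) h = z≤n

  ι-*-drop : ∀ {P : Set} (d : Dec P) m → ι d * m ≤ m
  ι-*-drop d m = ≤-trans (*-monoˡ-≤ m (ι≤1 d)) (≤-reflexive (*-identityˡ m))

  module _ {P : ℕ → Set} (P? : ∀ n → Dec (P n)) (d : ℕ) where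

    -- The intervals of length `d` that start at the points are disjoint and end before `X + d`.
    -- Strictness is what lets `multiples` drop the error term.
    spaced-strict : ∀ X → (∀ i j → i < j → P i → P j → i + d ≤ j) →
      ∑ X (λ i → ι (P? i)) ≡ 0 ⊎ d * ∑ X (λ i → ι (P? i)) < X + d
    spaced-strict X h with last X
      where
      # : ℕ → ℕ
      # Y = ∑ Y (λ i → ι (P? i))
      -- The invariant follows the largest point `i` below `Y`: all points counted so far fit into
      -- the numbers below `i + d`.
      last : ∀ Y → # Y ≡ 0 ⊎ ∃ λ i → i < Y × P i × d * # Y ≤ i + d
      last zero = inj₁ refl
      last (suc Y) with P? Y | last Y
      ... | no _ | inj₁ e = inj₁ (trans (+-identityʳ _) e)
      ... | no _ | inj₂ (i , i<Y , p , q) =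
        inj₂ (i , m<n⇒m<1+n i<Y , p , ≤-trans (≤-reflexive (cong (d *_) (+-identityʳ _))) q)
      ... | yes p | inj₁ e = inj₂ (Y , ≤-refl , p ,
        ≤-trans (≤-reflexive (trans (cong (λ k → d * (k + 1)) e) (*-identityʳ d))) (m≤n+m d Y))
      ... | yes p | inj₂ (i , i<Y , p′ , q) = inj₂ (Y , ≤-refl , p ,
        lin (q ⊕ h i Y i<Y p′ p) (r d (# Y) i Y))
        where
        r : ∀ d k i Y → d * (k + 1) + (i + d + Y) ≡ Y + d + (d * k + (i + d))
        r = solve-∀
    ... | inj₁ e = inj₁ e
    ... | inj₂ (i , i<X , p , q) = inj₂ (≤-<-trans q (+-monoˡ-< d i<X))

    spaced : ∀ X → (∀ i j → i < j → P i → P j → i + d ≤ j) → d * ∑ X (λ i → ι (P? i)) ≤ X + d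
    spaced X h with spaced-strict X h
    ... | inj₁ e = ≤-trans (≤-reflexive (trans (cong (d *_) e) (*-zeroʳ d))) z≤n
    ... | inj₂ q = <⇒≤ q

    -- Consecutive windows of length `d` contain a point each; the incomplete last window costs the
    -- extra `d`.
    dense : .{{_ : NonZero d}} → ∀ X → (∀ i → ∃ λ j → j < d × P (i + j)) → X ≤ d * ∑ X (λ i → ι (P? i)) + d
    dense X h = begin
      X ≡⟨ m≡m%n+[m/n]*n X d ⟩
      X % d + X / d * d ≤⟨ +-mono-≤ (<⇒≤ (m%n<n X d)) (≤-reflexive (*-comm (X / d) d)) ⟩
      d + d * (X / d) ≤⟨ +-monoʳ-≤ d (*-monoʳ-≤ d (≤-trans (blocks (X / d)) (∑-monoˡ _ (m/n*n≤m X d)))) ⟩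
      d + d * ∑ X (λ i → ι (P? i)) ≡⟨ +-comm d _ ⟩
      d * ∑ X (λ i → ι (P? i)) + d ∎
      where
      open ≤-Reasoning
      blocks : ∀ q → q ≤ ∑ (q * d) (λ i → ι (P? i))
      blocks zero = z≤n
      blocks (suc q) with h (q * d)
      ... | j , j<d , p = begin
        suc q ≡⟨ +-comm 1 q ⟩
        q + 1 ≤⟨ +-mono-≤ (blocks q) (≤-trans (≤-reflexive (sym (ι-yes (P? (q * d + j)) p))) (∑-term d (λ i → ι (P? (q * d + i))) j<d)) ⟩
        ∑ (q * d) (λ i → ι (P? i)) + ∑ d (λ i → ι (P? (q * d + i))) ≡⟨ sym (∑-split (q * d) d _) ⟩
        ∑ (q * d + d) (λ i → ι (P? i)) ≡⟨ cong (λ k → ∑ k (λ i → ι (P? i))) (+-comm (q * d) d) ⟩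
        ∑ (suc q * d) (λ i → ι (P? i)) ∎

  exclusive : ∀ n {P : ℕ → Set} (P? : ∀ i → Dec (P i)) → (∀ i j → P i → P j → i ≡ j) → ∑ n (λ i → ι (P? i)) ≤ 1
  exclusive zero P? h = z≤n
  exclusive (suc n) {P} P? h with P? n
  ... | no _ = ≤-trans (≤-reflexive (+-identityʳ _)) (exclusive n P? h)
  ... | yes p = ≤-reflexive (cong (_+ 1) (trans (∑-cong n (λ i i<n → ι-no (P? i) (λ q → <-irrefl (h i n q p) i<n))) (∑-zero n)))

  Ev : (ℕ → Set) → Set
  Ev P = ∃ λ n₀ → ∀ n → n₀ ≤ n → P n

  ev-map : ∀ {P Q : ℕ → Set} → (∀ n → P n → Q n) → Ev P → Ev Q
  ev-map f (n₀ , h) = n₀ , λ n n₀≤n → f n (h n n₀≤n)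

  infixr 5 _&_
  _&_ : ∀ {P Q : ℕ → Set} → Ev P → Ev Q → Ev (λ n → P n × Q n)
  (m , p) & (n , q) = m ⊔ n , λ k le → p k (≤-trans (m≤m⊔n m n) le) , q k (≤-trans (m≤n⊔m m n) le)

  Unbounded : (ℕ → ℕ) → Set
  Unbounded f = ∀ K → Ev (λ n → K ≤ f n)

  ev-∘ : ∀ {P : ℕ → Set} {f : ℕ → ℕ} → Unbounded f → Ev P → Ev (λ n → P (f n))
  ev-∘ u (n₀ , h) = ev-map (λ n → h _) (u n₀)

  ev-≥ : Unbounded (λ n → n)
  ev-≥ K = K , λ n h → h

-- Rounded logarithms

module Primes (T : ℕ) (1≤T : 1 ≤ T) where

  open import Data.Nat
  open import Data.Nat.Properties
  open import Data.Nat.Divisibility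
  open import Data.Nat.Primality
  open import Data.Nat.Primality.Factorisation using (factorise)
  open import Data.Nat.Logarithm using (⌊log₂_⌋; ⌊log₂⌋-mono-≤; ⌊log₂⌊n/2⌋⌋≡⌊log₂n⌋∸1; ⌊log₂[2^n]⌋≡n)
  open import Data.Nat.Induction using (<-rec)
  open import Data.Nat.Tactic.RingSolver using (solve-∀)
  open import Data.Nat.ListAction using (product)
  open import Data.List using ([]; _∷_)
  open import Data.List.Relation.Unary.All using ([]; _∷_)
  open import Data.Product using (∃; _×_; _,_; proj₁; proj₂)
  open import Data.Sum using (inj₁; inj₂)
  open import Data.Empty using (⊥-elim)
  open import Relation.Nullary using (¬_; Dec; yes; no)
  open import Relation.Nullary.Decidable using (_×-dec_)
  open import Relation.Binary.PropositionalEquality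
  open Sums

  log₂-< : ∀ k n → n < 2 ^ suc k → ⌊log₂ n ⌋ ≤ k
  log₂-< zero zero h = z≤n
  log₂-< zero (suc zero) h = z≤n
  log₂-< zero (suc (suc n)) (s≤s (s≤s ()))
  log₂-< (suc k) n h = ≤-trans (n≤1+[n∸1] ⌊log₂ n ⌋)
    (s≤s (≤-trans (≤-reflexive (sym (⌊log₂⌊n/2⌋⌋≡⌊log₂n⌋∸1 n))) (log₂-< k ⌊ n /2⌋ half)))
    where
    n≤1+[n∸1] : ∀ m → m ≤ suc (m ∸ 1)
    n≤1+[n∸1] zero = z≤n
    n≤1+[n∸1] (suc m) = ≤-refl
    twice : ∀ n → 2 * ⌊ n /2⌋ ≤ n
    twice n = ≤-trans (≤-reflexive (cong (⌊ n /2⌋ +_) (+-identityʳ _)))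
      (≤-trans (+-monoʳ-≤ ⌊ n /2⌋ (⌊n/2⌋≤⌈n/2⌉ n)) (≤-reflexive (⌊n/2⌋+⌈n/2⌉≡n n)))
    half : ⌊ n /2⌋ < 2 ^ suc k
    half = *-cancelˡ-< 2 ⌊ n /2⌋ (2 ^ suc k) (≤-<-trans (twice n) h)

  log₂-≥ : ∀ k n → 2 ^ k ≤ n → k ≤ ⌊log₂ n ⌋
  log₂-≥ k n h = ≤-trans (≤-reflexive (sym (⌊log₂[2^n]⌋≡n k))) (⌊log₂⌋-mono-≤ h)

  2^log₂ : ∀ n → 1 ≤ n → 2 ^ ⌊log₂ n ⌋ ≤ n
  2^log₂ n 1≤n with ⌊log₂ n ⌋ in e
  ... | zero = 1≤n
  ... | suc k with 2 ^ suc k ≤? n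
  ...   | yes h = h
  ...   | no h = ⊥-elim (<-irrefl refl (≤-trans (≤-reflexive (sym e)) (log₂-< k n (≰⇒> h))))

  <2^1+log₂ : ∀ n → n < 2 ^ suc ⌊log₂ n ⌋
  <2^1+log₂ n with 2 ^ suc ⌊log₂ n ⌋ ≤? n
  ... | yes h = ⊥-elim (<-irrefl refl (log₂-≥ _ n h))
  ... | no h = ≰⇒> h

  -- T log₂ n up to an error below 1, so relative to log₂ n the error is below 1 / T.
  L : ℕ → ℕ
  L n = ⌊log₂ (n ^ T) ⌋

  L-mono : ∀ {m n} → m ≤ n → L m ≤ L n
  L-mono h = ⌊log₂⌋-mono-≤ (^-monoˡ-≤ T h)

  ^-distribʳ-* : ∀ m n k → (m * n) ^ k ≡ m ^ k * n ^ k
  ^-distribʳ-* m n zero = refl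
  ^-distribʳ-* m n (suc k) = trans (cong (m * n *_) (^-distribʳ-* m n k)) (r m n (m ^ k) (n ^ k))
    where
    r : ∀ a b c d → a * b * (c * d) ≡ a * c * (b * d)
    r = solve-∀

  1≤^ : ∀ {m} k → 1 ≤ m → 1 ≤ m ^ k
  1≤^ zero h = ≤-refl
  1≤^ (suc k) h = *-mono-≤ h (1≤^ k h)

  L-sup : ∀ {m n} → 1 ≤ m → 1 ≤ n → L m + L n ≤ L (m * n)
  L-sup {m} {n} 1≤m 1≤n = log₂-≥ _ _ (begin
    2 ^ (L m + L n) ≡⟨ ^-distribˡ-+-* 2 (L m) (L n) ⟩
    2 ^ L m * 2 ^ L n ≤⟨ *-mono-≤ (2^log₂ _ (1≤^ T 1≤m)) (2^log₂ _ (1≤^ T 1≤n)) ⟩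
    m ^ T * n ^ T ≡⟨ sym (^-distribʳ-* m n T) ⟩
    (m * n) ^ T ∎)
    where open ≤-Reasoning

  -- Rounding costs at most 1 per product. By `L-≥T` this is at most a fraction `1 / T` of the
  -- logarithm of any factor that is at least 2.
  L-sub : ∀ m n → L (m * n) ≤ L m + L n + 1
  L-sub m n = log₂-< _ _ (begin-strict
    (m * n) ^ T ≡⟨ ^-distribʳ-* m n T ⟩
    m ^ T * n ^ T <⟨ *-mono-< (<2^1+log₂ (m ^ T)) (<2^1+log₂ (n ^ T)) ⟩
    2 ^ suc (L m) * 2 ^ suc (L n) ≡⟨ sym (^-distribˡ-+-* 2 (suc (L m)) (suc (L n))) ⟩
    2 ^ (suc (L m) + suc (L n)) ≡⟨ cong (2 ^_) (r (L m) (L n)) ⟩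
    2 ^ suc (L m + L n + 1) ∎)
    where
    open ≤-Reasoning
    r : ∀ a b → suc a + suc b ≡ suc (a + b + 1)
    r = solve-∀

  -- A factor 2 causes no rounding loss, because `2 ^ T` is itself a power of 2.
  L-double : ∀ n → L (2 * n) ≤ T + L n
  L-double n = log₂-< _ _ (begin-strict
    (2 * n) ^ T ≡⟨ ^-distribʳ-* 2 n T ⟩
    2 ^ T * n ^ T <⟨ *-monoʳ-< (2 ^ T) {{m^n≢0 2 T}} (<2^1+log₂ (n ^ T)) ⟩
    2 ^ T * 2 ^ suc (L n) ≡⟨ sym (^-distribˡ-+-* 2 T (suc (L n))) ⟩
    2 ^ (T + suc (L n)) ≡⟨ cong (2 ^_) (+-suc T (L n)) ⟩
    2 ^ suc (T + L n) ∎)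
    where open ≤-Reasoning

  L-≥T : ∀ {n} → 2 ≤ n → T ≤ L n
  L-≥T h = log₂-≥ _ _ (^-monoˡ-≤ T h)

  L-1 : L 1 ≡ 0
  L-1 = cong ⌊log₂_⌋ (^-zeroˡ T)

  L-2^ : ∀ k → L (2 ^ k) ≤ k * T
  L-2^ zero = ≤-reflexive L-1
  L-2^ (suc k) = ≤-trans (L-double (2 ^ k)) (+-monoʳ-≤ T (L-2^ k))

  L-^-lower : ∀ {n} e → 1 ≤ n → e * L n ≤ L (n ^ e)
  L-^-lower zero h = z≤n
  L-^-lower {n} (suc e) h = ≤-trans (+-monoʳ-≤ (L n) (L-^-lower e h)) (L-sup h (1≤^ e h))

  L-^-upper : ∀ n e → L (n ^ e) ≤ e * (L n + 1)
  L-^-upper n zero = ≤-reflexive L-1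
  L-^-upper n (suc e) = ≤-trans (L-sub n (n ^ e)) (lin (L-^-upper n e) (r (L n) (L (n ^ e)) (e * (L n + 1))))
    where
    r : ∀ a b c → a + b + 1 + c ≡ a + 1 + c + b
    r = solve-∀

  L-unbounded : Unbounded L
  L-unbounded K = 2 ^ K , λ n h → log₂-≥ K _ (≤-trans h (n≤n^T n))
    where
    n≤n^T : ∀ n → n ≤ n ^ T
    n≤n^T zero = z≤n
    n≤n^T (suc n) = ≤-trans (≤-reflexive (sym (^-identityʳ (suc n)))) (^-monoʳ-≤ (suc n) 1≤T)

  -- The logarithm of an integer as a sum over its prime factors

  pow-∣-cancel : ∀ {p} → Prime p → ∀ e k D → ¬ p ∣ D → p ^ e ∣ k * D → p ^ e ∣ k
  pow-∣-cancel pp zero k D _ _ = 1∣ k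
  pow-∣-cancel {p} pp (suc e) k D p∤D h with euclidsLemma k D pp (m*n∣⇒m∣ p (p ^ e) h)
  ... | inj₂ p∣D = ⊥-elim (p∤D p∣D)
  ... | inj₁ (divides k′ refl) = subst (p * p ^ e ∣_) (*-comm p k′) (*-monoʳ-∣ p
    (pow-∣-cancel pp e k′ D p∤D (*-cancelˡ-∣ p {{prime⇒nonZero pp}} (subst (p * p ^ e ∣_) (r k′ p D) h))))
    where
    r : ∀ k p D → k * p * D ≡ p * (k * D)
    r = solve-∀

  prime≥2 : ∀ {p} → Prime p → 2 ≤ p
  prime≥2 pp = nonTrivial⇒n>1 _ {{prime⇒nonTrivial pp}}

  prime≥1 : ∀ {p} → Prime p → 1 ≤ p
  prime≥1 pp = ≤-trans (s≤s z≤n) (prime≥2 pp)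

  prime∣prime^ : ∀ {p q} → Prime p → Prime q → ∀ e → q ∣ p ^ e → q ≡ p
  prime∣prime^ {p} {q} pp qq zero h = ⊥-elim (<-irrefl (sym (∣1⇒≡1 h)) (prime≥2 qq))
  prime∣prime^ {p} {q} pp qq (suc e) h with euclidsLemma p (p ^ e) qq h
  ... | inj₂ h′ = prime∣prime^ pp qq e h′
  ... | inj₁ h′ with prime⇒irreducible pp h′
  ...   | inj₁ q≡1 = ⊥-elim (<-irrefl (sym q≡1) (prime≥2 qq))
  ...   | inj₂ q≡p = q≡p

  -- Powers of distinct primes that divide `N` have a product dividing `N`, and `L` is
  -- superadditive.
  ∑-L≤ : ∀ z N (e : ℕ → ℕ) → 1 ≤ N → (∀ p → Prime p → p ^ e p ∣ N) →
    ∑ z (λ p → ι (prime? p) * (e p * L p)) ≤ L N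
  ∑-L≤ z N e 1≤N h with go z
    where
    -- `D` is the product of the powers `p ^ e p` with `p < z`. As its prime factors lie below `z`,
    -- it is coprime to the next prime power.
    go : ∀ z → ∃ λ D → D ∣ N × 1 ≤ D × (∀ q → Prime q → q ∣ D → q < z) × ∑ z (λ p → ι (prime? p) * (e p * L p)) ≤ L D
    go zero = 1 , 1∣ N , ≤-refl , (λ q qq q∣1 → ⊥-elim (<-irrefl (sym (∣1⇒≡1 q∣1)) (prime≥2 qq))) , z≤n
    go (suc z) with go z | prime? z
    ... | D , D∣N , 1≤D , D<z , s | no _ = D , D∣N , 1≤D , (λ q qq q∣D → m<n⇒m<1+n (D<z q qq q∣D)) , ≤-trans (≤-reflexive (+-identityʳ _)) s
    ... | D , divides k eq , 1≤D , D<z , s | yes pp = z ^ e z * D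
      , subst (z ^ e z * D ∣_) (sym eq) (*-monoˡ-∣ D (pow-∣-cancel pp (e z) k D (λ z∣D → <-irrefl refl (D<z z pp z∣D)) (subst (z ^ e z ∣_) eq (h z pp))))
      , *-mono-≤ (1≤^ (e z) (prime≥1 pp)) 1≤D
      , D′<
      , ≤-trans (+-mono-≤ s (≤-trans (≤-reflexive (+-identityʳ _)) (L-^-lower (e z) (prime≥1 pp))))
          (≤-trans (≤-reflexive (+-comm (L D) _)) (L-sup (1≤^ (e z) (prime≥1 pp)) 1≤D))
      where
      D′< : ∀ q → Prime q → q ∣ z ^ e z * D → q < suc z
      D′< q qq h with euclidsLemma (z ^ e z) D qq h
      ... | inj₁ h′ = s≤s (≤-reflexive (prime∣prime^ pp qq (e z) h′))
      ... | inj₂ h′ = m<n⇒m<1+n (D<z q qq h′)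
  ... | D , D∣N , 1≤D , _ , s = ≤-trans s (L-mono (∣⇒≤ {{>-nonZero 1≤N}} D∣N))

  prime-divisor : ∀ n → 2 ≤ n → ∃ λ p → Prime p × p ∣ n
  prime-divisor n 2≤n with factorise n {{>-nonZero (<⇒≤ 2≤n)}}
  ... | record { factors = [] ; isFactorisation = e } = ⊥-elim (<-irrefl (sym e) 2≤n)
  ... | record { factors = p ∷ ps ; isFactorisation = e ; factorsPrime = pp ∷ _ } =
    p , pp , divides (product ps) (trans e (*-comm p (product ps)))

  record Strip (p N : ℕ) : Set where
    constructor strip
    field
      exponent rest : ℕ
      factored : N ≡ p ^ exponent * rest
      p∤rest : ¬ p ∣ rest
      1≤rest : 1 ≤ rest

  strip-prime : ∀ {p} → Prime p → ∀ N → 1 ≤ N → Strip p N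
  strip-prime {p} pp = <-rec _ go
    where
    go : ∀ N → (∀ {M} → M < N → 1 ≤ M → Strip p M) → 1 ≤ N → Strip p N
    go N rec 1≤N with p ∣? N
    ... | no p∤N = strip 0 N (sym (*-identityˡ N)) p∤N 1≤N
    ... | yes p∣N@(divides k refl) with rec (quotient-< p∣N {{prime⇒nonTrivial pp}} {{>-nonZero 1≤N}}) (>-nonZero⁻¹ k {{quotient≢0 p∣N {{>-nonZero 1≤N}}}})
    ...   | strip e M eq a b = strip (suc e) M (trans (cong (_* p) eq) (r p (p ^ e) M)) a b
      where
      r : ∀ a b c → b * c * a ≡ a * b * c
      r = solve-∀

  ∑-ι≤ : ∀ R z → ∑ z (λ p → ι (p ≤? R)) ≤ suc R
  ∑-ι≤ R z with z ≤? suc R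
  ... | yes h = ≤-trans (∑-≤const z 1 (λ i _ → ι≤1 (i ≤? R))) (≤-trans (≤-reflexive (*-identityʳ z)) h)
  ... | no h = begin
    ∑ z f ≡⟨ cong (λ k → ∑ k f) (sym (m+[n∸m]≡n (<⇒≤ (≰⇒> h)))) ⟩
    ∑ (suc R + (z ∸ suc R)) f ≡⟨ ∑-split (suc R) (z ∸ suc R) f ⟩
    ∑ (suc R) f + ∑ (z ∸ suc R) (λ i → f (suc R + i)) ≤⟨ +-mono-≤ (∑-≤const (suc R) 1 (λ i _ → ι≤1 (i ≤? R)))
       (≤-reflexive (trans (∑-cong (z ∸ suc R) (λ i _ → ι-no (suc R + i ≤? R) (λ q → <-irrefl refl (≤-trans (m≤m+n (suc R) i) q)))) (∑-zero (z ∸ suc R)))) ⟩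
    suc R * 1 + 0 ≡⟨ trans (+-identityʳ _) (*-identityʳ _) ⟩
    suc R ∎
    where
    open ≤-Reasoning
    f : ℕ → ℕ
    f p = ι (p ≤? R)

  -- A converse of `∑-L≤` for typical `N`: nearly all of `L N` is carried by prime factors
  -- satisfying `G`, each counted once. The primes up to `R` contribute an amount bounded
  -- independently of `N`.
  module Radical (R k : ℕ) {G : ℕ → Set} (G? : ∀ p → Dec (G p)) where

    cost : ℕ
    cost = T * (k * (L R + 1))

    weight : ℕ → ℕ → ℕ
    weight N p = ι (G? p) * (ι (p ∣? N) * L p)

    private
      weight-mono : ∀ {M N} → M ∣ N → ∀ p → weight M p ≤ weight N p
      weight-mono {M} {N} M∣N p = *-monoʳ-≤ (ι (G? p)) (*-monoˡ-≤ (L p) (ι-mono (p ∣? M) (p ∣? N) (λ h → ∣-trans h M∣N)))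

      go : ∀ z N → 1 ≤ N → (∀ p → Prime p → p ∣ N → p < z) →
        (∀ p → Prime p → R < p → ¬ p * p ∣ N) → (∀ p → Prime p → p ≤ R → ¬ p ^ k ∣ N) →
        (∀ p → Prime p → R < p → p ∣ N → G p) →
        T * L N ≤ (T + 1) * ∑ z (weight N) + ∑ z (λ p → ι (p ≤? R)) * cost
      go zero N 1≤N <z _ _ _ with N ≤? 1
      ... | yes N≤1 = ≤-trans (*-monoʳ-≤ T (L-mono N≤1)) (≤-trans (≤-reflexive (trans (cong (T *_) L-1) (*-zeroʳ T))) z≤n)
      ... | no N≰1 with prime-divisor N (≰⇒> N≰1)
      ...   | p , pp , p∣N with <z p pp p∣N
      ...     | ()
      go (suc z) N 1≤N <z sq pw gd with prime? z
      ... | no ¬p = ≤-trans (go z N 1≤N (λ p pp p∣N → ≤∧≢⇒< (≤-pred (<z p pp p∣N)) (λ { refl → ¬p pp })) sq pw gd)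
        (+-mono-≤ (*-monoʳ-≤ (T + 1) (m≤m+n _ _)) (*-monoˡ-≤ cost (m≤m+n (∑ z (λ p → ι (p ≤? R))) _)))
      ... | yes pp with strip-prime pp N 1≤N
      ...   | strip e M eq z∤M 1≤M = step
        where
        M∣N : M ∣ N
        M∣N = divides (z ^ e) eq
        ih : T * L M ≤ (T + 1) * ∑ z (weight M) + ∑ z (λ p → ι (p ≤? R)) * cost
        ih = go z M 1≤M (λ p pq p∣M → ≤∧≢⇒< (≤-pred (<z p pq (∣-trans p∣M M∣N))) (λ { refl → z∤M p∣M }))
          (λ p pq R<p h → sq p pq R<p (∣-trans h M∣N)) (λ p pq R<p h → pw p pq R<p (∣-trans h M∣N))
          (λ p pq R<p h → gd p pq R<p (∣-trans h M∣N))
        ih′ : T * L M ≤ (T + 1) * ∑ z (weight N) + ∑ z (λ p → ι (p ≤? R)) * cost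
        ih′ = ≤-trans ih (+-monoˡ-≤ _ (*-monoʳ-≤ (T + 1) (∑-mono z (λ p _ → weight-mono M∣N p))))
        A B : ℕ
        A = ∑ z (weight N)
        B = ∑ z (λ p → ι (p ≤? R))
        step : T * L N ≤ (T + 1) * (A + weight N z) + (B + ι (z ≤? R)) * cost
        step with z ≤? R
        -- The whole power of a prime up to `R` is charged to `cost`, whether or not the prime
        -- satisfies `G`.
        ... | yes z≤R = ≤-trans (*-monoʳ-≤ T LN) (≤-trans
                (lin ih′ (r T (k * (L R + 1)) (L M) ((T + 1) * A) B))
                (+-monoˡ-≤ _ (*-monoʳ-≤ (T + 1) (m≤m+n A (weight N z)))))
          where
          e<k : e < k
          e<k with k ≤? e
          ... | no h = ≰⇒> h
          ... | yes h = ⊥-elim (pw z pp z≤R (∣-trans (subst (z ^ k ∣_) (trans (sym (^-distribˡ-+-* z k (e ∸ k))) (cong (z ^_) (m+[n∸m]≡n h))) (m∣m*n (z ^ (e ∸ k)))) (divides M (trans eq (*-comm _ M)))))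
          LN : L N ≤ L M + k * (L R + 1)
          LN = begin
            L N ≡⟨ cong L eq ⟩
            L (z ^ e * M) ≤⟨ L-sub (z ^ e) M ⟩
            L (z ^ e) + L M + 1 ≤⟨ +-monoˡ-≤ 1 (+-monoˡ-≤ (L M) (≤-trans (L-^-upper z e) (*-monoʳ-≤ e (+-monoˡ-≤ 1 (L-mono z≤R))))) ⟩
            e * (L R + 1) + L M + 1 ≤⟨ +-monoʳ-≤ (e * (L R + 1) + L M) (m≤n+m 1 (L R)) ⟩
            e * (L R + 1) + L M + (L R + 1) ≡⟨ r′ e (L R + 1) (L M) ⟩
            L M + suc e * (L R + 1) ≤⟨ +-monoʳ-≤ (L M) (*-monoˡ-≤ (L R + 1) e<k) ⟩
            L M + k * (L R + 1) ∎
            where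
            open ≤-Reasoning
            r′ : ∀ e l m → e * l + m + l ≡ m + suc e * l
            r′ = solve-∀
          r : ∀ T c m A B → T * (m + c) + (A + B * (T * c)) ≡ A + (B + 1) * (T * c) + T * m
          r = solve-∀
        ... | no z≰R = large e eq
          where
          large : ∀ e → N ≡ z ^ e * M → T * L N ≤ (T + 1) * (A + weight N z) + (B + 0) * cost
          large zero eq0 = ≤-trans (≤-reflexive (cong (λ n → T * L n) (trans eq0 (*-identityˡ M))))
                (≤-trans ih′ (+-mono-≤ (*-monoʳ-≤ (T + 1) (m≤m+n A _)) (*-monoˡ-≤ cost (m≤m+n B 0))))
          large (suc (suc e′)) eq2 = ⊥-elim (sq z pp (≰⇒> z≰R) (divides (z ^ e′ * M) (trans eq2 (r z (z ^ e′) M))))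
            where
            r : ∀ a b c → a * (a * b) * c ≡ b * c * (a * a)
            r = solve-∀
          -- The rounding loss 1, multiplied by `T`, is at most `L z`. This turns the factor `T`
          -- into `T + 1`.
          large (suc zero) eq1 = begin
            T * L N ≤⟨ *-monoʳ-≤ T (≤-trans (≤-reflexive (cong L (trans eq1 (cong (_* M) (*-identityʳ z))))) (L-sub z M)) ⟩
            T * (L z + L M + 1) ≤⟨ lin (ih′ ⊕ L-≥T (prime≥2 pp)) (r T (L z) (L M) A B cost) ⟩
            (T + 1) * (A + L z) + (B + 0) * cost ≡⟨ cong (λ w → (T + 1) * (A + w) + (B + 0) * cost) (sym (trans (cong₂ (λ i j → i * (j * L z)) (ι-yes (G? z) (gd z pp (≰⇒> z≰R) z∣N)) (ι-yes (z ∣? N) z∣N)) (trans (*-identityˡ _) (*-identityˡ _)))) ⟩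
            (T + 1) * (A + weight N z) + (B + 0) * cost ∎
            where
            open ≤-Reasoning
            z∣N : z ∣ N
            z∣N = divides M (trans eq1 (trans (cong (_* M) (*-identityʳ z)) (*-comm z M)))
            r : ∀ T l m A B c → T * (l + m + 1) + ((T + 1) * A + B * c + l) ≡ (T + 1) * (A + l) + (B + 0) * c + (T * m + T)
            r = solve-∀

    radical : ∀ z N → 1 ≤ N → (∀ p → Prime p → p ∣ N → p < z) →
        (∀ p → Prime p → R < p → ¬ p * p ∣ N) → (∀ p → Prime p → p ≤ R → ¬ p ^ k ∣ N) →
        (∀ p → Prime p → R < p → p ∣ N → G p) →
        T * L N ≤ (T + 1) * ∑ z (weight N) + suc R * cost
    radical z N 1≤N <z a b c = ≤-trans (go z N 1≤N <z a b c) (+-monoʳ-≤ _ (*-monoˡ-≤ cost (∑-ι≤ R z)))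

  -- A Chebyshev bound: the primes have density zero

  binomial : ℕ → ℕ → ℕ
  binomial m zero = 1
  binomial zero (suc n) = 1
  binomial (suc m) (suc n) = binomial m (suc n) + binomial (suc m) n

  binomial≤2^ : ∀ m n → binomial m n ≤ 2 ^ (m + n)
  binomial≤2^ m zero = 1≤^ (m + 0) (s≤s z≤n)
  binomial≤2^ zero (suc n) = 1≤^ (suc n) (s≤s z≤n)
  binomial≤2^ (suc m) (suc n) = ≤-trans
    (+-mono-≤ (binomial≤2^ m (suc n)) (≤-trans (binomial≤2^ (suc m) n) (≤-reflexive (cong (2 ^_) (sym (+-suc m n))))))
    (≤-reflexive (cong (2 ^ (m + suc n) +_) (sym (+-identityʳ _))))

  -- `binomial m n` is the coefficient "m + n choose n". Indexing it by the two parts makes Pascal's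
  -- rule structural and keeps subtraction out of the factorial formula.
  binomial-! : ∀ m n → binomial m n * (m ! * n !) ≡ (m + n) !
  binomial-! m zero = trans (+-identityʳ _) (trans (*-identityʳ _) (cong _! (sym (+-identityʳ m))))
  binomial-! zero (suc n) = trans (+-identityʳ _) (+-identityʳ _)
  binomial-! (suc m) (suc n) = trans (r (suc m) (suc n) (binomial m (suc n)) (binomial (suc m) n) (m !) (n !))
    (trans (cong₂ (λ x y → suc m * x + suc n * y) (binomial-! m (suc n)) (trans (binomial-! (suc m) n) (cong _! (sym (+-suc m n)))))
    (trans (sym (*-distribʳ-+ ((m + suc n) !) (suc m) (suc n))) refl))
    where
    r : ∀ a b x y c d → (x + y) * (a * c * (b * d)) ≡ a * (x * (c * (b * d))) + b * (y * (a * c * d))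
    r = solve-∀

  prime∣!⇒≤ : ∀ {p} → Prime p → ∀ n → p ∣ n ! → p ≤ n
  prime∣!⇒≤ pp zero h = ⊥-elim (<-irrefl (sym (∣1⇒≡1 h)) (prime≥2 pp))
  prime∣!⇒≤ pp (suc n) h with euclidsLemma (suc n) (n !) pp h
  ... | inj₁ h′ = ∣⇒≤ h′
  ... | inj₂ h′ = m≤n⇒m≤1+n (prime∣!⇒≤ pp n h′)

  π : ℕ → ℕ
  π z = ∑ z (λ p → ι (prime? p))

  π≤ : ∀ z → π z ≤ z
  π≤ z = ≤-trans (∑-≤const z 1 (λ p _ → ι≤1 (prime? p))) (≤-reflexive (*-identityʳ z))

  -- Every prime in `(n , 2 n]` divides the central binomial coefficient, which is at most `4 ^ n`.
  π-doubling : ∀ n → 1 ≤ n → π (suc (n + n)) * L n ≤ π (suc n) * L n + (n + n) * T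
  π-doubling n 1≤n = begin
    π (suc (n + n)) * L n ≡⟨ cong (_* L n) (∑-split (suc n) n (λ p → ι (prime? p))) ⟩
    (π (suc n) + ∑ n (λ i → ι (prime? (suc n + i)))) * L n ≡⟨ *-distribʳ-+ (L n) (π (suc n)) _ ⟩
    π (suc n) * L n + ∑ n (λ i → ι (prime? (suc n + i))) * L n ≤⟨ +-monoʳ-≤ _ upper ⟩
    π (suc n) * L n + (n + n) * T ∎
    where
    open ≤-Reasoning
    In? : ∀ p → Dec (n < p × p ≤ n + n)
    In? p = (n <? p) ×-dec (p ≤? n + n)
    e : ℕ → ℕ
    e p = ι (In? p)
    1≤B : 1 ≤ binomial n n
    1≤B = n≢0⇒n>0 (λ B≡0 → >⇒≢ (1≤n! (n + n)) (trans (sym (binomial-! n n)) (cong (_* (n ! * n !)) B≡0)))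
    div : ∀ p → Prime p → p ^ e p ∣ binomial n n
    div p pp with In? p
    ... | no _ = 1∣ _
    ... | yes (n<p , p≤2n) = subst (_∣ binomial n n) (sym (*-identityʳ p)) p∣B
      where
      p∣! : p ∣ (n + n) !
      p∣! = ∣-trans (p∣p! p (prime≥1 pp)) (m≤n⇒m!∣n! p≤2n)
        where
        p∣p! : ∀ p → 1 ≤ p → p ∣ p !
        p∣p! (suc p) _ = m∣m*n (p !)
      p∣B : p ∣ binomial n n
      p∣B with euclidsLemma (binomial n n) (n ! * n !) pp (subst (p ∣_) (sym (binomial-! n n)) p∣!)
      ... | inj₁ h = h
      ... | inj₂ h with euclidsLemma (n !) (n !) pp h
      ...   | inj₁ h′ = ⊥-elim (<-irrefl refl (<-≤-trans n<p (prime∣!⇒≤ pp n h′)))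
      ...   | inj₂ h′ = ⊥-elim (<-irrefl refl (<-≤-trans n<p (prime∣!⇒≤ pp n h′)))
    w : ℕ → ℕ
    w p = ι (prime? p) * (e p * L p)
    upper : ∑ n (λ i → ι (prime? (suc n + i))) * L n ≤ (n + n) * T
    upper = begin
      ∑ n (λ i → ι (prime? (suc n + i))) * L n ≡⟨ sym (∑-*ʳ n _ (L n)) ⟩
      ∑ n (λ i → ι (prime? (suc n + i)) * L n) ≤⟨ ∑-mono n (λ i i<n → *-monoʳ-≤ (ι (prime? (suc n + i)))
          (≤-trans (L-mono (≤-trans (n≤1+n n) (m≤m+n (suc n) i)))
          (≤-reflexive (sym (trans (cong (_* L (suc n + i)) (ι-yes (In? (suc n + i)) (s≤s (m≤m+n n i) , ≤-trans (≤-reflexive (sym (+-suc n i))) (+-monoʳ-≤ n i<n)))) (*-identityˡ _)))))) ⟩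
      ∑ n (λ i → w (suc n + i)) ≤⟨ m≤n+m _ (∑ (suc n) w) ⟩
      ∑ (suc n) w + ∑ n (λ i → w (suc n + i)) ≡⟨ sym (∑-split (suc n) n w) ⟩
      ∑ (suc n + n) w ≤⟨ ∑-L≤ (suc n + n) (binomial n n) e 1≤B div ⟩
      L (binomial n n) ≤⟨ L-mono (binomial≤2^ n n) ⟩
      L (2 ^ (n + n)) ≤⟨ L-2^ (n + n) ⟩
      (n + n) * T ∎

  -- Once `L n` exceeds a large multiple of `T`, passing from `n` to `2 n` adds few primes;
  -- induction on halves sums these gains as a geometric series.
  π-sublinear : ∀ E → Ev (λ x → E * π x ≤ x)
  π-sublinear E = ev-map conclude (ev-≥ C)
    where
    open ≤-Reasoning
    -- The induction gives `E′ * π x` at most `2 x + C`. The factor 4 leaves room for absorbing `C`.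
    E′ : ℕ
    E′ = 4 * E
    u : ℕ
    u = proj₁ (L-unbounded (2 * T * E′))
    n₀ : ℕ
    n₀ = suc u + E′
    big : ∀ n → n₀ ≤ n → 2 * T * E′ ≤ L n × 1 ≤ n × E′ ≤ n
    big n h = proj₂ (L-unbounded (2 * T * E′)) n (≤-trans (≤-trans (n≤1+n u) (m≤m+n (suc u) E′)) h)
      , ≤-trans (s≤s z≤n) h , ≤-trans (m≤n+m E′ (suc u)) h
    C : ℕ
    C = E′ * (n₀ + n₀ + 2)
    double : ∀ n → n₀ ≤ n → E′ * π (suc (n + n)) ≤ E′ * π (suc n) + n
    double n h with big n h
    ... | h1 , h2 , h3 with L n in eqL
    ...   | zero = ≤-trans (≤-reflexive (cong (_* π (suc (n + n))) (E′≡0 h1))) z≤n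
      where
      E′≡0 : 2 * T * E′ ≤ 0 → E′ ≡ 0
      E′≡0 q = n≤0⇒n≡0 (≤-trans (≤-trans (≤-reflexive (sym (*-identityˡ E′))) (*-monoˡ-≤ E′ (*-mono-≤ {1} {2} (s≤s z≤n) 1≤T))) q)
    ...   | suc l = *-cancelˡ-≤ (suc l) (begin
        suc l * (E′ * π (suc (n + n))) ≡⟨ r1 (suc l) E′ (π (suc (n + n))) ⟩
        E′ * (π (suc (n + n)) * suc l) ≤⟨ *-monoʳ-≤ E′ (subst (λ k → π (suc (n + n)) * k ≤ π (suc n) * k + (n + n) * T) eqL (π-doubling n h2)) ⟩
        E′ * (π (suc n) * suc l + (n + n) * T) ≡⟨ r2 E′ (π (suc n)) (suc l) n T ⟩
        suc l * (E′ * π (suc n)) + 2 * T * E′ * n ≤⟨ +-monoʳ-≤ _ (*-monoˡ-≤ n h1) ⟩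
        suc l * (E′ * π (suc n)) + suc l * n ≡⟨ sym (*-distribˡ-+ (suc l) _ n) ⟩
        suc l * (E′ * π (suc n) + n) ∎)
      where
      r1 : ∀ a b c → a * (b * c) ≡ b * (c * a)
      r1 = solve-∀
      r2 : ∀ e p l n t → e * (p * l + (n + n) * t) ≡ l * (e * p) + 2 * t * e * n
      r2 = solve-∀
    bound : ∀ m → E′ * π (suc m) ≤ 2 * m + C
    bound = <-rec _ go
      where
      go : ∀ m → (∀ {k} → k < m → E′ * π (suc k) ≤ 2 * k + C) → E′ * π (suc m) ≤ 2 * m + C
      go m rec with m ≤? n₀ + n₀ + 1
      ... | yes h = ≤-trans (*-monoʳ-≤ E′ (≤-trans (π≤ (suc m)) (≤-trans (s≤s h) (≤-reflexive (sym (+-suc (n₀ + n₀) 1)))))) (m≤n+m C (2 * m))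
      ... | no h = begin
        E′ * π (suc m) ≤⟨ *-monoʳ-≤ E′ (≤-trans (∑-monoˡ _ (s≤s m≤)) (+-monoʳ-≤ (π (suc (k + k))) (ι≤1 (prime? (suc (k + k)))))) ⟩
        E′ * (π (suc (k + k)) + 1) ≡⟨ trans (*-distribˡ-+ E′ _ 1) (cong (E′ * π (suc (k + k)) +_) (*-identityʳ E′)) ⟩
        E′ * π (suc (k + k)) + E′ ≤⟨ +-monoˡ-≤ E′ (double k n₀≤k) ⟩
        E′ * π (suc k) + k + E′ ≤⟨ +-mono-≤ (+-monoˡ-≤ k (rec k<m)) (proj₂ (proj₂ (big k n₀≤k))) ⟩
        2 * k + C + k + k ≤⟨ lin (2 ⊗ 2k≤) (r k m C) ⟩
        2 * m + C ∎
        where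
        k : ℕ
        k = ⌊ m /2⌋
        2k≤ : k + k ≤ m
        2k≤ = ≤-trans (+-monoʳ-≤ k (⌊n/2⌋≤⌈n/2⌉ m)) (≤-reflexive (⌊n/2⌋+⌈n/2⌉≡n m))
        m≤ : m ≤ suc (k + k)
        m≤ = ≤-trans (≤-reflexive (sym (⌊n/2⌋+⌈n/2⌉≡n m))) (≤-trans (+-monoʳ-≤ k (⌈n/2⌉≤ m)) (≤-reflexive (+-suc k k)))
          where
          ⌈n/2⌉≤ : ∀ m → ⌈ m /2⌉ ≤ suc ⌊ m /2⌋
          ⌈n/2⌉≤ zero = z≤n
          ⌈n/2⌉≤ (suc zero) = ≤-refl
          ⌈n/2⌉≤ (suc (suc m)) = s≤s (⌈n/2⌉≤ m)
        n₀≤k : n₀ ≤ k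
        n₀≤k with n₀ ≤? k
        ... | yes q = q
        ... | no q = ⊥-elim (h (≤-trans m≤ (≤-trans (s≤s (+-mono-≤ (<⇒≤ (≰⇒> q)) (<⇒≤ (≰⇒> q)))) (≤-reflexive (+-comm 1 _)))))
        k<m : k < m
        k<m = ≤-trans (+-monoˡ-≤ k (≤-trans (s≤s z≤n) n₀≤k)) 2k≤
        r : ∀ k m C → 2 * k + C + k + k + 2 * m ≡ 2 * m + C + 2 * (k + k)
        r = solve-∀
    conclude : ∀ x → C ≤ x → E * π x ≤ x
    conclude x C≤x = *-cancelˡ-≤ 4 (begin
      4 * (E * π x) ≡⟨ sym (*-assoc 4 E (π x)) ⟩
      E′ * π x ≤⟨ *-monoʳ-≤ E′ (m≤m+n (π x) _) ⟩
      E′ * π (suc x) ≤⟨ bound x ⟩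
      2 * x + C ≤⟨ +-monoʳ-≤ (2 * x) (≤-trans C≤x (m≤m+n x _)) ⟩
      2 * x + (x + x) ≡⟨ r x ⟩
      4 * x ∎)
      where
      r : ∀ x → 2 * x + (x + x) ≡ 4 * x
      r = solve-∀

open import Data.Integer using (ℤ; -_; +_)
open import Defs using (IsSquare)
open import Relation.Nullary using (¬_)

-- The form x² + b y² and the primes dividing its values

module Form (T : ℕ) (1≤T : 1 ≤ T) (b : ℤ) (nonsquare : ¬ IsSquare (- b)) where

  open import Data.Nat
  open import Data.Nat.Properties
  open import Data.Nat.Divisibility
  open import Data.Nat.DivMod using (_/_; _%_; m*n/n≡m; /-monoˡ-≤; m≡m%n+[m/n]*n; m%n<n; m/n*n≤m; m<n*o⇒m/o<n; m/n*n≡m)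
  open import Data.Nat.GCD using (gcd; gcd[m,n]∣m; gcd[m,n]∣n; module Bézout; gcd[m,n]≢0)
  open import Data.Nat.Coprimality using (Coprime; coprime-/gcd; coprime-divisor; coprime-Bézout) renaming (sym to coprime-sym)
  open import Data.Nat.Primality
  open import Data.Nat.Induction using (<-rec)
  open import Data.Integer as ℤ using (∣_∣)
  import Data.Integer.Properties as ℤₚ
  import Data.Integer.Divisibility.Signed as ℤ∣
  open ℤ∣ using () renaming (_∣_ to _∣ᶻ_)
  open import Data.Nat.Tactic.RingSolver using (solve-∀)
  import Data.Integer.Tactic.RingSolver as ℤ-Solver
  open import Data.Product using (∃; _×_; _,_; proj₁; proj₂)
  open import Data.Sum using (_⊎_; inj₁; inj₂; [_,_]′; map₂) renaming (map to ⊎-map)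
  open import Data.Empty using (⊥; ⊥-elim)
  open import Relation.Nullary using (Dec; yes; no)
  open import Relation.Nullary.Decidable using (_×-dec_; _⊎-dec_; ¬?)
  open import Relation.Binary.PropositionalEquality hiding (J)
  open IntegerIdentities
  open Identities
  open Sums
  open Primes T 1≤T

  β : ℕ
  β = ∣ b ∣

  1≤β : 1 ≤ β
  1≤β = n≢0⇒n>0 (λ β≡0 → nonsquare (ℤ.0ℤ , sym (cong ℤ.-_ (ℤₚ.∣i∣≡0⇒i≡0 β≡0))))

  form : ℤ → ℤ → ℤ
  form x y = x ℤ.* x ℤ.+ b ℤ.* (y ℤ.* y)

  F : ℕ → ℕ → ℕ
  F u v = ∣ form (+ u) (+ v) ∣

  ∣i∣²≡i² : ∀ i → + ∣ i ∣ ℤ.* + ∣ i ∣ ≡ i ℤ.* i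
  ∣i∣²≡i² (+ n) = refl
  ∣i∣²≡i² ℤ.-[1+ n ] = refl

  form-abs : ∀ x y → F ∣ x ∣ ∣ y ∣ ≡ ∣ form x y ∣
  form-abs x y = cong ∣_∣ (cong₂ (λ s t → s ℤ.+ b ℤ.* t) (∣i∣²≡i² x) (∣i∣²≡i² y))

  n∣ᶻ : ∀ {d z} → d ∣ ∣ z ∣ → + d ∣ᶻ z
  n∣ᶻ = ℤ∣.∣ᵤ⇒∣
  ∣n : ∀ {d z} → + d ∣ᶻ z → d ∣ ∣ z ∣
  ∣n = ℤ∣.∣⇒∣ᵤ

  ∣ᶻ-by : ∀ {d z w} → z ≡ w → d ∣ᶻ z → d ∣ᶻ w
  ∣ᶻ-by refl h = h

  euclidᶻ : ∀ {p} → Prime p → ∀ x y → + p ∣ᶻ x ℤ.* y → + p ∣ᶻ x ⊎ + p ∣ᶻ y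
  euclidᶻ pp x y h = ⊎-map n∣ᶻ n∣ᶻ (euclidsLemma ∣ x ∣ ∣ y ∣ pp (subst (_ ∣_) (ℤₚ.abs-* x y) (∣n h)))

  -- After division by the gcd, coprime `u′` and `v′` with `v′` dividing `u′ * u′` force `v′` to be
  -- 1.
  square∣square : ∀ u v → 1 ≤ v → v * v ∣ u * u → v ∣ u
  square∣square u v 1≤v h = subst (_∣ u) (sym v≡g) (gcd[m,n]∣m u v)
    where
    g : ℕ
    g = gcd u v
    instance
      g≢0 : NonZero g
      g≢0 = ≢-nonZero (gcd[m,n]≢0 u v (inj₂ (>⇒≢ 1≤v)))
    u′ v′ : ℕ
    u′ = u / g
    v′ = v / g
    eu : u ≡ u′ * g
    eu = trans (m∣n⇒n≡quotient*m (gcd[m,n]∣m u v)) (cong (_* g) (sym (n/m≡quotient (gcd[m,n]∣m u v))))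
    ev : v ≡ v′ * g
    ev = trans (m∣n⇒n≡quotient*m (gcd[m,n]∣n u v)) (cong (_* g) (sym (n/m≡quotient (gcd[m,n]∣n u v))))
    cop : Coprime u′ v′
    cop = coprime-/gcd u v
    r : ∀ x g → x * g * (x * g) ≡ g * g * (x * x)
    r = solve-∀
    h′ : v′ * v′ ∣ u′ * u′
    h′ = *-cancelˡ-∣ (g * g) {{m*n≢0 g g}} (subst₂ _∣_ (trans (cong₂ _*_ ev ev) (r v′ g)) (trans (cong₂ _*_ eu eu) (r u′ g)) h)
    v′∣u′ : v′ ∣ u′
    v′∣u′ = coprime-divisor (coprime-sym cop) (∣-trans (m∣m*n v′) h′)
    v≡g : v ≡ g
    v≡g = trans ev (trans (cong (_* g) (cop (v′∣u′ , ∣-refl))) (*-identityˡ g))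

  -- A zero would make `u / v` an integer with square `- b`. The hypothesis on `b` enters here and
  -- in `1≤β`.
  form≢0 : ∀ u v → 1 ≤ v → ¬ form (+ u) (+ v) ≡ ℤ.0ℤ
  form≢0 u v 1≤v e = go (square∣square u v 1≤v v²∣u²)
    where
    r : ∀ b s t → s ≡ (s ℤ.+ b ℤ.* t) ℤ.+ (ℤ.- b) ℤ.* t
    r = ℤ-Solver.solve-∀
    u²≡ : + u ℤ.* + u ≡ (ℤ.- b) ℤ.* (+ v ℤ.* + v)
    u²≡ = trans (r b (+ u ℤ.* + u) (+ v ℤ.* + v)) (trans (cong (ℤ._+ (ℤ.- b) ℤ.* (+ v ℤ.* + v)) e) (ℤₚ.+-identityˡ _))
    v²∣u² : v * v ∣ u * u
    v²∣u² = ∣n (∣ᶻ-by (trans (sym u²≡) (sym (ℤₚ.pos-* u u))) (ℤ∣.∣n⇒∣m*n (ℤ.- b) (ℤ∣.∣-reflexive (ℤₚ.pos-* v v))))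
    instance
      v²≢0 : ℤ.NonZero (+ v ℤ.* + v)
      v²≢0 = ℤ.≢-nonZero (λ q → >⇒≢ (*-mono-≤ 1≤v 1≤v) (ℤₚ.+-injective (trans (ℤₚ.pos-* v v) q)))
    s : ∀ k v → k ℤ.* k ℤ.* (v ℤ.* v) ≡ k ℤ.* v ℤ.* (k ℤ.* v)
    s = ℤ-Solver.solve-∀
    go : v ∣ u → ⊥
    go (divides k u≡kv) = nonsquare (+ k , ℤₚ.*-cancelʳ-≡ _ _ (+ v ℤ.* + v)
      (trans (s (+ k) (+ v)) (trans (cong (λ t → t ℤ.* t) (trans (sym (ℤₚ.pos-* k v)) (cong +_ (sym u≡kv)))) u²≡)))

  F-pos : ∀ u v → 1 ≤ u ⊎ 1 ≤ v → 1 ≤ F u v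
  F-pos u zero (inj₁ h) = ≤-trans (*-mono-≤ h h) (≤-reflexive (sym u²))
    where
    u² : F u 0 ≡ u * u
    u² = trans (cong ∣_∣ (trans (cong (λ t → + u ℤ.* + u ℤ.+ t) (ℤₚ.*-zeroʳ b)) (ℤₚ.+-identityʳ (+ u ℤ.* + u)))) (ℤₚ.abs-* (+ u) (+ u))
  F-pos u (suc v) _ = n≢0⇒n>0 (λ e → form≢0 u (suc v) (s≤s z≤n) (ℤₚ.∣i∣≡0⇒i≡0 e))

  F-upper : ∀ u v → F u v ≤ u * u + β * (v * v)
  F-upper u v = ≤-trans (ℤₚ.∣i+j∣≤∣i∣+∣j∣ (+ u ℤ.* + u) (b ℤ.* (+ v ℤ.* + v)))
    (≤-reflexive (cong₂ _+_ (ℤₚ.abs-* (+ u) (+ u)) (trans (ℤₚ.abs-* b _) (cong (β *_) (ℤₚ.abs-* (+ v) (+ v))))))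

  F-lower : ∀ u v → u * u ≤ F u v + β * (v * v)
  F-lower u v = ≤-trans (≤-reflexive (trans (sym (ℤₚ.abs-* (+ u) (+ u))) (cong ∣_∣ (r (+ u ℤ.* + u) (b ℤ.* (+ v ℤ.* + v))))))
    (≤-trans (ℤₚ.∣i-j∣≤∣i∣+∣j∣ (form (+ u) (+ v)) (b ℤ.* (+ v ℤ.* + v)))
    (≤-reflexive (cong (λ t → F u v + t) (trans (ℤₚ.abs-* b _) (cong (β *_) (ℤₚ.abs-* (+ v) (+ v)))))))
    where
    r : ∀ s t → s ≡ (s ℤ.+ t) ℤ.- t
    r = ℤ-Solver.solve-∀

  -- `2 * β < p` excludes 2 and the divisors of `b`, so a root and its negative are distinct modulo
  -- `p`. The primes lost this way lie below the cutoff `R` of `Radical`.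
  record Split (p : ℕ) : Set where
    constructor mkSplit
    field
      isPrime : Prime p
      2β<p : 2 * β < p
      hasRoot : ∃ λ r → r < p × p ∣ F r 1

  split? : ∀ p → Dec (Split p)
  split? p with prime? p | 2 * β <? p | anyUpTo? (λ r → p ∣? F r 1) p
  ... | no h | _ | _ = no (λ s → h (Split.isPrime s))
  ... | yes _ | no h | _ = no (λ s → h (Split.2β<p s))
  ... | yes _ | yes _ | no h = no (λ s → h (Split.hasRoot s))
  ... | yes x | yes y | yes z = yes (mkSplit x y z)

  ∤b : ∀ {p} → 2 * β < p → ¬ p ∣ β
  ∤b h p∣β = <-irrefl refl (<-≤-trans h (≤-trans (∣⇒≤ {{>-nonZero 1≤β}} p∣β) (m≤m+n β (1 * β))))

  ∤2 : ∀ {p} → 2 * β < p → ¬ p ∣ 2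
  ∤2 h p∣2 = <-irrefl refl (<-≤-trans h (≤-trans (∣⇒≤ p∣2) (*-monoʳ-≤ 2 1≤β)))

  double-∣ : ∀ {p} → Prime p → 2 * β < p → ∀ x → + p ∣ᶻ x ℤ.+ x → + p ∣ᶻ x
  double-∣ pp h x d = [ (λ q → ⊥-elim (∤2 h (∣n q))) , (λ q → q) ]′ (euclidᶻ pp (+ 2) x (∣ᶻ-by (twice x) d))

  square-∣ : ∀ {p} → Prime p → ∀ x → + p ∣ᶻ x ℤ.* x → + p ∣ᶻ x
  square-∣ pp x d = [ (λ q → q) , (λ q → q) ]′ (euclidᶻ pp x x d)

  -- Modulo `p` the form is the product of `x + r y` and `x - r y`, so its zeros form two lattices;
  -- `conj` represents the root `- r`.
  module Root {p : ℕ} (pp : Prime p) (2β<p : 2 * β < p) (r : ℕ) (r<p : r < p) (root : p ∣ F r 1) where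

    root′ : + p ∣ᶻ + r ℤ.* + r ℤ.+ b
    root′ = ∣ᶻ-by (cong (λ t → + r ℤ.* + r ℤ.+ t) (ℤₚ.*-identityʳ b)) (n∣ᶻ root)

    p∤r : ¬ + p ∣ᶻ + r
    p∤r h = ∤b 2β<p (∣n (ℤ∣.∣m+n∣m⇒∣n root′ (ℤ∣.∣m⇒∣m*n (+ r) h)))

    conj : ℕ
    conj = p ∸ r

    conj≡ : + conj ≡ + p ℤ.- + r
    conj≡ = trans (sym (ℤₚ.⊖-≥ (<⇒≤ r<p))) (sym (ℤₚ.m-n≡m⊖n p r))

    form-∣ : ∀ x y → + p ∣ᶻ x ℤ.+ + r ℤ.* y → + p ∣ᶻ form x y
    form-∣ x y h = ∣ᶻ-by (form-factor b x y (+ r)) (ℤ∣.∣m∣n⇒∣m+n (ℤ∣.∣m⇒∣m*n (x ℤ.- + r ℤ.* y) h) (ℤ∣.∣n⇒∣m*n (y ℤ.* y) root′))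

    to-conj : ∀ x y → + p ∣ᶻ x ℤ.- + r ℤ.* y → + p ∣ᶻ x ℤ.+ + conj ℤ.* y
    to-conj x y h = ∣ᶻ-by (trans (e x y (+ r) (+ p)) (cong (λ t → x ℤ.+ t ℤ.* y) (sym conj≡))) (ℤ∣.∣m∣n⇒∣m+n h (ℤ∣.∣m⇒∣m*n y ℤ∣.∣-refl))
      where
      e : ∀ x y r p → (x ℤ.- r ℤ.* y) ℤ.+ p ℤ.* y ≡ x ℤ.+ (p ℤ.- r) ℤ.* y
      e = ℤ-Solver.solve-∀

    from-conj : ∀ x y → + p ∣ᶻ x ℤ.+ + conj ℤ.* y → + p ∣ᶻ x ℤ.- + r ℤ.* y
    from-conj x y h = ∣ᶻ-by (trans (cong (λ t → (x ℤ.+ t ℤ.* y) ℤ.- + p ℤ.* y) conj≡) (e x y (+ r) (+ p))) (ℤ∣.∣m∣n⇒∣m-n h (ℤ∣.∣m⇒∣m*n y ℤ∣.∣-refl))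
      where
      e : ∀ x y r p → (x ℤ.+ (p ℤ.- r) ℤ.* y) ℤ.- p ℤ.* y ≡ x ℤ.- r ℤ.* y
      e = ℤ-Solver.solve-∀

    factors : ∀ x y → + p ∣ᶻ form x y → + p ∣ᶻ x ℤ.+ + r ℤ.* y ⊎ + p ∣ᶻ x ℤ.+ + conj ℤ.* y
    factors x y h = map₂ (to-conj x y) (euclidᶻ pp (x ℤ.+ + r ℤ.* y) (x ℤ.- + r ℤ.* y) product)
      where
      product : + p ∣ᶻ (x ℤ.+ + r ℤ.* y) ℤ.* (x ℤ.- + r ℤ.* y)
      product = ∣ᶻ-by (form-factor′ b x y (+ r)) (ℤ∣.∣m∣n⇒∣m-n h (ℤ∣.∣n⇒∣m*n (y ℤ.* y) root′))

    -- The two factors add up to `2 x`, and `p` divides neither 2 nor `r`.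
    both : ∀ x y → + p ∣ᶻ x ℤ.+ + r ℤ.* y → + p ∣ᶻ x ℤ.+ + conj ℤ.* y → + p ∣ᶻ x × + p ∣ᶻ y
    both x y h h′ = px , py
      where
      e : ∀ x y r → (x ℤ.+ r ℤ.* y) ℤ.+ (x ℤ.- r ℤ.* y) ≡ x ℤ.+ x
      e = ℤ-Solver.solve-∀
      px : + p ∣ᶻ x
      px = double-∣ pp 2β<p x (∣ᶻ-by (e x y (+ r)) (ℤ∣.∣m∣n⇒∣m+n h (from-conj x y h′)))
      py : + p ∣ᶻ y
      py = [ (λ q → ⊥-elim (p∤r q)) , (λ q → q) ]′ (euclidᶻ pp (+ r) y (ℤ∣.∣m+n∣m⇒∣n h px))

    conj<p : conj < p
    conj<p = ∸-monoʳ-< {p} {r} {0} (n≢0⇒n>0 (λ r≡0 → p∤r (∣ᶻ-by (cong +_ (sym r≡0)) (n∣ᶻ (p ∣0))))) (<⇒≤ r<p)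

  form-squares-∣ : ∀ p x y → + p ∣ᶻ x → + p ∣ᶻ y → + (p * p) ∣ᶻ form x y
  form-squares-∣ p x y (ℤ∣.divides s es) (ℤ∣.divides t et) = ℤ∣.divides (form s t) eq
    where
    eq : form x y ≡ form s t ℤ.* + (p * p)
    eq = begin
      form x y ≡⟨ cong₂ form es et ⟩
      form (s ℤ.* + p) (t ℤ.* + p) ≡⟨ form-scale b s t (+ p) ⟩
      form s t ℤ.* (+ p ℤ.* + p) ≡⟨ cong (form s t ℤ.*_) (sym (ℤₚ.pos-* p p)) ⟩
      form s t ℤ.* + (p * p) ∎
      where open ≡-Reasoning

  conj-root : ∀ {p} → Prime p → 2 * β < p → ∀ r → r < p → p ∣ F r 1 → p ∣ F (p ∸ r) 1
  conj-root {p} pp h r r<p root = ∣n (∣ᶻ-by (cong (λ t → form t (+ 1)) (sym conj≡)) (∣ᶻ-by (form-conj b (+ p) (+ r)) (ℤ∣.∣m∣n⇒∣m+n (n∣ᶻ {p} {form (+ r) (+ 1)} root) (ℤ∣.∣m⇒∣m*n (+ p ℤ.- + r ℤ.- + r) ℤ∣.∣-refl))))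
    where
    open Root pp h r r<p root

  form-mod : ∀ p x y k → + p ∣ᶻ form x y → + p ∣ᶻ form (x ℤ.- k ℤ.* + p) y
  form-mod p x y k h = ∣ᶻ-by {+ p} {form x y ℤ.+ + p ℤ.* (k ℤ.* (k ℤ.* + p ℤ.- x ℤ.- x))} (form-shift b x y k (+ p))
    (ℤ∣.∣m∣n⇒∣m+n {+ p} {form x y} {+ p ℤ.* (k ℤ.* (k ℤ.* + p ℤ.- x ℤ.- x))} h (ℤ∣.∣m⇒∣m*n {+ p} {+ p} (k ℤ.* (k ℤ.* + p ℤ.- x ℤ.- x)) ℤ∣.∣-refl))

  -- Division by `v` modulo `p` turns the zero `(u , v)` into a root of x² + b.
  split-from : ∀ {p} → Prime p → 2 * β < p → ∀ u v → p ∣ F u v → ¬ p ∣ v → Split p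
  split-from {p} pp h u v p∣F p∤v = mkSplit pp h (m % p , m%n<n m p , ∣n (∣ᶻ-by (cong (λ t → form t (+ 1)) eq) (form-mod p (+ m) (+ 1) (+ (m / p)) p∣m)))
    where
    instance
      p≢0 : NonZero p
      p≢0 = prime⇒nonZero pp
    cop : Coprime v p
    cop {d} (d∣v , d∣p) with prime⇒irreducible pp d∣p
    ... | inj₁ d≡1 = d≡1
    ... | inj₂ refl = ⊥-elim (p∤v d∣v)
    -- Bézout's identity comes in two cases, with `w * v` congruent to 1 or to - 1. Only the square
    -- of `w` matters, and the product of both factors treats the cases alike.
    inverse : ∃ λ w → + p ∣ᶻ (ℤ.1ℤ ℤ.- + w ℤ.* + v) ℤ.* (ℤ.1ℤ ℤ.+ + w ℤ.* + v)
    inverse with coprime-Bézout cop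
    ... | Bézout.+- x y eq = x , ℤ∣.∣m⇒∣m*n (ℤ.1ℤ ℤ.+ + x ℤ.* + v) (ℤ∣.divides (ℤ.- + y)
          (trans (cong (λ t → ℤ.1ℤ ℤ.- t) (trans (sym (ℤₚ.pos-* x v)) (trans (cong +_ (sym eq)) (cong (λ t → ℤ.1ℤ ℤ.+ t) (ℤₚ.pos-* y p))))) (e (+ y) (+ p))))
      where
      e : ∀ y p → ℤ.1ℤ ℤ.- (ℤ.1ℤ ℤ.+ y ℤ.* p) ≡ (ℤ.- y) ℤ.* p
      e = ℤ-Solver.solve-∀
    ... | Bézout.-+ x y eq = x , ℤ∣.∣n⇒∣m*n (ℤ.1ℤ ℤ.- + x ℤ.* + v) (ℤ∣.divides (+ y)
          (trans (cong (λ t → ℤ.1ℤ ℤ.+ t) (sym (ℤₚ.pos-* x v))) (trans (cong +_ eq) (ℤₚ.pos-* y p))))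
    w m : ℕ
    w = proj₁ inverse
    m = u * w
    p∣m : + p ∣ᶻ form (+ m) (+ 1)
    p∣m = ∣ᶻ-by (trans (form-inverse b (+ u) (+ v) (+ w)) (cong (λ t → t ℤ.* t ℤ.+ b ℤ.* (+ 1 ℤ.* + 1)) (sym (ℤₚ.pos-* u w))))
       (ℤ∣.∣m∣n⇒∣m+n (ℤ∣.∣n⇒∣m*n (+ w ℤ.* + w) (n∣ᶻ p∣F)) (ℤ∣.∣n⇒∣m*n b (proj₂ inverse)))
    eq : + m ℤ.- + (m / p) ℤ.* + p ≡ + (m % p)
    eq = trans (cong₂ (λ s t → s ℤ.- t) (cong +_ (m≡m%n+[m/n]*n m p)) (sym (ℤₚ.pos-* (m / p) p))) (e (+ (m % p)) (+ (m / p * p)))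
      where
      e : ∀ x y → (x ℤ.+ y) ℤ.- y ≡ x
      e = ℤ-Solver.solve-∀

  -- Counting solutions of congruences in an interval

  difference-∣ : ∀ d s i j → i < j → d ∣ i + s → d ∣ j + s → d ∣ j ∸ i
  difference-∣ d s i j i<j di dj = ∣m+n∣m⇒∣n (subst (d ∣_) (trans (cong (_+ s) (sym (m+[n∸m]≡n (<⇒≤ i<j)))) (r i (j ∸ i) s)) dj) di
    where
    r : ∀ i k s → i + k + s ≡ i + s + k
    r = solve-∀

  ∣∸⇒≤ : ∀ d i j → i < j → d ∣ j ∸ i → i + d ≤ j
  ∣∸⇒≤ d i j i<j h = ≤-trans (+-monoʳ-≤ i (∣⇒≤ {{>-nonZero (m<n⇒0<n∸m i<j)}} h)) (≤-reflexive (m+[n∸m]≡n (<⇒≤ i<j)))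

  spacing-∣ : ∀ d s i j → i < j → d ∣ i + s → d ∣ j + s → i + d ≤ j
  spacing-∣ d s i j i<j di dj = ∣∸⇒≤ d i j i<j (difference-∣ d s i j i<j di dj)

  class-upper : ∀ d s X → d * ∑ X (λ n → ι (d ∣? n + s)) ≤ X + d
  class-upper d s X = spaced (λ n → d ∣? n + s) d X (spacing-∣ d s)

  class-lower : ∀ d .{{_ : NonZero d}} s X → X ≤ d * ∑ X (λ n → ι (d ∣? n + s)) + d
  class-lower d s X = dense (λ n → d ∣? n + s) d X window
    where
    window : ∀ i → ∃ λ j → (j < d) × (d ∣ i + j + s)
    window i with (i + s) % d in e
    ... | zero = 0 , >-nonZero⁻¹ d , subst (d ∣_) (cong (_+ s) (sym (+-identityʳ i))) (m%n≡0⇒n∣m (i + s) d e)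
    ... | suc k = d ∸ suc k , ∸-monoʳ-< {d} {suc k} {0} (s≤s z≤n) k≤d
        , subst (d ∣_) (sym eq) (n∣m*n (suc ((i + s) / d)))
      where
      k≤d : suc k ≤ d
      k≤d = subst (_≤ d) e (<⇒≤ (m%n<n (i + s) d))
      q : ℕ
      q = (i + s) / d
      swap : ∀ i j s → i + j + s ≡ i + s + j
      swap = solve-∀
      swap′ : ∀ k qd j → k + qd + j ≡ k + j + qd
      swap′ = solve-∀
      eq : i + (d ∸ suc k) + s ≡ suc q * d
      eq = begin
        i + (d ∸ suc k) + s ≡⟨ swap i (d ∸ suc k) s ⟩
        i + s + (d ∸ suc k) ≡⟨ cong (_+ (d ∸ suc k)) (m≡m%n+[m/n]*n (i + s) d) ⟩
        (i + s) % d + q * d + (d ∸ suc k) ≡⟨ cong (λ t → t + q * d + (d ∸ suc k)) e ⟩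
        suc k + q * d + (d ∸ suc k) ≡⟨ swap′ (suc k) (q * d) (d ∸ suc k) ⟩
        suc k + (d ∸ suc k) + q * d ≡⟨ cong (_+ q * d) (m+[n∸m]≡n k≤d) ⟩
        d + q * d ∎
        where open ≡-Reasoning

  ι-×≡ : ∀ {P Q : Set} (d : Dec P) (e : Dec Q) → ι d * ι e ≡ ι (d ×-dec e)
  ι-×≡ (yes _) (yes _) = refl
  ι-×≡ (yes _) (no _) = refl
  ι-×≡ (no _) e = refl

  -- Two solutions differ by a multiple of both primes, hence of `p * q`.
  pair-class-upper : ∀ {p q} → Prime p → Prime q → p ≢ q → ∀ s t X →
    p * q * ∑ X (λ n → ι (p ∣? n + s) * ι (q ∣? n + t)) ≤ X + p * q
  pair-class-upper {p} {q} pp pq p≢q s t X = ≤-trans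
    (≤-reflexive (cong (p * q *_) (∑-cong X (λ n _ → ι-×≡ (p ∣? n + s) (q ∣? n + t)))))
    (spaced (λ n → (p ∣? n + s) ×-dec (q ∣? n + t)) (p * q) X sp)
    where
    q∤p : ¬ q ∣ p
    q∤p h = [ (λ e → <-irrefl (sym e) (prime≥2 pq)) , (λ e → p≢q (sym e)) ]′ (prime⇒irreducible pp h)
    sp : ∀ i j → i < j → (p ∣ i + s) × (q ∣ i + t) → (p ∣ j + s) × (q ∣ j + t) → i + p * q ≤ j
    sp i j i<j (pi , qi) (pj , qj) = ∣∸⇒≤ (p * q) i j i<j pq∣
      where
      pq∣ : p * q ∣ j ∸ i
      pq∣ with difference-∣ p s i j i<j pi pj
      ... | divides k e = subst₂ _∣_ (*-comm q p) (sym e) (*-monoˡ-∣ p q∣k)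
        where
        q∣k : q ∣ k
        q∣k = [ (λ h → h) , (λ h → ⊥-elim (q∤p h)) ]′ (euclidsLemma k p pq (subst (q ∣_) e (difference-∣ q t i j i<j qi qj)))

  module _ {P : ℕ → Set} (P? : ∀ n → Dec (P n)) (d : ℕ) (1≤d : 1 ≤ d)
    (two : ∀ i j → P i → P j → (d ∣ ∣ + i ℤ.- + j ∣) ⊎ (d ∣ i + j)) where

    -- If `a` is a solution, every other one is congruent to `a` or to `- a` modulo `d`, so two
    -- residue classes cover them all.
    two-class : ∀ s X → d * ∑ X (λ i → ι (P? (s + i))) ≤ 2 * (X + d)
    two-class s X with 1 ≤? ∑ X (λ i → ι (P? (s + i)))
    ... | no h = ≤-trans (≤-reflexive (trans (cong (d *_) (n<1⇒n≡0 (≰⇒> h))) (*-zeroʳ d))) z≤n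
    ... | yes h with ∑-pos X (λ i → ι (P? (s + i))) h
    ...   | i₀ , _ , q = begin
        d * ∑ X (λ i → ι (P? (s + i))) ≤⟨ *-monoʳ-≤ d (∑-mono X (λ i _ → cover i)) ⟩
        d * ∑ X (λ i → ι (d ∣? i + (s + a)) + ι (d ∣? i + (s + a′))) ≡⟨ cong (d *_) (∑-+ X _ _) ⟩
        d * (∑ X (λ i → ι (d ∣? i + (s + a))) + ∑ X (λ i → ι (d ∣? i + (s + a′)))) ≡⟨ *-distribˡ-+ d (∑ X (λ i → ι (d ∣? i + (s + a)))) _ ⟩
        d * ∑ X (λ i → ι (d ∣? i + (s + a))) + d * ∑ X (λ i → ι (d ∣? i + (s + a′))) ≤⟨ +-mono-≤ (class-upper d (s + a) X) (class-upper d (s + a′) X) ⟩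
        (X + d) + (X + d) ≡⟨ cong (λ t → (X + d) + t) (sym (+-identityʳ _)) ⟩
        2 * (X + d) ∎
      where
      open ≤-Reasoning
      a a′ : ℕ
      a = s + i₀
      -- A natural number congruent to `- a` modulo `d`.
      a′ = pred d * a
      Pa : P a
      Pa = ι-holds (P? a) q
      1+pred : suc (pred d) ≡ d
      1+pred = suc-pred d {{>-nonZero 1≤d}}
      assoc : ∀ i s a → s + i + a ≡ i + (s + a)
      assoc = solve-∀
      minus : ∀ u → d ∣ ∣ + u ℤ.- + a ∣ → d ∣ u + a′
      minus u h = ∣n {d} {+ (u + a′)} (∣ᶻ-by eq (ℤ∣.∣m∣n⇒∣m+n (n∣ᶻ {d} {+ u ℤ.- + a} h) (ℤ∣.∣m⇒∣m*n (+ a) (ℤ∣.∣-refl {+ d}))))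
        where
        eq : (+ u ℤ.- + a) ℤ.+ + d ℤ.* + a ≡ + (u + a′)
        eq = trans (cong (λ t → (+ u ℤ.- + a) ℤ.+ + t ℤ.* + a) (sym 1+pred)) (trans (minus-class (+ u) (+ a) (+ (pred d))) (cong (λ t → + u ℤ.+ t) (sym (ℤₚ.pos-* (pred d) a))))
      cover : ∀ i → ι (P? (s + i)) ≤ ι (d ∣? i + (s + a)) + ι (d ∣? i + (s + a′))
      cover i with P? (s + i)
      ... | no _ = z≤n
      ... | yes p with two (s + i) a p Pa
      ...   | inj₁ h = ≤-trans (1≤ι (d ∣? i + (s + a′)) (subst (d ∣_) (assoc i s a′) (minus (s + i) h))) (m≤n+m _ (ι (d ∣? i + (s + a))))
      ...   | inj₂ h = ≤-trans (1≤ι (d ∣? i + (s + a)) (subst (d ∣_) (assoc i s a) h)) (m≤m+n _ _)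

  F-difference : ∀ d u w v → d ∣ F u v → d ∣ F w v → d ∣ ∣ + u ℤ.- + w ∣ * (u + w)
  F-difference d u w v h h′ = subst (d ∣_) (ℤₚ.abs-* (+ u ℤ.- + w) (+ (u + w))) (∣n {d} {(+ u ℤ.- + w) ℤ.* + (u + w)}
    (∣ᶻ-by (form-difference b (+ u) (+ v) (+ w)) (ℤ∣.∣m∣n⇒∣m-n (n∣ᶻ {d} {form (+ u) (+ v)} h) (n∣ᶻ {d} {form (+ w) (+ v)} h′))))

  -- If `p` divided both `u - w` and `u + w`, it would divide `2 u`, hence `u`, hence `b v²`,
  -- contrary to `2 * β < p` and `p ∤ v`. So one of the two takes the whole square.
  square-two : ∀ {p} → Prime p → 2 * β < p → ∀ v → ¬ p ∣ v → ∀ u w → p * p ∣ F u v → p * p ∣ F w v →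
    (p * p ∣ ∣ + u ℤ.- + w ∣) ⊎ (p * p ∣ u + w)
  square-two {p} pp h v p∤v u w hu hw with p ∣? u + w
  ... | no p∤ = inj₁ (subst (_∣ ∣ + u ℤ.- + w ∣) p²≡ (pow-∣-cancel pp 2 ∣ + u ℤ.- + w ∣ (u + w) p∤ (subst (_∣ ∣ + u ℤ.- + w ∣ * (u + w)) (sym p²≡) (F-difference (p * p) u w v hu hw))))
    where
    p²≡ : p ^ 2 ≡ p * p
    p²≡ = cong (p *_) (*-identityʳ p)
  ... | yes p∣ = inj₂ (subst (_∣ u + w) p²≡ (pow-∣-cancel pp 2 (u + w) ∣ + u ℤ.- + w ∣ p∤ (subst₂ _∣_ (sym p²≡) (*-comm ∣ + u ℤ.- + w ∣ (u + w)) (F-difference (p * p) u w v hu hw))))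
    where
    p²≡ : p ^ 2 ≡ p * p
    p²≡ = cong (p *_) (*-identityʳ p)
    p∤ : ¬ p ∣ ∣ + u ℤ.- + w ∣
    p∤ q = [ ∤b h , (λ t → [ (λ t → p∤v t) , (λ t → p∤v t) ]′ (euclidsLemma v v pp t)) ]′ (euclidsLemma β (v * v) pp p∣βvv)
      where
      p∣u : + p ∣ᶻ + u
      p∣u = double-∣ pp h (+ u) (∣ᶻ-by (sum-diff (+ u) (+ w)) (ℤ∣.∣m∣n⇒∣m+n (n∣ᶻ {p} {+ (u + w)} p∣) (n∣ᶻ {p} {+ u ℤ.- + w} q)))
      p∣bvv : + p ∣ᶻ b ℤ.* (+ v ℤ.* + v)
      p∣bvv = ℤ∣.∣m+n∣m⇒∣n (n∣ᶻ {p} {form (+ u) (+ v)} (∣-trans (m∣m*n p) hu)) (ℤ∣.∣m⇒∣m*n (+ u) p∣u)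
      p∣βvv : p ∣ β * (v * v)
      p∣βvv = subst (p ∣_) (trans (ℤₚ.abs-* b (+ v ℤ.* + v)) (cong (β *_) (ℤₚ.abs-* (+ v) (+ v)))) (∣n {p} {b ℤ.* (+ v ℤ.* + v)} p∣bvv)

  -- Both factors may be divisible by a small prime; doubling the exponent still forces `p ^ j` into
  -- one of them.
  pow-split : ∀ {p} → Prime p → ∀ j x y → p ^ (j + j) ∣ x * y → (p ^ j ∣ x) ⊎ (p ^ j ∣ y)
  pow-split {p} pp j zero y h = inj₁ ((p ^ j) ∣0)
  pow-split {p} pp j x@(suc _) y h = go (strip-prime pp x (s≤s z≤n))
    where
    pow-mono : ∀ {i k} → i ≤ k → p ^ i ∣ p ^ k
    pow-mono {i} {k} i≤k = subst (p ^ i ∣_) (trans (sym (^-distribˡ-+-* p i (k ∸ i))) (cong (p ^_) (m+[n∸m]≡n i≤k))) (m∣m*n (p ^ (k ∸ i)))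
    go : Strip p x → (p ^ j ∣ x) ⊎ (p ^ j ∣ y)
    go (strip e x′ eq p∤x′ _) with j ≤? e
    ... | yes j≤e = inj₁ (∣-trans (pow-mono j≤e) (divides x′ (trans eq (*-comm _ x′))))
    ... | no j≰e = inj₂ (pow-∣-cancel pp j y x′ p∤x′ (*-cancelˡ-∣ (p ^ e) {{m^n≢0 p e {{prime⇒nonZero pp}}}}
        (subst₂ _∣_ (^-distribˡ-+-* p e j) (trans (cong (_* y) eq) (r (p ^ e) x′ y)) (∣-trans (pow-mono (+-monoˡ-≤ j (<⇒≤ (≰⇒> j≰e)))) h))))
      where
      r : ∀ a x y → a * x * y ≡ a * (y * x)
      r = solve-∀

  -- 1 / p² ≤ 1 / (p - 1) - 1 / p, so the sum over p > R telescopes to at most 1 / R.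
  ∑-inverse-squares : ∀ R A (f : ℕ → ℕ) → (∀ p → R < p → p * p * f p ≤ A) → (∀ p → p ≤ R → f p ≡ 0) →
    ∀ Y → R * ∑ Y f ≤ A
  ∑-inverse-squares R A f hf f0 Y with Y ≤? suc R
  ... | yes h = ≤-trans (≤-reflexive (trans (cong (R *_) (trans (∑-cong Y (λ p p<Y → f0 p (≤-pred (≤-trans p<Y h)))) (∑-zero Y))) (*-zeroʳ R))) z≤n
  ... | no h = *-cancelˡ-≤ (R + k) {{>-nonZero (≤-trans 1≤k (m≤n+m k R))}} (begin
      (R + k) * (R * ∑ Y f) ≡⟨ cong (λ y → (R + k) * (R * ∑ y f)) (sym Y≡) ⟩
      (R + k) * (R * ∑ (suc (R + k)) f) ≤⟨ go k ⟩
      k * A ≤⟨ *-monoˡ-≤ A (m≤n+m k R) ⟩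
      (R + k) * A ∎)
    where
    open ≤-Reasoning
    k : ℕ
    k = Y ∸ suc R
    1≤k : 1 ≤ k
    1≤k = m<n⇒0<n∸m (≰⇒> h)
    Y≡ : suc (R + k) ≡ Y
    Y≡ = m+[n∸m]≡n (<⇒≤ (≰⇒> h))
    go : ∀ k → (R + k) * (R * ∑ (suc (R + k)) f) ≤ k * A
    go zero = ≤-trans (≤-reflexive (trans (cong (λ s → (R + 0) * (R * s)) (trans (∑-cong (suc (R + 0)) (λ p p< → f0 p (≤-trans (≤-pred p<) (≤-reflexive (+-identityʳ R))))) (∑-zero (suc (R + 0))))) (trans (cong ((R + 0) *_) (*-zeroʳ R)) (*-zeroʳ (R + 0))))) z≤n
    go (suc k) rewrite +-suc R k = lemma (R + k) R k A (∑ (suc (R + k)) f) (f (suc (R + k))) refl (go k) (hf (suc (R + k)) (s≤s (m≤m+n R k)))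
      where
      lemma : ∀ y R k A S g → y ≡ R + k → y * (R * S) ≤ k * A → suc y * suc y * g ≤ A → suc y * (R * (S + g)) ≤ suc k * A
      lemma zero R k A S g e _ h2 = ≤-trans (≤-reflexive (trans (cong (λ R → 1 * (R * (S + g))) R≡0) refl)) z≤n
        where
        R≡0 : R ≡ 0
        R≡0 = n≤0⇒n≡0 (≤-trans (m≤m+n R k) (≤-reflexive (sym e)))
      lemma y@(suc _) R k A S g e h1 h2 = *-cancelˡ-≤ y (begin
        y * (suc y * (R * (S + g))) ≡⟨ ladder₁ y R S g ⟩
        suc y * (y * (R * S)) + R * (y * (suc y * g)) ≤⟨ +-mono-≤ (*-monoʳ-≤ (suc y) h1) (*-monoʳ-≤ R (≤-trans (*-monoˡ-≤ (suc y * g) (n≤1+n y)) (≤-trans (≤-reflexive (sym (*-assoc (suc y) (suc y) g))) h2))) ⟩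
        suc y * (k * A) + R * A ≡⟨ trans (cong (λ y → suc y * (k * A) + R * A) e) (trans (ladder₂ R k A) (cong (_* (suc k * A)) (sym e))) ⟩
        y * (suc k * A) ∎)

  -- Counting 0 along with the multiples in `[1 , X]` and using the strict spacing bound removes the
  -- error `p`. In particular a single multiple forces `p ≤ X`.
  multiples : ∀ p X → 1 ≤ p → p * ∑ X (λ i → ι (p ∣? suc i)) ≤ X
  multiples p X 1≤p with spaced-strict (λ n → p ∣? n) p (suc X) (λ i j i<j di dj → spacing-∣ p 0 i j i<j (subst (p ∣_) (sym (+-identityʳ i)) di) (subst (p ∣_) (sym (+-identityʳ j)) dj))
  ... | inj₁ e = ⊥-elim (<-irrefl (sym (trans (sym (∑-split 1 X (λ n → ι (p ∣? n)))) e)) (≤-trans (1≤ι (p ∣? 0) (p ∣0)) (m≤m+n _ _)))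
  ... | inj₂ q = +-cancelʳ-≤ p _ _ (≤-pred (≤-trans (≤-reflexive (cong suc eq)) q))
    where
    eq : p * ∑ X (λ i → ι (p ∣? suc i)) + p ≡ p * ∑ (suc X) (λ n → ι (p ∣? n))
    eq = trans (trans (+-comm _ p) (sym (*-suc p _))) (cong (p *_) (sym (trans (∑-split 1 X (λ n → ι (p ∣? n))) (cong (_+ ∑ X (λ i → ι (p ∣? suc i))) (ι-yes (p ∣? 0) (p ∣0))))))

  -- Exceptional values: large square factors and high powers of small primes

  module Exceptional (R j : ℕ) (2β≤R : 2 * β ≤ R) where

    Sq : ℕ → ℕ → ℕ → Set
    Sq v p u = (Prime p × R < p) × (¬ p ∣ v) × (p * p ∣ F u v)

    Pw : ℕ → ℕ → ℕ → Set
    Pw v p u = Prime p × (p ^ (j + j) ∣ F u v)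

    sq? : ∀ v p u → Dec (Sq v p u)
    sq? v p u = (prime? p ×-dec (R <? p)) ×-dec (¬? (p ∣? v) ×-dec (p * p ∣? F u v))

    pw? : ∀ v p u → Dec (Pw v p u)
    pw? v p u = prime? p ×-dec (p ^ (j + j) ∣? F u v)

    -- The obstructions to applying `radical` to `F u v` are counted, not merely detected, so that a
    -- sum over `u` can be interchanged with the sum over primes.
    bad : ℕ → ℕ → ℕ → ℕ
    bad Y u v = ∑ Y (λ p → ι (sq? v p u)) + ∑ (suc R) (λ p → ι (pw? v p u))

    -- Two classes may contribute one solution each however large `d` is; with these two set aside,
    -- the count is bounded by a multiple of `1 / d`.
    trim : ∀ d c A → d * c ≤ 2 * (A + d) → d * (c ∸ 2) ≤ 2 * A
    trim d c A h = ≤-trans (≤-reflexive (*-distribˡ-∸ d c 2)) (m≤n+o⇒m∸n≤o (d * c) (d * 2) (≤-trans h (≤-reflexive (r A d))))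
      where
      r : ∀ A d → 2 * (A + d) ≡ d * 2 + 2 * A
      r = solve-∀

    module _ (s v X : ℕ) where

      sq-count : ℕ → ℕ
      sq-count p = ∑ X (λ i → ι (sq? v p (s + i)))

      sq-none : ∀ p → ¬ (Prime p × R < p) → sq-count p ≡ 0
      sq-none p h = trans (∑-cong X (λ i _ → ι-no (sq? v p (s + i)) (λ q → h (proj₁ q)))) (∑-zero X)

      -- Each prime has at most `2 X / p² + 2` solutions. The first terms telescope to `2 X / R`;
      -- the constants add up to `2 π Y`, negligible when `Y` is proportional to `X`.
      sq-bound : ∀ Y → R * ∑ X (λ i → ∑ Y (λ p → ι (sq? v p (s + i)))) ≤ 2 * R * π Y + 2 * X
      sq-bound Y = begin
        R * ∑ X (λ i → ∑ Y (λ p → ι (sq? v p (s + i)))) ≡⟨ cong (R *_) (∑-swap X Y _) ⟩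
        R * ∑ Y sq-count ≤⟨ *-monoʳ-≤ R (∑-mono Y (λ p _ → cut p)) ⟩
        R * ∑ Y (λ p → 2 * ι (prime? p) + (sq-count p ∸ 2)) ≡⟨ cong (R *_) (∑-+ Y _ _) ⟩
        R * (∑ Y (λ p → 2 * ι (prime? p)) + ∑ Y (λ p → sq-count p ∸ 2)) ≡⟨ *-distribˡ-+ R (∑ Y (λ p → 2 * ι (prime? p))) _ ⟩
        R * ∑ Y (λ p → 2 * ι (prime? p)) + R * ∑ Y (λ p → sq-count p ∸ 2)
          ≤⟨ +-mono-≤ (≤-reflexive (trans (cong (R *_) (∑-* Y 2 _)) (r R (π Y)))) (∑-inverse-squares R (2 * X) _ large small Y) ⟩
        2 * R * π Y + 2 * X ∎
        where
        open ≤-Reasoning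
        r : ∀ R x → R * (2 * x) ≡ 2 * R * x
        r = solve-∀
        cut : ∀ p → sq-count p ≤ 2 * ι (prime? p) + (sq-count p ∸ 2)
        cut p = cases (prime? p)
          where
          cases : (d : Dec (Prime p)) → sq-count p ≤ 2 * ι d + (sq-count p ∸ 2)
          cases (yes _) = m≤n+m∸n (sq-count p) 2
          cases (no ¬p) = ≤-trans (≤-reflexive (sq-none p (λ q → ¬p (proj₁ q)))) z≤n
        small : ∀ p → p ≤ R → sq-count p ∸ 2 ≡ 0
        small p p≤R = cong (_∸ 2) (sq-none p (λ q → <-irrefl refl (<-≤-trans (proj₂ q) p≤R)))
        large : ∀ p → R < p → p * p * (sq-count p ∸ 2) ≤ 2 * X
        large p R<p = trim (p * p) (sq-count p) X (two-class (sq? v p) (p * p) (*-mono-≤ 1≤p 1≤p)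
          (λ u w ((pp , _) , p∤v , hu) (_ , _ , hw) → square-two pp (≤-<-trans 2β≤R R<p) v p∤v u w hu hw) s X)
          where
          1≤p : 1 ≤ p
          1≤p = ≤-trans (s≤s z≤n) R<p

      -- By `pow-split` the solutions for one prime lie in two classes modulo `p ^ j`, and `p ^ j`
      -- is at least `2 ^ j`.
      pw-bound : 2 ^ j * ∑ X (λ i → ∑ (suc R) (λ p → ι (pw? v p (s + i)))) ≤ suc R * (2 * X + 2 * 2 ^ j)
      pw-bound = begin
        2 ^ j * ∑ X (λ i → ∑ (suc R) (λ p → ι (pw? v p (s + i)))) ≡⟨ cong (2 ^ j *_) (∑-swap X (suc R) _) ⟩
        2 ^ j * ∑ (suc R) count ≡⟨ sym (∑-* (suc R) (2 ^ j) count) ⟩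
        ∑ (suc R) (λ p → 2 ^ j * count p) ≤⟨ ∑-≤const (suc R) (2 * X + 2 * 2 ^ j) (λ p _ → each p) ⟩
        suc R * (2 * X + 2 * 2 ^ j) ∎
        where
        open ≤-Reasoning
        count : ℕ → ℕ
        count p = ∑ X (λ i → ι (pw? v p (s + i)))
        each : ∀ p → 2 ^ j * count p ≤ 2 * X + 2 * 2 ^ j
        each p = cases (prime? p)
         where
         cases : Dec (Prime p) → 2 ^ j * count p ≤ 2 * X + 2 * 2 ^ j
         cases (no ¬p) = ≤-trans (≤-reflexive (trans (cong (2 ^ j *_) (trans (∑-cong X (λ i _ → ι-no (pw? v p (s + i)) (λ q → ¬p (proj₁ q)))) (∑-zero X))) (*-zeroʳ (2 ^ j)))) z≤n
         cases (yes pp) = begin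
          2 ^ j * count p ≤⟨ *-monoʳ-≤ (2 ^ j) (m≤n+m∸n (count p) 2) ⟩
          2 ^ j * (2 + (count p ∸ 2)) ≡⟨ r (2 ^ j) (count p ∸ 2) ⟩
          2 ^ j * (count p ∸ 2) + 2 * 2 ^ j ≤⟨ +-monoˡ-≤ (2 * 2 ^ j) (≤-trans (*-monoˡ-≤ (count p ∸ 2) (^-monoˡ-≤ j (prime≥2 pp))) (trim (p ^ j) (count p) X two-cl)) ⟩
          2 * X + 2 * 2 ^ j ∎
          where
          r : ∀ a c → a * (2 + c) ≡ a * c + 2 * a
          r = solve-∀
          two-cl : p ^ j * count p ≤ 2 * (X + p ^ j)
          two-cl = two-class (pw? v p) (p ^ j) (1≤^ j (prime≥1 pp))
            (λ u w (_ , hu) (_ , hw) → pow-split pp j ∣ + u ℤ.- + w ∣ (u + w) (F-difference (p ^ (j + j)) u w v hu hw)) s X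

    -- A prime whose square divides a positive value below `Y * Y` is itself below `Y`, so the range
    -- inspected by `bad Y` is long enough.
    bad-zero-sq : ∀ Y u v → bad Y u v ≡ 0 → 1 ≤ F u v → F u v < Y * Y → ∀ p → Prime p → R < p → ¬ p ∣ v → ¬ p * p ∣ F u v
    bad-zero-sq Y u v e 1≤F F<Y² p pp R<p p∤v h = <-irrefl (sym e)
      (≤-trans (≤-trans (1≤ι (sq? v p u) ((pp , R<p) , p∤v , h)) (∑-term Y (λ p → ι (sq? v p u)) p<Y)) (m≤m+n _ _))
      where
      p<Y : p < Y
      p<Y with p <? Y
      ... | yes q = q
      ... | no q = ⊥-elim (<-irrefl refl (<-≤-trans F<Y² (≤-trans (*-mono-≤ (≮⇒≥ q) (≮⇒≥ q)) (∣⇒≤ {{>-nonZero 1≤F}} h))))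

    bad-zero-pw : ∀ Y u v → bad Y u v ≡ 0 → ∀ p → Prime p → p ≤ R → ¬ p ^ (j + j) ∣ F u v
    bad-zero-pw Y u v e p pp p≤R h = <-irrefl (sym e)
      (≤-trans (≤-trans (1≤ι (pw? v p u) (pp , h)) (∑-term (suc R) (λ p → ι (pw? v p u)) (s≤s p≤R))) (m≤n+m _ (∑ Y (λ p → ι (sq? v p u)))))

    Common : ℕ → ℕ → ℕ → Set
    Common u v p = (Prime p × R < p) × (p ∣ u) × (p ∣ v)

    common? : ∀ u v p → Dec (Common u v p)
    common? u v p = (prime? p ×-dec (R <? p)) ×-dec ((p ∣? u) ×-dec (p ∣? v))

    -- About `X² / p²` points have both coordinates divisible by `p`. The second coordinate runs
    -- over `[1 , X]`, so a solution forces `p ≤ X`, and the error `p` in the first coordinate at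
    -- most doubles its count.
    common-bound : ∀ s X Y → R * ∑ X (λ i → ∑ X (λ k → ∑ Y (λ p → ι (common? (s + i) (suc k) p)))) ≤ 2 * (X * X)
    common-bound s X Y = ≤-trans (≤-reflexive (cong (R *_) swap)) (∑-inverse-squares R (2 * (X * X)) count large small Y)
      where
      open ≤-Reasoning
      count : ℕ → ℕ
      count p = ∑ X (λ i → ∑ X (λ k → ι (common? (s + i) (suc k) p)))
      swap : ∑ X (λ i → ∑ X (λ k → ∑ Y (λ p → ι (common? (s + i) (suc k) p)))) ≡ ∑ Y count
      swap = trans (∑-cong X (λ i _ → ∑-swap X Y (λ k p → ι (common? (s + i) (suc k) p)))) (∑-swap X Y (λ i p → ∑ X (λ k → ι (common? (s + i) (suc k) p))))
      small : ∀ p → p ≤ R → count p ≡ 0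
      small p p≤R = trans (∑-cong X (λ i _ → trans (∑-cong X (λ k _ → ι-no (common? (s + i) (suc k) p) (λ q → <-irrefl refl (<-≤-trans (proj₂ (proj₁ q)) p≤R)))) (∑-zero X))) (∑-zero X)
      large : ∀ p → R < p → p * p * count p ≤ 2 * (X * X)
      large p R<p = begin
        p * p * count p ≤⟨ *-monoʳ-≤ (p * p) (∑-mono X (λ i _ → ∑-mono X (λ k _ → le i k))) ⟩
        p * p * ∑ X (λ i → ∑ X (λ k → ι (p ∣? i + s) * ι (p ∣? suc k))) ≡⟨ cong (p * p *_) (sym (∑-*-∑ X X (λ i → ι (p ∣? i + s)) (λ k → ι (p ∣? suc k)))) ⟩
        p * p * (a * c) ≡⟨ r p a c ⟩
        p * a * (p * c) ≤⟨ product ⟩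
        2 * (X * X) ∎
        where
        r : ∀ p a b → p * p * (a * b) ≡ p * a * (p * b)
        r = solve-∀
        a c : ℕ
        a = ∑ X (λ i → ι (p ∣? i + s))
        c = ∑ X (λ k → ι (p ∣? suc k))
        1≤p : 1 ≤ p
        1≤p = ≤-trans (s≤s z≤n) R<p
        le : ∀ i k → ι (common? (s + i) (suc k) p) ≤ ι (p ∣? i + s) * ι (p ∣? suc k)
        le i k = ≤-trans (ι-mono (common? (s + i) (suc k) p) ((p ∣? i + s) ×-dec (p ∣? suc k)) (λ q → subst (p ∣_) (+-comm s i) (proj₁ (proj₂ q)) , proj₂ (proj₂ q))) (≤-reflexive (sym (ι-×≡ (p ∣? i + s) (p ∣? suc k))))
        product : p * a * (p * c) ≤ 2 * (X * X)
        product with c in ec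
        ... | zero = ≤-trans (≤-reflexive (trans (cong (p * a *_) (*-zeroʳ p)) (*-zeroʳ (p * a)))) z≤n
        ... | suc c′ = ≤-trans (*-mono-≤ (class-upper p s X) mult) (≤-trans (*-monoˡ-≤ X (+-monoʳ-≤ X p≤X)) (≤-reflexive (r′ X)))
          where
          mult : p * suc c′ ≤ X
          mult = subst (λ t → p * t ≤ X) ec (multiples p X 1≤p)
          p≤X : p ≤ X
          p≤X = ≤-trans (m≤m*n p (suc c′)) mult
          r′ : ∀ X → (X + X) * X ≡ 2 * (X * X)
          r′ = solve-∀

  n≤2^n : ∀ n → n ≤ 2 ^ n
  n≤2^n zero = z≤n
  n≤2^n (suc n) = ≤-trans (+-mono-≤ (1≤^ n (s≤s z≤n)) (n≤2^n n)) (≤-reflexive (cong (λ t → 2 ^ n + t) (sym (+-identityʳ _))))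

  module Rare (E c : ℕ) (1≤c : 1 ≤ c) where

    -- `R ≥ 8 E` brings the square obstructions down to `3 X / (8 E)`; the exponent `j` does the
    -- same for the powers, because `2 ^ j` is at least `j`.
    R : ℕ
    R = 8 * E + 2 * β

    j : ℕ
    j = 8 * E * suc R

    2β≤R : 2 * β ≤ R
    2β≤R = m≤n+m (2 * β) (8 * E)

    open Exceptional R j 2β≤R public

    -- The bound is uniform in the shift `s` and in `v`, so it can be summed over the columns of a
    -- box.
    rare : Ev (λ X → ∀ s v → E * ∑ X (λ i → bad (c * X) (s + i) v) ≤ X)
    rare = ev-map (λ X (h₁ , h₂) s v → bound X h₁ h₂ s v) (ev-∘ (unb c 1≤c) (π-sublinear (2 * R * c)) & ev-≥ (16 * E * suc R))
      where
      unb : ∀ c → 1 ≤ c → Unbounded (c *_)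
      unb c 1≤c K = K , λ n K≤n → ≤-trans K≤n (≤-trans (≤-reflexive (sym (*-identityˡ n))) (*-monoˡ-≤ n 1≤c))
      open ≤-Reasoning
      bound : ∀ X → 2 * R * c * π (c * X) ≤ c * X → 16 * E * suc R ≤ X → ∀ s v → E * ∑ X (λ i → bad (c * X) (s + i) v) ≤ X
      bound X hπ hX s v = *-cancelˡ-≤ 8 (begin
        8 * (E * ∑ X (λ i → bad (c * X) (s + i) v)) ≡⟨ cong (λ t → 8 * (E * t)) (∑-+ X _ _) ⟩
        8 * (E * (S₁ + S₂)) ≡⟨ r₀ E S₁ S₂ ⟩
        8 * E * S₁ + 8 * E * S₂ ≤⟨ +-mono-≤ b₁ b₂ ⟩
        3 * X + 3 * X ≤⟨ lin {0} {2 * X} z≤n (r₁ X) ⟩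
        8 * X ∎)
        where
        S₁ S₂ J : ℕ
        S₁ = ∑ X (λ i → ∑ (c * X) (λ p → ι (sq? v p (s + i))))
        S₂ = ∑ X (λ i → ∑ (suc R) (λ p → ι (pw? v p (s + i))))
        J = 2 ^ j
        r₀ : ∀ E a b → 8 * (E * (a + b)) ≡ 8 * E * a + 8 * E * b
        r₀ = solve-∀
        r₁ : ∀ X → 3 * X + 3 * X + 2 * X ≡ 8 * X + 0
        r₁ = solve-∀
        hπ′ : 2 * R * π (c * X) ≤ X
        hπ′ = *-cancelˡ-≤ c {{>-nonZero 1≤c}} (≤-trans (≤-reflexive (r R c (π (c * X)))) hπ)
          where
          r : ∀ R c p → c * (2 * R * p) ≡ 2 * R * c * p
          r = solve-∀
        b₁ : 8 * E * S₁ ≤ 3 * X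
        b₁ = begin
          8 * E * S₁ ≤⟨ *-monoˡ-≤ S₁ (m≤m+n (8 * E) (2 * β)) ⟩
          R * S₁ ≤⟨ sq-bound s v X (c * X) ⟩
          2 * R * π (c * X) + 2 * X ≤⟨ +-monoˡ-≤ (2 * X) hπ′ ⟩
          3 * X ∎
        b₂ : 8 * E * S₂ ≤ 3 * X
        b₂ = *-cancelˡ-≤ J {{m^n≢0 2 j}} (begin
          J * (8 * E * S₂) ≡⟨ r J E S₂ ⟩
          8 * E * (J * S₂) ≤⟨ *-monoʳ-≤ (8 * E) (pw-bound s v X) ⟩
          8 * E * (suc R * (2 * X + 2 * J)) ≡⟨ r′ E (suc R) X J ⟩
          8 * E * suc R * (2 * X) + J * (16 * E * suc R) ≤⟨ +-mono-≤ (*-monoˡ-≤ (2 * X) (n≤2^n j)) (*-monoʳ-≤ J hX) ⟩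
          J * (2 * X) + J * X ≡⟨ r″ J X ⟩
          J * (3 * X) ∎)
          where
          r : ∀ J E S → J * (8 * E * S) ≡ 8 * E * (J * S)
          r = solve-∀
          r′ : ∀ E R X J → 8 * E * (R * (2 * X + 2 * J)) ≡ 8 * E * R * (2 * X) + J * (16 * E * R)
          r′ = solve-∀
          r″ : ∀ J X → J * (2 * X) + J * X ≡ J * (3 * X)
          r″ = solve-∀

  -- Mertens upper bound from differences of box points

  isqrt : ∀ n → ∃ λ r → r * r ≤ n × n < suc r * suc r
  isqrt zero = 0 , z≤n , s≤s z≤n
  isqrt (suc n) with isqrt n
  ... | r , lo , hi with suc n <? suc r * suc r
  ...   | yes h = r , m≤n⇒m≤1+n lo , h
  ...   | no h = suc r , ≮⇒≥ h , ≤-<-trans hi (*-mono-< {suc r} ≤-refl ≤-refl)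

  Δ-injective : ∀ a c → ∣ + a ℤ.- + c ∣ ≡ 0 → a ≡ c
  Δ-injective a c e = ℤₚ.+-injective (ℤₚ.i-j≡0⇒i≡j (+ a) (+ c) (ℤₚ.∣i∣≡0⇒i≡0 e))

  2ab≤a²+b² : ∀ a b → 2 * (a * b) ≤ a * a + b * b
  2ab≤a²+b² zero b = z≤n
  2ab≤a²+b² (suc a) zero = ≤-trans (≤-reflexive (cong (2 *_) (*-zeroʳ (suc a)))) z≤n
  2ab≤a²+b² (suc a) (suc b) = lin (2ab≤a²+b² a b) (r a b)
    where
    r : ∀ a b → 2 * (suc a * suc b) + (a * a + b * b) ≡ suc a * suc a + suc b * suc b + 2 * (a * b)
    r = solve-∀

  cauchy : ∀ p (r : ℕ → ℕ) → ∑ p r * ∑ p r ≤ p * ∑ p (λ c → r c * r c)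
  cauchy p r = *-cancelˡ-≤ 2 (begin
    2 * (∑ p r * ∑ p r) ≡⟨ cong (2 *_) (∑-*-∑ p p r r) ⟩
    2 * ∑ p (λ c → ∑ p (λ d → r c * r d)) ≡⟨ sym (trans (∑-cong p (λ c _ → ∑-* p 2 _)) (∑-* p 2 _)) ⟩
    ∑ p (λ c → ∑ p (λ d → 2 * (r c * r d))) ≤⟨ ∑-mono p (λ c _ → ∑-mono p (λ d _ → 2ab≤a²+b² (r c) (r d))) ⟩
    ∑ p (λ c → ∑ p (λ d → r c * r c + r d * r d)) ≡⟨ ∑-cong p (λ c _ → trans (∑-+ p _ _) (cong (_+ s) (∑-const p (r c * r c)))) ⟩
    ∑ p (λ c → p * (r c * r c) + s) ≡⟨ ∑-+ p _ _ ⟩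
    ∑ p (λ c → p * (r c * r c)) + ∑ p (λ _ → s) ≡⟨ cong₂ _+_ (∑-* p p _) (∑-const p s) ⟩
    p * s + p * s ≡⟨ cong (λ t → p * s + t) (sym (+-identityʳ (p * s))) ⟩
    2 * (p * s) ∎)
    where
    open ≤-Reasoning
    s : ℕ
    s = ∑ p (λ d → r d * r d)

  -- The preimage sizes `r c` sum to at least `n`, while their squares sum to at most the number of
  -- colliding pairs.
  collisions : ∀ p n (f : ℕ → ℕ) → (∀ w → f w < p) → n * n ≤ p * ∑ n (λ w → ∑ n (λ w′ → ι (f w ≟ f w′)))
  collisions p n f f<p = begin
    n * n ≤⟨ *-mono-≤ n≤ n≤ ⟩
    ∑ p r * ∑ p r ≤⟨ cauchy p r ⟩
    p * ∑ p (λ c → r c * r c) ≤⟨ *-monoʳ-≤ p squares ⟩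
    p * ∑ n (λ w → ∑ n (λ w′ → ι (f w ≟ f w′))) ∎
    where
    open ≤-Reasoning
    r : ℕ → ℕ
    r c = ∑ n (λ w → ι (f w ≟ c))
    n≤ : n ≤ ∑ p r
    n≤ = begin
      n ≡⟨ sym (trans (∑-const n 1) (*-identityʳ n)) ⟩
      ∑ n (λ _ → 1) ≤⟨ ∑-mono n (λ w _ → ≤-trans (1≤ι (f w ≟ f w) refl) (∑-term p (λ c → ι (f w ≟ c)) (f<p w))) ⟩
      ∑ n (λ w → ∑ p (λ c → ι (f w ≟ c))) ≡⟨ ∑-swap n p _ ⟩
      ∑ p r ∎
    meet : ∀ a b → ∑ p (λ c → ι (a ≟ c) * ι (b ≟ c)) ≤ ι (a ≟ b)
    meet a b with a ≟ b
    ... | yes a≡b = ≤-trans (∑-mono p (λ c _ → ι-*-drop′ (ι (a ≟ c)) (ι≤1 (b ≟ c)))) (exclusive p (λ c → a ≟ c) (λ i j e e′ → trans (sym e) e′))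
      where
      ι-*-drop′ : ∀ m {k} → k ≤ 1 → m * k ≤ m
      ι-*-drop′ m h = ≤-trans (*-monoʳ-≤ m h) (≤-reflexive (*-identityʳ m))
    ... | no a≢b = ≤-reflexive (trans (∑-cong p (λ c _ → zero′ c)) (∑-zero p))
      where
      zero′ : ∀ c → ι (a ≟ c) * ι (b ≟ c) ≡ 0
      zero′ c = trans (ι-×≡ (a ≟ c) (b ≟ c)) (ι-no ((a ≟ c) ×-dec (b ≟ c)) (λ (e , e′) → a≢b (trans e (sym e′))))
    squares : ∑ p (λ c → r c * r c) ≤ ∑ n (λ w → ∑ n (λ w′ → ι (f w ≟ f w′)))
    squares = begin
      ∑ p (λ c → r c * r c) ≡⟨ ∑-cong p (λ c _ → ∑-*-∑ n n _ _) ⟩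
      ∑ p (λ c → ∑ n (λ w → ∑ n (λ w′ → ι (f w ≟ c) * ι (f w′ ≟ c)))) ≡⟨ ∑-swap p n _ ⟩
      ∑ n (λ w → ∑ p (λ c → ∑ n (λ w′ → ι (f w ≟ c) * ι (f w′ ≟ c)))) ≡⟨ ∑-cong n (λ w _ → ∑-swap p n _) ⟩
      ∑ n (λ w → ∑ n (λ w′ → ∑ p (λ c → ι (f w ≟ c) * ι (f w′ ≟ c)))) ≤⟨ ∑-mono n (λ w _ → ∑-mono n (λ w′ _ → meet (f w) (f w′))) ⟩
      ∑ n (λ w → ∑ n (λ w′ → ι (f w ≟ f w′))) ∎

  σ : ℕ → ℕ
  σ p = ι (split? p)

  -- Q and q stand for a common multiple of the moduli and for Q / p: a sum of terms c p * q p is Q times the sum of c p / p.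
  CommonMultiple : ℕ → ℕ → (ℕ → ℕ) → Set
  CommonMultiple z Q q = ∀ p → 1 ≤ p → p < z → q p * p ≡ Q

  S : (ℕ → ℕ) → ℕ → ℕ
  S q z = ∑ z (λ p → σ p * (2 * (L p * q p)))

  ∑-σL≤ : ∀ z → ∑ z (λ p → σ p * L p) ≤ π z * L z
  ∑-σL≤ z = ≤-trans (∑-mono z (λ p p<z → *-mono-≤ (ι-mono (split? p) (prime? p) Split.isPrime) (L-mono (<⇒≤ p<z)))) (≤-reflexive (∑-*ʳ z _ (L z)))

  module Pairs (X : ℕ) (1≤X : 1 ≤ X) where

    instance
      X≢0 : NonZero X
      X≢0 = >-nonZero 1≤X

    n : ℕ
    n = X * X

    U V : ℕ → ℕ
    U w = w / X
    V w = w % X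

    ΔU ΔV : ℕ → ℕ → ℤ
    ΔU w w′ = + U w ℤ.- + U w′
    ΔV w w′ = + V w ℤ.- + V w′

    D : ℕ → ℕ → ℕ
    D w w′ = F ∣ ΔU w w′ ∣ ∣ ΔV w w′ ∣

    Δ-pos : ∀ w w′ → w ≢ w′ → 1 ≤ ∣ ΔU w w′ ∣ ⊎ 1 ≤ ∣ ΔV w w′ ∣
    Δ-pos w w′ w≢w′ with 1 ≤? ∣ ΔU w w′ ∣ | 1 ≤? ∣ ΔV w w′ ∣
    ... | yes h | _ = inj₁ h
    ... | no _ | yes h = inj₂ h
    ... | no hu | no hv = ⊥-elim (w≢w′ (trans (m≡m%n+[m/n]*n w X) (trans (cong₂ (λ x y → x + y * X) (Δ-injective (V w) (V w′) (n<1⇒n≡0 (≰⇒> hv))) (Δ-injective (U w) (U w′) (n<1⇒n≡0 (≰⇒> hu)))) (sym (m≡m%n+[m/n]*n w′ X)))))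

    D-pos : ∀ w w′ → w ≢ w′ → 1 ≤ D w w′
    D-pos w w′ w≢w′ = F-pos ∣ ΔU w w′ ∣ ∣ ΔV w w′ ∣ (Δ-pos w w′ w≢w′)

    ∣Δ∣< : ∀ a c → a < X → c < X → ∣ + a ℤ.- + c ∣ < X
    ∣Δ∣< a c a< c< = ≤-<-trans (≤-reflexive (cong ∣_∣ (ℤₚ.m-n≡m⊖n a c))) (≤-<-trans (ℤₚ.∣m⊝n∣≤m⊔n a c) (⊔-lub a< c<))

    ΔU< : ∀ w w′ → w < n → w′ < n → ∣ ΔU w w′ ∣ < X
    ΔU< w w′ w< w′< = ∣Δ∣< (U w) (U w′) (m<n*o⇒m/o<n w<) (m<n*o⇒m/o<n w′<)

    ΔV< : ∀ w w′ → ∣ ΔV w w′ ∣ < X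
    ΔV< w w′ = ∣Δ∣< (V w) (V w′) (m%n<n w X) (m%n<n w′ X)

    D-upper : ∀ w w′ → w < n → w′ < n → D w w′ ≤ (1 + β) * n
    D-upper w w′ w< w′< = ≤-trans (F-upper ∣ ΔU w w′ ∣ ∣ ΔV w w′ ∣) (+-mono-≤ (*-mono-≤ u≤ u≤) (*-monoʳ-≤ β (*-mono-≤ v≤ v≤)))
      where
      u≤ : ∣ ΔU w w′ ∣ ≤ X
      u≤ = <⇒≤ (ΔU< w w′ w< w′<)
      v≤ : ∣ ΔV w w′ ∣ ≤ X
      v≤ = <⇒≤ (ΔV< w w′)

    module Lattice {p : ℕ} (s : Split p) where

      open Split s
      r₀ : ℕ
      r₀ = proj₁ hasRoot
      open Root isPrime 2β<p r₀ (proj₁ (proj₂ hasRoot)) (proj₂ (proj₂ hasRoot)) public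

      instance
        p≢0 : NonZero p
        p≢0 = prime⇒nonZero isPrime

      -- The residue that names the coset of a point modulo the lattice of the root `r`.
      key : ℕ → ℕ → ℕ
      key r w = (U w + r * V w) % p

      key-∣ : ∀ r w w′ → key r w ≡ key r w′ → + p ∣ᶻ ΔU w w′ ℤ.+ + r ℤ.* ΔV w w′
      key-∣ r w w′ e = ∣ᶻ-by eq (ℤ∣.divides (+ (a / p) ℤ.- + (a′ / p)) refl)
        where
        a a′ : ℕ
        a = U w + r * V w
        a′ = U w′ + r * V w′
        cast : ∀ w → + (U w + r * V w) ≡ + U w ℤ.+ + r ℤ.* + V w
        cast w = cong (λ t → + U w ℤ.+ t) (ℤₚ.pos-* r (V w))
        div : ∀ a → + a ≡ + (a % p) ℤ.+ + (a / p) ℤ.* + p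
        div a = trans (cong +_ (m≡m%n+[m/n]*n a p)) (cong (λ t → + (a % p) ℤ.+ t) (ℤₚ.pos-* (a / p) p))
        eq : (+ (a / p) ℤ.- + (a′ / p)) ℤ.* + p ≡ ΔU w w′ ℤ.+ + r ℤ.* ΔV w w′
        eq = begin
          (+ (a / p) ℤ.- + (a′ / p)) ℤ.* + p ≡⟨ key-identity (+ (a / p)) (+ (a′ / p)) (+ p) (+ (a % p)) ⟩
          (+ (a % p) ℤ.+ + (a / p) ℤ.* + p) ℤ.- (+ (a % p) ℤ.+ + (a′ / p) ℤ.* + p) ≡⟨ cong (λ t → (+ (a % p) ℤ.+ + (a / p) ℤ.* + p) ℤ.- (+ t ℤ.+ + (a′ / p) ℤ.* + p)) e ⟩
          (+ (a % p) ℤ.+ + (a / p) ℤ.* + p) ℤ.- (+ (a′ % p) ℤ.+ + (a′ / p) ℤ.* + p) ≡⟨ cong₂ ℤ._-_ (trans (sym (div a)) (cast w)) (trans (sym (div a′)) (cast w′)) ⟩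
          (+ U w ℤ.+ + r ℤ.* + V w) ℤ.- (+ U w′ ℤ.+ + r ℤ.* + V w′) ≡⟨ key-difference (+ U w) (+ V w) (+ U w′) (+ V w′) (+ r) ⟩
          ΔU w w′ ℤ.+ + r ℤ.* ΔV w w′ ∎
          where open ≡-Reasoning

      -- The number of the two lattices that contain the difference. A difference in both has its
      -- coordinates divisible by `p`, so this is a lower bound for the exponent of `p` in the value
      -- of the form.
      e : ℕ → ℕ → ℕ
      e w w′ = ι (key r₀ w ≟ key r₀ w′) + ι (key conj w ≟ key conj w′)

      root-conj : p ∣ F conj 1
      root-conj = conj-root isPrime 2β<p r₀ (proj₁ (proj₂ hasRoot)) (proj₂ (proj₂ hasRoot))

      e-∣ : ∀ w w′ → p ^ e w w′ ∣ D w w′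
      e-∣ w w′ with key r₀ w ≟ key r₀ w′ | key conj w ≟ key conj w′
      ... | no _ | no _ = 1∣ _
      ... | yes h | no _ = subst₂ _∣_ (sym (*-identityʳ p)) (sym (form-abs (ΔU w w′) (ΔV w w′))) (∣n (form-∣ (ΔU w w′) (ΔV w w′) (key-∣ r₀ w w′ h)))
      ... | no _ | yes h = subst₂ _∣_ (sym (*-identityʳ p)) (sym (form-abs (ΔU w w′) (ΔV w w′))) (∣n (Root.form-∣ isPrime 2β<p conj conj<p root-conj (ΔU w w′) (ΔV w w′) (key-∣ conj w w′ h)))
      ... | yes h | yes h′ = subst₂ _∣_ (sym (cong (p *_) (*-identityʳ p))) (sym (form-abs (ΔU w w′) (ΔV w w′))) (∣n (form-squares-∣ p (ΔU w w′) (ΔV w w′) (proj₁ pp) (proj₂ pp)))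
        where
        pp : + p ∣ᶻ ΔU w w′ × + p ∣ᶻ ΔV w w′
        pp = both (ΔU w w′) (ΔV w w′) (key-∣ r₀ w w′ h) (key-∣ conj w w′ h′)

      off : ℕ
      off = ∑ n (λ w → ∑ n (λ w′ → ι (¬? (w ≟ w′)) * e w w′))

      -- Cauchy-Schwarz gives at least `n² / p` pairs for each lattice. The `n` diagonal pairs,
      -- whose difference is zero, are separated off.
      many : 2 * (n * n) ≤ p * (off + 2 * n)
      many = begin
        2 * (n * n) ≡⟨ cong (λ t → n * n + t) (+-identityʳ (n * n)) ⟩
        n * n + n * n ≤⟨ +-mono-≤ (collisions p n (key r₀) (λ w → m%n<n _ p)) (collisions p n (key conj) (λ w → m%n<n _ p)) ⟩
        p * A + p * B ≡⟨ sym (*-distribˡ-+ p A B) ⟩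
        p * (A + B) ≡⟨ cong (p *_) (sym (trans (∑-cong n (λ w _ → ∑-+ n _ _)) (∑-+ n _ _))) ⟩
        p * ∑ n (λ w → ∑ n (e w)) ≤⟨ *-monoʳ-≤ p (∑-mono n (λ w w<n → row w w<n)) ⟩
        p * ∑ n (λ w → ∑ n (λ w′ → ι (¬? (w ≟ w′)) * e w w′) + 2) ≡⟨ cong (p *_) (trans (∑-+ n _ _) (cong (λ t → off + t) (trans (∑-const n 2) (*-comm n 2)))) ⟩
        p * (off + 2 * n) ∎
        where
        open ≤-Reasoning
        A B : ℕ
        A = ∑ n (λ w → ∑ n (λ w′ → ι (key r₀ w ≟ key r₀ w′)))
        B = ∑ n (λ w → ∑ n (λ w′ → ι (key conj w ≟ key conj w′)))
        e≤2 : ∀ w w′ → e w w′ ≤ 2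
        e≤2 w w′ = +-mono-≤ (ι≤1 (key r₀ w ≟ key r₀ w′)) (ι≤1 (key conj w ≟ key conj w′))
        term : ∀ w w′ → e w w′ ≤ ι (¬? (w ≟ w′)) * e w w′ + ι (w ≟ w′) * 2
        term w w′ = cases (w ≟ w′)
          where
          cases : (d : Dec (w ≡ w′)) → e w w′ ≤ ι (¬? d) * e w w′ + ι d * 2
          cases (yes _) = e≤2 w w′
          cases (no _) = ≤-reflexive (sym (trans (+-identityʳ _) (+-identityʳ _)))
        row : ∀ w → w < n → ∑ n (e w) ≤ ∑ n (λ w′ → ι (¬? (w ≟ w′)) * e w w′) + 2
        row w _ = ≤-trans (∑-mono n (λ w′ _ → term w w′)) (≤-trans (≤-reflexive (∑-+ n _ _))
          (+-monoʳ-≤ _ (≤-trans (≤-reflexive (∑-*ʳ n _ 2)) (*-monoˡ-≤ 2 (exclusive n (λ w′ → w ≟ w′) (λ i j a b → trans (sym a) b))))))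

    exponent : ∀ {p} → Dec (Split p) → ℕ → ℕ → ℕ
    exponent (yes s) w w′ = Lattice.e s w w′
    exponent (no _) w w′ = 0

    exponent-∣ : ∀ {p} (d : Dec (Split p)) w w′ → p ^ exponent d w w′ ∣ D w w′
    exponent-∣ (yes s) w w′ = Lattice.e-∣ s w w′
    exponent-∣ (no _) w w′ = 1∣ _

    off : ∀ p → ℕ
    off p = ∑ n (λ w → ∑ n (λ w′ → ι (¬? (w ≟ w′)) * exponent (split? p) w w′))

    many : ∀ p (d : Dec (Split p)) → ι d * (2 * (n * n)) ≤ ι d * (p * (∑ n (λ w → ∑ n (λ w′ → ι (¬? (w ≟ w′)) * exponent d w w′)) + 2 * n))
    many p (yes s) = *-monoʳ-≤ 1 (Lattice.many s)
    many p (no _) = z≤n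

    Λ : ℕ
    Λ = L ((1 + β) * n)

    -- Off the diagonal the value `D w w′` is positive and at most `(1 + β) * n`, so by `∑-L≤` its
    -- split prime powers weigh at most `Λ`.
    total : ∀ z → ∑ z (λ p → ι (prime? p) * (L p * off p)) ≤ n * (n * Λ)
    total z = begin
      ∑ z (λ p → ι (prime? p) * (L p * off p)) ≡⟨ ∑-cong z (λ p _ → expand p) ⟩
      ∑ z (λ p → ∑ n (λ w → ∑ n (λ w′ → ι (¬? (w ≟ w′)) * (ι (prime? p) * (exponent (split? p) w w′ * L p))))) ≡⟨ trans (∑-swap z n _) (∑-cong n (λ w _ → ∑-swap z n _)) ⟩
      ∑ n (λ w → ∑ n (λ w′ → ∑ z (λ p → ι (¬? (w ≟ w′)) * (ι (prime? p) * (exponent (split? p) w w′ * L p))))) ≡⟨ ∑-cong n (λ w _ → ∑-cong n (λ w′ _ → ∑-* z (ι (¬? (w ≟ w′))) _)) ⟩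
      ∑ n (λ w → ∑ n (λ w′ → ι (¬? (w ≟ w′)) * ∑ z (λ p → ι (prime? p) * (exponent (split? p) w w′ * L p)))) ≤⟨ ∑-≤const n (n * Λ) (λ w w< → ∑-≤const n Λ (λ w′ w′< → cell w w′ w< w′<)) ⟩
      n * (n * Λ) ∎
      where
      open ≤-Reasoning
      cell : ∀ w w′ → w < n → w′ < n → ι (¬? (w ≟ w′)) * ∑ z (λ p → ι (prime? p) * (exponent (split? p) w w′ * L p)) ≤ Λ
      cell w w′ w< w′< = ≤-trans (ι-*≤ (¬? (w ≟ w′)) (λ w≢ → ≤-trans (∑-L≤ z (D w w′) (λ p → exponent (split? p) w w′) (D-pos w w′ w≢) (λ p _ → exponent-∣ (split? p) w w′)) (L-mono (D-upper w w′ w< w′<)))) (ι-*-drop (¬? (w ≟ w′)) Λ)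
      r : ∀ i l a x → i * (l * (a * x)) ≡ a * (i * (x * l))
      r = solve-∀
      pull : ∀ c (f : ℕ → ℕ → ℕ) → c * ∑ n (λ w → ∑ n (f w)) ≡ ∑ n (λ w → ∑ n (λ w′ → c * f w w′))
      pull c f = sym (trans (∑-cong n (λ w _ → ∑-* n c _)) (∑-* n c _))
      expand : ∀ p → ι (prime? p) * (L p * off p) ≡ ∑ n (λ w → ∑ n (λ w′ → ι (¬? (w ≟ w′)) * (ι (prime? p) * (exponent (split? p) w w′ * L p))))
      expand p = trans (cong (ι (prime? p) *_) (pull (L p) _)) (trans (pull (ι (prime? p)) _) (∑-cong n (λ w _ → ∑-cong n (λ w′ _ → r (ι (prime? p)) (L p) (ι (¬? (w ≟ w′))) (exponent (split? p) w w′)))))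

    -- `many` gives each split prime a share of at least `2 n² / p - 2 n` pairs, and `total` bounds
    -- all shares, weighted by logarithms, together.
    upper : ∀ z Q q → CommonMultiple z Q q → n * S q z ≤ Q * (n * Λ) + 2 * (Q * (π z * L z))
    upper z Q q cm = *-cancelˡ-≤ n {{m*n≢0 X X}} (begin
      n * (n * S q z) ≡⟨ pull ⟩
      ∑ z (λ p → L p * q p * (σ p * (2 * (n * n)))) ≤⟨ ∑-mono z (λ p p<z → step p p<z) ⟩
      ∑ z (λ p → Q * (ι (prime? p) * (L p * off p)) + 2 * n * Q * (σ p * L p)) ≡⟨ trans (∑-+ z _ _) (cong₂ _+_ (∑-* z Q _) (∑-* z (2 * n * Q) _)) ⟩
      Q * ∑ z (λ p → ι (prime? p) * (L p * off p)) + 2 * n * Q * ∑ z (λ p → σ p * L p) ≤⟨ +-mono-≤ (*-monoʳ-≤ Q (total z)) (*-monoʳ-≤ (2 * n * Q) (∑-σL≤ z)) ⟩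
      Q * (n * (n * Λ)) + 2 * n * Q * (π z * L z) ≡⟨ r₂ n Q Λ (π z * L z) ⟩
      n * (Q * (n * Λ) + 2 * (Q * (π z * L z))) ∎)
      where
      open ≤-Reasoning
      r₁ : ∀ n s l q → n * (n * (s * (2 * (l * q)))) ≡ l * q * (s * (2 * (n * n)))
      r₁ = solve-∀
      r₂ : ∀ n Q Λ x → Q * (n * (n * Λ)) + 2 * n * Q * x ≡ n * (Q * (n * Λ) + 2 * (Q * x))
      r₂ = solve-∀
      pull : n * (n * S q z) ≡ ∑ z (λ p → L p * q p * (σ p * (2 * (n * n))))
      pull = trans (cong (n *_) (sym (∑-* z n _))) (trans (sym (∑-* z n _)) (∑-cong z (λ p _ → r₁ n (σ p) (L p) (q p))))
      step : ∀ p → p < z → L p * q p * (σ p * (2 * (n * n))) ≤ Q * (ι (prime? p) * (L p * off p)) + 2 * n * Q * (σ p * L p)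
      step zero _ = ≤-trans (≤-reflexive (trans (cong (λ t → L 0 * q 0 * (t * (2 * (n * n)))) (ι-no (split? 0) (λ s → ¬prime[0] (Split.isPrime s)))) (*-zeroʳ (L 0 * q 0)))) z≤n
      step p@(suc _) p<z = begin
        L p * q p * (σ p * (2 * (n * n))) ≤⟨ *-monoʳ-≤ (L p * q p) (many p (split? p)) ⟩
        L p * q p * (σ p * (p * (off p + 2 * n))) ≡⟨ r₃ (L p) (q p) (σ p) p (off p) n ⟩
        q p * p * (σ p * (L p * off p)) + 2 * n * (q p * p) * (σ p * L p) ≡⟨ cong (λ t → t * (σ p * (L p * off p)) + 2 * n * t * (σ p * L p)) (cm p (s≤s z≤n) p<z) ⟩
        Q * (σ p * (L p * off p)) + 2 * n * Q * (σ p * L p) ≤⟨ +-monoˡ-≤ _ (*-monoʳ-≤ Q (*-monoˡ-≤ (L p * off p) (ι-mono (split? p) (prime? p) Split.isPrime))) ⟩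
        Q * (ι (prime? p) * (L p * off p)) + 2 * n * Q * (σ p * L p) ∎
        where
        r₃ : ∀ l q s p o n → l * q * (s * (p * (o + 2 * n))) ≡ q * p * (s * (l * o)) + 2 * n * (q * p) * (s * l)
        r₃ = solve-∀

  -- The side of the box is just above the square root of `z`: then `Λ` is `L z` up to a constant,
  -- and the diagonal costs only `π z`, which is small against `n`. Each of these takes half of the
  -- slack `1 / T`.
  mertens-upper : Ev (λ z → ∀ Q q → CommonMultiple z Q q → T * S q z ≤ (T + 1) * (Q * L z))
  mertens-upper = ev-map (λ z (h₁ , h₂ , h₃) → bound z h₁ h₂ h₃) (ev-≥ 1 & π-sublinear (4 * T) & L-unbounded (2 * T * K))
    where
    K : ℕ
    K = L ((1 + β) * 4) + 1
    bound : ∀ z → 1 ≤ z → 4 * T * π z ≤ z → 2 * T * K ≤ L z → ∀ Q q → CommonMultiple z Q q → T * S q z ≤ (T + 1) * (Q * L z)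
    bound z 1≤z hπ hL Q q cm with isqrt z
    ... | r , lo , hi = *-cancelˡ-≤ (2 * n) {{m*n≢0 2 n {{_}} {{m*n≢0 X X}}}} (begin
        2 * n * (T * S q z) ≡⟨ r₁ n T (S q z) ⟩
        2 * T * (n * S q z) ≤⟨ *-monoʳ-≤ (2 * T) (upper z Q q cm) ⟩
        2 * T * (Q * (n * Λ) + 2 * (Q * (π z * L z))) ≡⟨ r₂ T Q n Λ (π z) (L z) ⟩
        2 * T * (Q * (n * Λ)) + Q * (4 * T * π z * L z) ≤⟨ +-mono-≤ (*-monoʳ-≤ (2 * T) (*-monoʳ-≤ Q (*-monoʳ-≤ n Λ≤))) (*-monoʳ-≤ Q (*-monoˡ-≤ (L z) (≤-trans hπ (<⇒≤ hi)))) ⟩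
        2 * T * (Q * (n * (K + L z))) + Q * (n * L z) ≡⟨ r₃ T Q n K (L z) ⟩
        Q * n * (2 * T * K) + Q * n * (2 * T * L z + L z) ≤⟨ +-monoˡ-≤ _ (*-monoʳ-≤ (Q * n) hL) ⟩
        Q * n * L z + Q * n * (2 * T * L z + L z) ≡⟨ r₄ T Q n (L z) ⟩
        2 * n * ((T + 1) * (Q * L z)) ∎)
      where
      X : ℕ
      X = suc r
      open Pairs X (s≤s z≤n)
      open ≤-Reasoning
      1≤r : 1 ≤ r
      1≤r = n≢0⇒n>0 (λ { refl → <-irrefl refl (<-≤-trans hi 1≤z) })
      n≤4z : n ≤ 4 * z
      n≤4z = ≤-trans (*-mono-≤ X≤2r X≤2r) (≤-trans (≤-reflexive (r₅ r)) (*-monoʳ-≤ 4 lo))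
        where
        X≤2r : X ≤ 2 * r
        X≤2r = ≤-trans (+-monoˡ-≤ r 1≤r) (≤-reflexive (cong (λ t → r + t) (sym (+-identityʳ r))))
        r₅ : ∀ r → 2 * r * (2 * r) ≡ 4 * (r * r)
        r₅ = solve-∀
      Λ≤ : Λ ≤ K + L z
      Λ≤ = ≤-trans (L-mono (≤-trans (*-monoʳ-≤ (1 + β) n≤4z) (≤-reflexive (sym (*-assoc (1 + β) 4 z))))) (≤-trans (L-sub ((1 + β) * 4) z) (≤-reflexive (swap (L ((1 + β) * 4)) (L z))))
        where
        swap : ∀ a b → a + b + 1 ≡ a + 1 + b
        swap = solve-∀
      r₁ : ∀ n T s → 2 * n * (T * s) ≡ 2 * T * (n * s)
      r₁ = solve-∀
      r₂ : ∀ T Q n l p z → 2 * T * (Q * (n * l) + 2 * (Q * (p * z))) ≡ 2 * T * (Q * (n * l)) + Q * (4 * T * p * z)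
      r₂ = solve-∀
      r₃ : ∀ T Q n K l → 2 * T * (Q * (n * (K + l))) + Q * (n * l) ≡ Q * n * (2 * T * K) + Q * n * (2 * T * l + l)
      r₃ = solve-∀
      r₄ : ∀ T Q n l → Q * n * l + Q * n * (2 * T * l + l) ≡ 2 * n * ((T + 1) * (Q * l))
      r₄ = solve-∀

  -- Lattice points in a box, counted strip by strip

  exclusive₂ : ∀ m n {P : ℕ → ℕ → Set} (P? : ∀ i k → Dec (P i k)) →
    (∀ i k i′ k′ → P i k → P i′ k′ → i ≡ i′ × k ≡ k′) → ∑ m (λ i → ∑ n (λ k → ι (P? i k))) ≤ 1
  exclusive₂ m n {P} P? h = ≤-trans (∑-mono m (λ i _ → collapse i)) (exclusive m (λ i → 1 ≤? inner i) same)
    where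
    inner : ℕ → ℕ
    inner i = ∑ n (λ k → ι (P? i k))
    collapse : ∀ i → inner i ≤ ι (1 ≤? inner i)
    collapse i with 1 ≤? inner i
    ... | yes _ = exclusive n (P? i) (λ k k′ p p′ → proj₂ (h i k i k′ p p′))
    ... | no q = ≤-pred (≰⇒> q)
    same : ∀ i i′ → 1 ≤ inner i → 1 ≤ inner i′ → i ≡ i′
    same i i′ a b with ∑-pos n _ a | ∑-pos n _ b
    ... | k , _ , x | k′ , _ , y = proj₁ (h i k i′ k′ (ι-holds (P? i k) x) (ι-holds (P? i′ k′) y))

  ∑-blocks : ∀ a m (f : ℕ → ℕ) → ∑ (m * a) f ≡ ∑ m (λ t → ∑ a (λ i → f (t * a + i)))
  ∑-blocks a zero f = refl
  ∑-blocks a (suc m) f = trans (cong (λ k → ∑ k f) (+-comm a (m * a))) (trans (∑-split (m * a) a f) (cong (_+ ∑ a (λ i → f (m * a + i))) (∑-blocks a m f)))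

  pos-∸ : ∀ {m n} → n ≤ m → + (m ∸ n) ≡ + m ℤ.- + n
  pos-∸ {m} {n} n≤m = trans (sym (ℤₚ.⊖-≥ n≤m)) (sym (ℤₚ.m-n≡m⊖n m n))

  -- Points of a lattice of index p in a box. If (a , κ) is a vector of the lattice, the linear form
  -- a y - κ x takes values divisible by p on it, and within a strip of width a it separates points.
  module Strips (p a : ℕ) (1≤a : 1 ≤ a) (κ : ℤ) (∣κ∣≤a : ∣ κ ∣ ≤ a)
    {G : ℕ → ℕ → Set} (G? : ∀ i k → Dec (G i k))
    (cross : ∀ i k i′ k′ → G i k → G i′ k′ → + p ∣ᶻ + a ℤ.* (+ k ℤ.- + k′) ℤ.- κ ℤ.* (+ i ℤ.- + i′))
    (separate : ∀ i k i′ k′ → G i k → G i′ k′ → + a ℤ.* (+ k ℤ.- + k′) ≡ κ ℤ.* (+ i ℤ.- + i′) → ∣ + i ℤ.- + i′ ∣ < a → i ≡ i′ × k ≡ k′) where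

    -- Equals `- κ i` up to a constant: for `κ ≥ 0` the constant `κ a` keeps it a natural number
    -- inside a strip of width `a`.
    shift : ℤ → ℕ → ℕ
    shift (+ y) i = y * (a ∸ i)
    shift ℤ.-[1+ y ] i = suc y * i

    shift≤ : ∀ κ i → ∣ κ ∣ ≤ a → i ≤ a → shift κ i ≤ a * a
    shift≤ (+ y) i h i≤a = *-mono-≤ h (m∸n≤m a i)
    shift≤ ℤ.-[1+ y ] i h i≤a = *-mono-≤ h i≤a

    shift-Δ : ∀ κ i i′ → i ≤ a → i′ ≤ a → + shift κ i ℤ.- + shift κ i′ ≡ ℤ.- (κ ℤ.* (+ i ℤ.- + i′))
    shift-Δ (+ y) i i′ i≤a i′≤a = trans
      (cong₂ ℤ._-_ (trans (ℤₚ.pos-* y (a ∸ i)) (cong (λ t → + y ℤ.* t) (pos-∸ i≤a))) (trans (ℤₚ.pos-* y (a ∸ i′)) (cong (λ t → + y ℤ.* t) (pos-∸ i′≤a))))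
      (shift-identity (+ y) (+ a) (+ i) (+ i′))
    shift-Δ ℤ.-[1+ y ] i i′ i≤a i′≤a = trans
      (cong₂ ℤ._-_ (ℤₚ.pos-* (suc y) i) (ℤₚ.pos-* (suc y) i′)) (shift-identity′ (+ suc y) (+ i) (+ i′))

    τ : ℕ → ℕ → ℕ
    τ i k = a * k + shift κ i

    τ-Δ : ∀ i₀ i k i′ k′ → i ≤ a → i′ ≤ a → + τ i k ℤ.- + τ i′ k′ ≡ + a ℤ.* (+ k ℤ.- + k′) ℤ.- κ ℤ.* (+ (i₀ + i) ℤ.- + (i₀ + i′))
    τ-Δ i₀ i k i′ k′ i≤a i′≤a = trans (cong₂ (λ s t → (s ℤ.+ + shift κ i) ℤ.- (t ℤ.+ + shift κ i′)) (ℤₚ.pos-* a k) (ℤₚ.pos-* a k′))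
      (trans (τ-identity (+ a) (+ k) (+ k′) (+ shift κ i) (+ shift κ i′))
      (trans (cong (λ t → + a ℤ.* (+ k ℤ.- + k′) ℤ.+ t) (shift-Δ κ i i′ i≤a i′≤a)) (τ-identity′ (+ a ℤ.* (+ k ℤ.- + k′)) κ (+ i₀) (+ i) (+ i′))))

    ∣Δ∣<a : ∀ i₀ i i′ → i < a → i′ < a → ∣ + (i₀ + i) ℤ.- + (i₀ + i′) ∣ < a
    ∣Δ∣<a i₀ i i′ i< i′< = ≤-<-trans (≤-reflexive (cong ∣_∣ (trans (cancel-shift (+ i₀) (+ i) (+ i′)) (ℤₚ.m-n≡m⊖n i i′)))) (≤-<-trans (ℤₚ.∣m⊝n∣≤m⊔n i i′) (⊔-lub i< i′<))

    -- Inside one strip `τ` separates the lattice points, stays below `a * (X + a)`, and has values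
    -- that differ by multiples of `p`; so the values form a spaced set.
    block : ∀ X i₀ → p * ∑ a (λ i → ∑ X (λ k → ι (G? (i₀ + i) k))) ≤ a * (X + a) + p
    block X i₀ = ≤-trans (*-monoʳ-≤ p injected) (spaced (λ t → 1 ≤? hit t) p N spacing)
      where
      open ≤-Reasoning
      N : ℕ
      N = a * (X + a)
      Hit? : ∀ t i k → Dec ((G (i₀ + i) k × i < a) × τ i k ≡ t)
      Hit? t i k = (G? (i₀ + i) k ×-dec (i <? a)) ×-dec (τ i k ≟ t)
      hit : ℕ → ℕ
      hit t = ∑ a (λ i → ∑ X (λ k → ι (Hit? t i k)))
      τ< : ∀ i k → i < a → k < X → τ i k < N
      τ< i k i<a k<X = begin-strict
        a * k + shift κ i <⟨ +-mono-<-≤ (*-monoʳ-< a {{>-nonZero 1≤a}} k<X) (shift≤ κ i ∣κ∣≤a (<⇒≤ i<a)) ⟩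
        a * X + a * a ≡⟨ sym (*-distribˡ-+ a X a) ⟩
        a * (X + a) ∎
      single : ∀ t i k i′ k′ → (G (i₀ + i) k × i < a) × τ i k ≡ t → (G (i₀ + i′) k′ × i′ < a) × τ i′ k′ ≡ t → i ≡ i′ × k ≡ k′
      single t i k i′ k′ ((g , i<) , e) ((g′ , i′<) , e′) = +-cancelˡ-≡ i₀ i i′ (proj₁ q) , proj₂ q
        where
        zero-diff : + a ℤ.* (+ k ℤ.- + k′) ℤ.- κ ℤ.* (+ (i₀ + i) ℤ.- + (i₀ + i′)) ≡ ℤ.0ℤ
        zero-diff = trans (sym (τ-Δ i₀ i k i′ k′ (<⇒≤ i<) (<⇒≤ i′<))) (trans (cong (λ s → + s ℤ.- + τ i′ k′) (trans e (sym e′))) (ℤₚ.+-inverseʳ (+ τ i′ k′)))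
        q : i₀ + i ≡ i₀ + i′ × k ≡ k′
        q = separate (i₀ + i) k (i₀ + i′) k′ g g′ (ℤₚ.i-j≡0⇒i≡j _ _ zero-diff) (∣Δ∣<a i₀ i i′ i< i′<)
      injected : ∑ a (λ i → ∑ X (λ k → ι (G? (i₀ + i) k))) ≤ ∑ N (λ t → ι (1 ≤? hit t))
      injected = begin
        ∑ a (λ i → ∑ X (λ k → ι (G? (i₀ + i) k))) ≤⟨ ∑-mono a (λ i i<a → ∑-mono X (λ k k<X → land i k i<a k<X)) ⟩
        ∑ a (λ i → ∑ X (λ k → ∑ N (λ t → ι (Hit? t i k)))) ≡⟨ trans (∑-cong a (λ i _ → ∑-swap X N (λ k t → ι (Hit? t i k)))) (∑-swap a N (λ i t → ∑ X (λ k → ι (Hit? t i k)))) ⟩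
        ∑ N hit ≤⟨ ∑-mono N (λ t _ → collapse t) ⟩
        ∑ N (λ t → ι (1 ≤? hit t)) ∎
        where
        land : ∀ i k → i < a → k < X → ι (G? (i₀ + i) k) ≤ ∑ N (λ t → ι (Hit? t i k))
        land i k i<a k<X = cases (G? (i₀ + i) k)
          where
          cases : (d : Dec (G (i₀ + i) k)) → ι d ≤ ∑ N (λ t → ι (Hit? t i k))
          cases (no _) = z≤n
          cases (yes g) = ≤-trans (1≤ι (Hit? (τ i k) i k) ((g , i<a) , refl)) (∑-term N (λ t → ι (Hit? t i k)) (τ< i k i<a k<X))
        collapse : ∀ t → hit t ≤ ι (1 ≤? hit t)
        collapse t = cases (1 ≤? hit t)
          where
          cases : (d : Dec (1 ≤ hit t)) → hit t ≤ ι d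
          cases (yes _) = exclusive₂ a X (Hit? t) (single t)
          cases (no q) = ≤-pred (≰⇒> q)
      witness : ∀ t → 1 ≤ hit t → ∃ λ i → ∃ λ k → (G (i₀ + i) k × i < a) × τ i k ≡ t
      witness t h = let (i , _ , x) = ∑-pos a _ h ; (k , _ , y) = ∑-pos X _ x in i , k , ι-holds (Hit? t i k) y
      spacing : ∀ t t′ → t < t′ → 1 ≤ hit t → 1 ≤ hit t′ → t + p ≤ t′
      spacing t t′ t<t′ h h′ = go (witness t h) (witness t′ h′)
        where
        go : (∃ λ i → ∃ λ k → (G (i₀ + i) k × i < a) × τ i k ≡ t) → (∃ λ i → ∃ λ k → (G (i₀ + i) k × i < a) × τ i k ≡ t′) → t + p ≤ t′
        go (i , k , (g , i<) , e) (i′ , k′ , (g′ , i′<) , e′) = ∣∸⇒≤ p t t′ t<t′ p∣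
          where
          p∣ : p ∣ t′ ∸ t
          p∣ = ∣n {p} {+ (t′ ∸ t)} (∣ᶻ-by (trans (sym (τ-Δ i₀ i′ k′ i k (<⇒≤ i′<) (<⇒≤ i<))) (trans (cong₂ (λ x y → + x ℤ.- + y) e′ e) (sym (pos-∸ (<⇒≤ t<t′))))) (cross (i₀ + i′) k′ (i₀ + i) k g′ g))

    module _ (a²≤p : a * a ≤ p) (X : ℕ) where

      instance
        a≢0 : NonZero a
        a≢0 = >-nonZero 1≤a

      -- With `m = X / a + 1` strips, `a * a ≤ p` turns everything beyond `X * X` into at most
      -- `3 m + 1` multiples of `p`.
      count : p * ∑ X (λ i → ∑ X (λ k → ι (G? i k))) ≤ X * X + p * (3 * (X / a) + 4)
      count = begin
        p * ∑ X f ≤⟨ *-monoʳ-≤ p (∑-monoˡ f X≤) ⟩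
        p * ∑ (m * a) f ≡⟨ trans (cong (p *_) (∑-blocks a m f)) (sym (∑-* m p _)) ⟩
        ∑ m (λ t → p * ∑ a (λ i → f (t * a + i))) ≤⟨ ∑-≤const m (a * (X + a) + p) (λ t _ → block X (t * a)) ⟩
        m * (a * (X + a) + p) ≡⟨ strip₁ m a X p ⟩
        m * a * (X + a) + m * p ≤⟨ +-monoˡ-≤ (m * p) (*-monoˡ-≤ (X + a) ma≤) ⟩
        (X + a) * (X + a) + m * p ≡⟨ strip₂ X a m p ⟩
        X * X + (2 * a * X + a * a + m * p) ≤⟨ +-monoʳ-≤ (X * X) (+-monoˡ-≤ (m * p) (+-mono-≤ (*-monoʳ-≤ (2 * a) X≤) a²≤p)) ⟩
        X * X + (2 * a * (m * a) + p + m * p) ≡⟨ cong (λ t → X * X + (t + p + m * p)) (strip₃ a m) ⟩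
        X * X + (2 * m * (a * a) + p + m * p) ≤⟨ +-monoʳ-≤ (X * X) (+-monoˡ-≤ (m * p) (+-monoˡ-≤ p (*-monoʳ-≤ (2 * m) a²≤p))) ⟩
        X * X + (2 * m * p + p + m * p) ≡⟨ strip₄ X (X / a) p ⟩
        X * X + p * (3 * (X / a) + 4) ∎
        where
        open ≤-Reasoning
        m : ℕ
        m = suc (X / a)
        f : ℕ → ℕ
        f i = ∑ X (λ k → ι (G? i k))
        X≤ : X ≤ m * a
        X≤ = ≤-trans (≤-reflexive (m≡m%n+[m/n]*n X a)) (+-monoˡ-≤ (X / a * a) (<⇒≤ (m%n<n X a)))
        ma≤ : m * a ≤ X + a
        ma≤ = ≤-trans (+-monoʳ-≤ a (m/n*n≤m X a)) (≤-reflexive (+-comm a X))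

  least : ∀ {P : ℕ → Set} (P? : ∀ n → Dec (P n)) m → P m → ∃ λ a → a ≤ m × P a × (∀ k → k < a → ¬ P k)
  least {P} P? = <-rec _ go
    where
    go : ∀ m → (∀ {k} → k < m → P k → ∃ λ a → a ≤ k × P a × (∀ i → i < a → ¬ P i)) → P m → ∃ λ a → a ≤ m × P a × (∀ i → i < a → ¬ P i)
    go m rec Pm with anyUpTo? P? m
    ... | no none = m , ≤-refl , Pm , λ k k<m Pk → none (k , k<m , Pk)
    ... | yes (k , k<m , Pk) with rec k<m Pk
    ...   | a , a≤k , Pa , min = a , ≤-trans a≤k (<⇒≤ k<m) , Pa , min

  -- Shortest zeros of the form modulo a split prime

  Short : ℕ → ℕ → Set
  Short p a = ∃ λ x → (x < suc a) × (∃ λ y → (y < suc a) × ((1 ≤ x ⊎ 1 ≤ y) × (p ∣ F x y)))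

  short? : ∀ p a → Dec (Short p a)
  short? p a = anyUpTo? (λ x → anyUpTo? (λ y → ((1 ≤? x) ⊎-dec (1 ≤? y)) ×-dec (p ∣? F x y)) (suc a)) (suc a)

  record Shortest (p : ℕ) : Set where
    field
      a x y : ℕ
      a²≤p : a * a ≤ p
      x≤a : x ≤ a
      y≤a : y ≤ a
      nonzero : 1 ≤ x ⊎ 1 ≤ y
      p∣Fxy : p ∣ F x y
      minimal : ∀ k → k < a → ¬ Short p k

  -- Thue's lemma: a box with more than `p` points contains two points whose difference lies in one
  -- of the lattices, for otherwise `many` without pairs off the diagonal gives `n ≤ p`.
  thue : ∀ {p} → Split p → ∃ λ m → m * m ≤ p × Short p m
  thue {p} s with isqrt p
  ... | m , m²≤p , p<X² = m , m²≤p , go (1 ≤? off)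
    where
    open Pairs (suc m) (s≤s z≤n) hiding (off; many)
    open Lattice s
    open ≤-Reasoning
    collide : 1 ≤ off → Short p m
    collide h = let (w , w< , h₁) = ∑-pos n _ h ; (w′ , w′< , h₂) = ∑-pos n _ h₁ in found w w′ w< w′< h₂
      where
      found : ∀ w w′ → w < n → w′ < n → 1 ≤ ι (¬? (w ≟ w′)) * e w w′ → Short p m
      found w w′ w< w′< h = ∣ ΔU w w′ ∣ , ΔU< w w′ w< w′< , ∣ ΔV w w′ ∣ , ΔV< w w′ , Δ-pos w w′ w≢ , p∣D
        where
        distinct : 1 ≤ ι (¬? (w ≟ w′))
        distinct = >-nonZero⁻¹ _ {{m*n≢0⇒m≢0 (ι (¬? (w ≟ w′))) {{>-nonZero h}}}}
        w≢ : w ≢ w′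
        w≢ = ι-holds (¬? (w ≟ w′)) distinct
        p∣D : p ∣ D w w′
        p∣D = positive-power (e w w′) (>-nonZero⁻¹ _ {{m*n≢0⇒n≢0 (ι (¬? (w ≟ w′))) {{>-nonZero h}}}}) (e-∣ w w′)
          where
          positive-power : ∀ k → 1 ≤ k → p ^ k ∣ D w w′ → p ∣ D w w′
          positive-power (suc k) _ d = ∣-trans (m∣m*n (p ^ k)) d
    go : Dec (1 ≤ off) → Short p m
    go (yes h) = collide h
    go (no h) = ⊥-elim (<-irrefl refl (<-≤-trans p<X² (*-cancelˡ-≤ (2 * n) {{m*n≢0 2 n}} (begin
      2 * n * n ≡⟨ *-assoc 2 n n ⟩
      2 * (n * n) ≤⟨ many ⟩
      p * (off + 2 * n) ≡⟨ cong (λ t → p * (t + 2 * n)) (n<1⇒n≡0 (≰⇒> h)) ⟩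
      p * (2 * n) ≡⟨ *-comm p (2 * n) ⟩
      2 * n * p ∎))))

  abstract
    shortest : ∀ {p} → Split p → Shortest p
    shortest {p} s = let (m , m²≤p , sh) = thue s ; (a , a≤m , (x , x< , y , y< , nz , d) , min) = least (short? p) m sh in record
      { a = a ; x = x ; y = y ; a²≤p = ≤-trans (*-mono-≤ a≤m a≤m) m²≤p ; x≤a = ≤-pred x< ; y≤a = ≤-pred y< ; nonzero = nz ; p∣Fxy = d ; minimal = min }

  module ShortVector {p : ℕ} (s : Split p) where

    open Split s
    open Shortest (shortest s) public

    1≤a : 1 ≤ a
    1≤a = [ (λ h → ≤-trans h x≤a) , (λ h → ≤-trans h y≤a) ]′ nonzero

    minimal-vector : ∀ u v → 1 ≤ u ⊎ 1 ≤ v → p ∣ F u v → u < a → v < a → ⊥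
    minimal-vector u v h d u<a v<a = minimal (pred a) (≤-reflexive 1+) (u , subst (u <_) (sym 1+) u<a , v , subst (v <_) (sym 1+) v<a , h , d)
      where
      1+ : suc (pred a) ≡ a
      1+ = suc-pred a {{>-nonZero 1≤a}}

    extremal : x ≡ a ⊎ y ≡ a
    extremal with x ≟ a | y ≟ a
    ... | yes e | _ = inj₁ e
    ... | no _ | yes e = inj₂ e
    ... | no hx | no hy = ⊥-elim (minimal-vector x y nonzero p∣Fxy (≤∧≢⇒< x≤a hx) (≤∧≢⇒< y≤a hy))

    small-zero : ∀ u v → + p ∣ᶻ form u v → ∣ u ∣ < a → ∣ v ∣ < a → ∣ u ∣ ≡ 0 × ∣ v ∣ ≡ 0
    small-zero u v h u< v< with 1 ≤? ∣ u ∣ | 1 ≤? ∣ v ∣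
    ... | yes q | _ = ⊥-elim (minimal-vector ∣ u ∣ ∣ v ∣ (inj₁ q) (subst (p ∣_) (sym (form-abs u v)) (∣n h)) u< v<)
    ... | no _ | yes q = ⊥-elim (minimal-vector ∣ u ∣ ∣ v ∣ (inj₂ q) (subst (p ∣_) (sym (form-abs u v)) (∣n h)) u< v<)
    ... | no q | no q′ = n<1⇒n≡0 (≰⇒> q) , n<1⇒n≡0 (≰⇒> q′)

    instance
      a≢0 : NonZero a
      a≢0 = >-nonZero 1≤a

    -- In the coordinates `(i , k)` the points form a coset of the lattice. Only differences enter
    -- the strip count, so the position of the box has no effect on the bound.
    module Box (r : ℕ) (r<p : r < p) (root : p ∣ F r 1) (s₀ t₀ X : ℕ) where

      open Root isPrime 2β<p r r<p root

      G : ℕ → ℕ → Set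
      G i k = p ∣ s₀ + i + r * (t₀ + k)

      G? : ∀ i k → Dec (G i k)
      G? i k = p ∣? s₀ + i + r * (t₀ + k)

      G-Δ : ∀ i k i′ k′ → G i k → G i′ k′ → + p ∣ᶻ (+ i ℤ.- + i′) ℤ.+ + r ℤ.* (+ k ℤ.- + k′)
      G-Δ i k i′ k′ g g′ = ∣ᶻ-by (trans (cong₂ ℤ._-_ (cast i k) (cast i′ k′)) (box-difference (+ s₀) (+ t₀) (+ r) (+ i) (+ k) (+ i′) (+ k′)))
          (ℤ∣.∣m∣n⇒∣m-n (n∣ᶻ {p} {+ (s₀ + i + r * (t₀ + k))} g) (n∣ᶻ {p} {+ (s₀ + i′ + r * (t₀ + k′))} g′))
        where
        cast : ∀ i k → + (s₀ + i + r * (t₀ + k)) ≡ (+ s₀ ℤ.+ + i) ℤ.+ + r ℤ.* (+ t₀ ℤ.+ + k)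
        cast i k = cong (λ t → (+ s₀ ℤ.+ + i) ℤ.+ t) (ℤₚ.pos-* r (t₀ + k))

      shrink : ∀ κ u v → ∣ κ ∣ ≤ a → + a ℤ.* v ≡ κ ℤ.* u → ∣ u ∣ < a → ∣ v ∣ < a
      shrink κ u v h e u<a = ≤-<-trans (*-cancelˡ-≤ a (begin
        a * ∣ v ∣ ≡⟨ sym (ℤₚ.abs-* (+ a) v) ⟩
        ∣ + a ℤ.* v ∣ ≡⟨ cong ∣_∣ e ⟩
        ∣ κ ℤ.* u ∣ ≡⟨ ℤₚ.abs-* κ u ⟩
        ∣ κ ∣ * ∣ u ∣ ≤⟨ *-monoˡ-≤ ∣ u ∣ h ⟩
        a * ∣ u ∣ ∎)) u<a
        where open ≤-Reasoning

      coincide : ∀ i k i′ k′ → G i k → G i′ k′ → ∣ + i ℤ.- + i′ ∣ < a → ∣ + k ℤ.- + k′ ∣ < a → i ≡ i′ × k ≡ k′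
      coincide i k i′ k′ g g′ hi hk = let (ei , ek) = small-zero (+ i ℤ.- + i′) (+ k ℤ.- + k′) (form-∣ (+ i ℤ.- + i′) (+ k ℤ.- + k′) (G-Δ i k i′ k′ g g′)) hi hk in
        Δ-injective i i′ ei , Δ-injective k k′ ek

      N : ℕ
      N = ∑ X (λ i → ∑ X (λ k → ι (G? i k)))

      -- Here `(a , κ)` is the short vector. Points of one strip with equal values of `a k - κ i`
      -- differ by less than `a` in both coordinates and coincide by minimality.
      along-u : ∀ κ → ∣ κ ∣ ≤ a → + p ∣ᶻ + a ℤ.+ + r ℤ.* κ → p * N ≤ X * X + p * (3 * (X / a) + 4)
      along-u κ hκ h = Strips.count p a 1≤a κ hκ G?
        (λ i k i′ k′ g g′ → ∣ᶻ-by (cross-u (+ a) κ (+ r) (+ i ℤ.- + i′) (+ k ℤ.- + k′)) (ℤ∣.∣m∣n⇒∣m-n (ℤ∣.∣n⇒∣m*n (+ k ℤ.- + k′) h) (ℤ∣.∣n⇒∣m*n κ (G-Δ i k i′ k′ g g′))))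
        (λ i k i′ k′ g g′ e hi → coincide i k i′ k′ g g′ hi (shrink κ (+ i ℤ.- + i′) (+ k ℤ.- + k′) hκ e hi)) a²≤p X

      along-v : ∀ κ → ∣ κ ∣ ≤ a → + p ∣ᶻ κ ℤ.+ + r ℤ.* + a → p * N ≤ X * X + p * (3 * (X / a) + 4)
      along-v κ hκ h = ≤-trans (≤-reflexive (cong (p *_) (∑-swap X X (λ i k → ι (G? i k))))) (Strips.count p a 1≤a κ hκ (λ k i → G? i k)
        (λ k i k′ i′ g g′ → ∣ᶻ-by (cross-v (+ a) κ (+ r) (+ i ℤ.- + i′) (+ k ℤ.- + k′)) (ℤ∣.∣m∣n⇒∣m-n (ℤ∣.∣n⇒∣m*n (+ a) (G-Δ i k i′ k′ g g′)) (ℤ∣.∣n⇒∣m*n (+ k ℤ.- + k′) h)))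
        (λ k i k′ i′ g g′ e hk → let (ei , ek) = coincide i k i′ k′ g g′ (shrink κ (+ k ℤ.- + k′) (+ i ℤ.- + i′) hκ e hk) hk in ek , ei) a²≤p X)

      -- One short vector serves both lattices: if `(x , y)` belongs to the other root, then
      -- `(x , - y)` belongs to `r`. The coordinate that equals `a` decides the direction of the
      -- strips.
      count : p * N ≤ X * X + p * (3 * (X / a) + 4)
      count = [ (λ e → [ u₊ e , u₋ e ]′ fac) , (λ e → [ v₊ e , v₋ e ]′ fac) ]′ extremal
        where
        fac : + p ∣ᶻ + x ℤ.+ + r ℤ.* + y ⊎ + p ∣ᶻ + x ℤ.+ + conj ℤ.* + y
        fac = factors (+ x) (+ y) (n∣ᶻ {p} {form (+ x) (+ y)} p∣Fxy)
        Bound : Set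
        Bound = p * N ≤ X * X + p * (3 * (X / a) + 4)
        u₊ : x ≡ a → + p ∣ᶻ + x ℤ.+ + r ℤ.* + y → Bound
        u₊ e h = along-u (+ y) y≤a (∣ᶻ-by (cong (λ t → + t ℤ.+ + r ℤ.* + y) e) h)
        u₋ : x ≡ a → + p ∣ᶻ + x ℤ.+ + conj ℤ.* + y → Bound
        u₋ e h = along-u (ℤ.- + y) (≤-trans (≤-reflexive (ℤₚ.∣-i∣≡∣i∣ (+ y))) y≤a) (∣ᶻ-by (trans (cong (λ t → + t ℤ.- + r ℤ.* + y) e) (minus-out (+ a) (+ r) (+ y))) (from-conj (+ x) (+ y) h))
        v₊ : y ≡ a → + p ∣ᶻ + x ℤ.+ + r ℤ.* + y → Bound
        v₊ e h = along-v (+ x) x≤a (∣ᶻ-by (cong (λ t → + x ℤ.+ + r ℤ.* + t) e) h)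
        v₋ : y ≡ a → + p ∣ᶻ + x ℤ.+ + conj ℤ.* + y → Bound
        v₋ e h = along-v (ℤ.- + x) (≤-trans (≤-reflexive (ℤₚ.∣-i∣≡∣i∣ (+ x))) x≤a) (∣ᶻ-by (trans (cong (λ t → ℤ.- (+ x ℤ.- + r ℤ.* + t)) e) (minus-both (+ x) (+ r) (+ a))) (ℤ∣.∣m⇒∣-m (from-conj (+ x) (+ y) h)))

    r₀ : ℕ
    r₀ = proj₁ hasRoot

    box-count : ∀ s₀ t₀ X → p * ∑ X (λ i → ∑ X (λ k → ι (p ∣? F (s₀ + i) (t₀ + k)))) ≤ 2 * (X * X + p * (3 * (X / a) + 4))
    box-count s₀ t₀ X = begin
      p * ∑ X (λ i → ∑ X (λ k → ι (p ∣? F (s₀ + i) (t₀ + k)))) ≤⟨ *-monoʳ-≤ p (∑-mono X (λ i _ → ∑-mono X (λ k _ → cover i k))) ⟩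
      p * ∑ X (λ i → ∑ X (λ k → ι (B₁.G? i k) + ι (B₂.G? i k))) ≡⟨ cong (p *_) (trans (∑-cong X (λ i _ → ∑-+ X (λ k → ι (B₁.G? i k)) (λ k → ι (B₂.G? i k)))) (∑-+ X _ _)) ⟩
      p * (B₁.N + B₂.N) ≡⟨ *-distribˡ-+ p B₁.N B₂.N ⟩
      p * B₁.N + p * B₂.N ≤⟨ +-mono-≤ B₁.count B₂.count ⟩
      C + C ≡⟨ cong (λ t → C + t) (sym (+-identityʳ C)) ⟩
      2 * C ∎
      where
      open ≤-Reasoning
      r₀<p : r₀ < p
      r₀<p = proj₁ (proj₂ hasRoot)
      root₀ : p ∣ F r₀ 1
      root₀ = proj₂ (proj₂ hasRoot)
      module R₀ = Root isPrime 2β<p r₀ r₀<p root₀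
      module B₁ = Box r₀ r₀<p root₀ s₀ t₀ X
      module B₂ = Box R₀.conj R₀.conj<p (conj-root isPrime 2β<p r₀ r₀<p root₀) s₀ t₀ X
      C : ℕ
      C = X * X + p * (3 * (X / a) + 4)
      cast : ∀ r u v → + (u + r * v) ≡ + u ℤ.+ + r ℤ.* + v
      cast r u v = cong (λ t → + u ℤ.+ t) (ℤₚ.pos-* r v)
      cover : ∀ i k → ι (p ∣? F (s₀ + i) (t₀ + k)) ≤ ι (B₁.G? i k) + ι (B₂.G? i k)
      cover i k = cases (p ∣? F (s₀ + i) (t₀ + k))
        where
        u v : ℕ
        u = s₀ + i
        v = t₀ + k
        cases : (d : Dec (p ∣ F u v)) → ι d ≤ ι (B₁.G? i k) + ι (B₂.G? i k)
        cases (no _) = z≤n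
        cases (yes h) = [ (λ q → ≤-trans (1≤ι (B₁.G? i k) (∣n {p} {+ (u + r₀ * v)} (∣ᶻ-by (sym (cast r₀ u v)) q))) (m≤m+n _ _))
                        , (λ q → ≤-trans (1≤ι (B₂.G? i k) (∣n {p} {+ (u + R₀.conj * v)} (∣ᶻ-by (sym (cast R₀.conj u v)) q))) (m≤n+m _ (ι (B₁.G? i k)))) ]′
                        (R₀.factors (+ u) (+ v) (n∣ᶻ {p} {form (+ u) (+ v)} h))

  -- The average over primes of `X` divided by the shortest length

  quot : ℕ → ℕ → ℕ
  quot X zero = 0
  quot X (suc a) = X / suc a

  quot-≡ : ∀ X a .{{_ : NonZero a}} → X / a ≡ quot X a
  quot-≡ X (suc a) = refl

  quot-* : ∀ X a → quot X a * a ≤ X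
  quot-* X zero = z≤n
  quot-* X (suc a) = m/n*n≤m X (suc a)

  quot-≤ : ∀ X a → quot X a ≤ X
  quot-≤ X zero = z≤n
  quot-≤ X (suc a) = ≤-trans (m≤m*n (X / suc a) (suc a)) (m/n*n≤m X (suc a))

  quot-≥ : ∀ X a H → 1 ≤ H → H * a ≤ X → a ≤ quot X H
  quot-≥ X a (suc H) _ h = ≤-trans (≤-reflexive (sym (m*n/n≡m a (suc H)))) (/-monoˡ-≤ (suc H) (≤-trans (≤-reflexive (*-comm a (suc H))) h))

  -- About `2 x` pairs have maximum `x`, and together they contribute about `2 X`.
  ∑-quot-max : ∀ A X → ∑ A (λ x → ∑ A (λ y → quot X (x ⊔ y))) ≤ 4 * (A * X)
  ∑-quot-max A X = begin
    ∑ A (λ x → ∑ A (λ y → quot X (x ⊔ y))) ≤⟨ ∑-mono A (λ x _ → ∑-mono A (λ y _ → larger x y)) ⟩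
    ∑ A (λ x → ∑ A (λ y → ι (y ≤? x) * quot X x + ι (x ≤? y) * quot X y)) ≡⟨ trans (∑-cong A (λ x _ → ∑-+ A (λ y → ι (y ≤? x) * quot X x) (λ y → ι (x ≤? y) * quot X y))) (∑-+ A _ _) ⟩
    ∑ A (λ x → ∑ A (λ y → ι (y ≤? x) * quot X x)) + ∑ A (λ x → ∑ A (λ y → ι (x ≤? y) * quot X y)) ≡⟨ cong (λ t → ∑ A (λ x → ∑ A (λ y → ι (y ≤? x) * quot X x)) + t) (∑-swap A A (λ x y → ι (x ≤? y) * quot X y)) ⟩
    half + half ≤⟨ +-mono-≤ half≤ half≤ ⟩
    A * (2 * X) + A * (2 * X) ≡⟨ r A X ⟩
    4 * (A * X) ∎
    where
    open ≤-Reasoning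
    r : ∀ A X → A * (2 * X) + A * (2 * X) ≡ 4 * (A * X)
    r = solve-∀
    half : ℕ
    half = ∑ A (λ x → ∑ A (λ y → ι (y ≤? x) * quot X x))
    larger : ∀ x y → quot X (x ⊔ y) ≤ ι (y ≤? x) * quot X x + ι (x ≤? y) * quot X y
    larger x y = [ (λ y≤x → ≤-trans (≤-reflexive (trans (cong (quot X) (m≥n⇒m⊔n≡m y≤x)) (sym (trans (cong (_* quot X x) (ι-yes (y ≤? x) y≤x)) (*-identityˡ _))))) (m≤m+n _ _))
                 , (λ x≤y → ≤-trans (≤-reflexive (trans (cong (quot X) (m≤n⇒m⊔n≡n x≤y)) (sym (trans (cong (_* quot X y) (ι-yes (x ≤? y) x≤y)) (*-identityˡ _))))) (m≤n+m _ (ι (y ≤? x) * quot X x))) ]′ (≤-total y x)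
    row : ∀ x → ∑ A (λ y → ι (y ≤? x) * quot X x) ≤ 2 * X
    row zero = ≤-trans (≤-reflexive (trans (∑-cong A (λ y _ → *-zeroʳ (ι (y ≤? 0)))) (∑-zero A))) z≤n
    row x@(suc _) = begin
      ∑ A (λ y → ι (y ≤? x) * quot X x) ≡⟨ ∑-*ʳ A (λ y → ι (y ≤? x)) (quot X x) ⟩
      ∑ A (λ y → ι (y ≤? x)) * quot X x ≤⟨ *-monoˡ-≤ (quot X x) (∑-ι≤ x A) ⟩
      suc x * quot X x ≡⟨ cong (λ t → quot X x + t) (*-comm x (quot X x)) ⟩
      quot X x + quot X x * x ≤⟨ +-mono-≤ (quot-≤ X x) (≤-trans (quot-* X x) (≤-reflexive (sym (+-identityʳ X)))) ⟩
      2 * X ∎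
    half≤ : half ≤ A * (2 * X)
    half≤ = ∑-≤const A (2 * X) (λ x _ → row x)

  len : ∀ {p} → Dec (Split p) → ℕ
  len (yes s) = Shortest.a (shortest s)
  len (no _) = 0

  module ShortSum (X H Z Λ : ℕ) (1≤H : 1 ≤ H) (Λ≥ : L ((1 + β) * (X * X)) ≤ Λ) where

    A : ℕ
    A = suc (quot X H)

    g : ℕ → ℕ → ℕ → ℕ
    g x y p = ι (prime? p) * (ι (p ∣? F x y) * L p)

    -- Primes with `X / a ≤ H` are estimated trivially. For the others the shortest vector has
    -- coordinates below `A`, and each nonzero `(x , y)` there is a zero modulo primes of total
    -- weight at most `L (F x y)`.
    short-sum : ∑ Z (λ p → σ p * (L p * quot X (len (split? p)))) ≤ H * ∑ Z (λ p → σ p * L p) + 4 * (A * X) * Λ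
    short-sum = begin
      ∑ Z (λ p → σ p * (L p * quot X (len (split? p)))) ≤⟨ ∑-mono Z (λ p _ → each p (split? p)) ⟩
      ∑ Z (λ p → H * (σ p * L p) + ∑ A (λ x → ∑ A (λ y → quot X (x ⊔ y) * g x y p))) ≡⟨ trans (∑-+ Z _ _) (cong₂ _+_ (∑-* Z H _) swap) ⟩
      H * ∑ Z (λ p → σ p * L p) + ∑ A (λ x → ∑ A (λ y → quot X (x ⊔ y) * ∑ Z (g x y))) ≤⟨ +-monoʳ-≤ (H * ∑ Z (λ p → σ p * L p)) (∑-mono A (λ x x<A → ∑-mono A (λ y y<A → cell x y x<A y<A))) ⟩
      H * ∑ Z (λ p → σ p * L p) + ∑ A (λ x → ∑ A (λ y → quot X (x ⊔ y) * Λ)) ≡⟨ cong (λ t → H * ∑ Z (λ p → σ p * L p) + t) (trans (∑-cong A (λ x _ → ∑-*ʳ A (λ y → quot X (x ⊔ y)) Λ)) (∑-*ʳ A _ Λ)) ⟩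
      H * ∑ Z (λ p → σ p * L p) + ∑ A (λ x → ∑ A (λ y → quot X (x ⊔ y))) * Λ ≤⟨ +-monoʳ-≤ (H * ∑ Z (λ p → σ p * L p)) (*-monoˡ-≤ Λ (∑-quot-max A X)) ⟩
      H * ∑ Z (λ p → σ p * L p) + 4 * (A * X) * Λ ∎
      where
      open ≤-Reasoning
      swap : ∑ Z (λ p → ∑ A (λ x → ∑ A (λ y → quot X (x ⊔ y) * g x y p))) ≡ ∑ A (λ x → ∑ A (λ y → quot X (x ⊔ y) * ∑ Z (g x y)))
      swap = trans (∑-swap Z A (λ p x → ∑ A (λ y → quot X (x ⊔ y) * g x y p)))
        (∑-cong A (λ x _ → trans (∑-swap Z A (λ p y → quot X (x ⊔ y) * g x y p)) (∑-cong A (λ y _ → ∑-* Z (quot X (x ⊔ y)) (g x y)))))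
      g-total : ∀ x y → 1 ≤ x ⊎ 1 ≤ y → x < A → y < A → ∑ Z (g x y) ≤ Λ
      g-total x y h x< y< = begin
        ∑ Z (g x y) ≤⟨ ∑-L≤ Z (F x y) (λ p → ι (p ∣? F x y)) (F-pos x y h) (λ p _ → divides-power p (p ∣? F x y)) ⟩
        L (F x y) ≤⟨ L-mono (≤-trans (F-upper x y) (+-mono-≤ (*-mono-≤ x≤X x≤X) (*-monoʳ-≤ β (*-mono-≤ y≤X y≤X)))) ⟩
        L ((1 + β) * (X * X)) ≤⟨ Λ≥ ⟩
        Λ ∎
        where
        x≤X : x ≤ X
        x≤X = ≤-trans (≤-pred x<) (quot-≤ X H)
        y≤X : y ≤ X
        y≤X = ≤-trans (≤-pred y<) (quot-≤ X H)
        divides-power : ∀ p (d : Dec (p ∣ F x y)) → p ^ ι d ∣ F x y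
        divides-power p (yes h) = subst (_∣ F x y) (sym (*-identityʳ p)) h
        divides-power p (no _) = 1∣ _
      cell : ∀ x y → x < A → y < A → quot X (x ⊔ y) * ∑ Z (g x y) ≤ quot X (x ⊔ y) * Λ
      -- The form vanishes at the origin and bounds no prime there; the convention `quot X 0 = 0`
      -- removes this term.
      cell zero zero _ _ = z≤n
      cell (suc x) y x< y< = *-monoʳ-≤ (quot X (suc x ⊔ y)) (g-total (suc x) y (inj₁ (s≤s z≤n)) x< y<)
      cell zero (suc y) x< y< = *-monoʳ-≤ (quot X (suc y)) (g-total zero (suc y) (inj₂ (s≤s z≤n)) x< y<)
      each : ∀ p (d : Dec (Split p)) → ι d * (L p * quot X (len d)) ≤ H * (ι d * L p) + ∑ A (λ x → ∑ A (λ y → quot X (x ⊔ y) * g x y p))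
      each p (no _) = z≤n
      each p (yes s) = cases (quot X a ≤? H)
        where
        open ShortVector s
        cases : Dec (quot X a ≤ H) → 1 * (L p * quot X a) ≤ H * (1 * L p) + ∑ A (λ x → ∑ A (λ y → quot X (x ⊔ y) * g x y p))
        cases (yes q) = ≤-trans (≤-trans (*-monoʳ-≤ 1 (*-monoʳ-≤ (L p) q)) (≤-reflexive (r (L p) H))) (m≤m+n _ _)
          where
          r : ∀ l H → 1 * (l * H) ≡ H * (1 * l)
          r = solve-∀
        cases (no q) = begin
          1 * (L p * quot X a) ≡⟨ r (L p) (quot X a) ⟩
          quot X a * (1 * (1 * L p)) ≡⟨ cong₂ _*_ (cong (quot X) (sym max)) (sym (cong₂ (λ m k → m * (k * L p)) (ι-yes (prime? p) (Split.isPrime s)) (ι-yes (p ∣? F x y) p∣Fxy))) ⟩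
          quot X (x ⊔ y) * g x y p ≤⟨ ∑-term A (λ y → quot X (x ⊔ y) * g x y p) (s≤s (≤-trans y≤a a≤)) ⟩
          ∑ A (λ y → quot X (x ⊔ y) * g x y p) ≤⟨ ∑-term A (λ x → ∑ A (λ y → quot X (x ⊔ y) * g x y p)) (s≤s (≤-trans x≤a a≤)) ⟩
          ∑ A (λ x → ∑ A (λ y → quot X (x ⊔ y) * g x y p)) ≤⟨ m≤n+m _ (H * (1 * L p)) ⟩
          H * (1 * L p) + ∑ A (λ x → ∑ A (λ y → quot X (x ⊔ y) * g x y p)) ∎
          where
          r : ∀ l k → 1 * (l * k) ≡ k * (1 * (1 * l))
          r = solve-∀
          max : x ⊔ y ≡ a
          max = [ (λ e → trans (m≥n⇒m⊔n≡m (≤-trans y≤a (≤-reflexive (sym e)))) e) , (λ e → trans (m≤n⇒m⊔n≡n (≤-trans x≤a (≤-reflexive (sym e)))) e) ]′ extremal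
          a≤ : a ≤ quot X H
          a≤ = quot-≥ X a H 1≤H (≤-trans (*-monoˡ-≤ a (<⇒≤ (≰⇒> q))) (quot-* X a))

  -- Mertens lower bound from values of the form on a shifted box

  module Grid (X : ℕ) (1≤X : 1 ≤ X) (E : ℕ) where

    open Rare E (β + 3) (≤-trans (s≤s z≤n) (m≤n+m 3 β))
    open Radical R (j + j) split?

    -- For `u ≥ s₀` the square `u²` dominates `β v²`, so all values lie between `X²` and `C X²` even
    -- for negative `b`. `Z` exceeds every prime factor of a value, and `Y * Y` every value.
    n s₀ C Z Y : ℕ
    n = X * X
    s₀ = suc β * X
    C = (β + 2) * (β + 2) + β
    Z = suc (C * n)
    Y = (β + 3) * X

    f : ℕ → ℕ → ℕ
    f i k = F (s₀ + i) (suc k)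

    -- A common prime factor of both coordinates above `R` is a further obstruction, since it
    -- divides the value without having to be split.
    exc : ℕ → ℕ → ℕ
    exc i k = bad Y (s₀ + i) (suc k) + ∑ Y (λ p → ι (common? (s₀ + i) (suc k) p))

    Λ : ℕ
    Λ = L Z

    K : ℕ
    K = suc R * cost

    module _ (i k : ℕ) (i<X : i < X) (k<X : k < X) where

      u≤ : s₀ + i ≤ (β + 2) * X
      u≤ = ≤-trans (+-monoʳ-≤ s₀ (<⇒≤ i<X)) (≤-reflexive (grid₁ β X))

      f-upper : f i k ≤ C * n
      f-upper = ≤-trans (F-upper (s₀ + i) (suc k)) (≤-trans (+-mono-≤ (*-mono-≤ u≤ u≤) (*-monoʳ-≤ β (*-mono-≤ k<X k<X))) (≤-reflexive (grid₂ β X)))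

      f-lower : n ≤ f i k
      f-lower = +-cancelʳ-≤ (β * n) n (f i k) (begin
        n + β * n ≤⟨ m≤m+n (n + β * n) ((β + β * β) * n) ⟩
        n + β * n + (β + β * β) * n ≡⟨ grid₃ β X ⟩
        s₀ * s₀ ≤⟨ *-mono-≤ (m≤m+n s₀ i) (m≤m+n s₀ i) ⟩
        (s₀ + i) * (s₀ + i) ≤⟨ F-lower (s₀ + i) (suc k) ⟩
        f i k + β * (suc k * suc k) ≤⟨ +-monoʳ-≤ (f i k) (*-monoʳ-≤ β (*-mono-≤ k<X k<X)) ⟩
        f i k + β * n ∎)
        where open ≤-Reasoning

      1≤n : 1 ≤ n
      1≤n = *-mono-≤ 1≤X 1≤X

      f<Y² : f i k < Y * Y
      f<Y² = ≤-<-trans f-upper (≤-trans (+-monoˡ-≤ (C * n) (≤-trans 1≤n (m≤m+n n ((4 + β) * n)))) (≤-reflexive (grid₄ β X)))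

      good : exc i k ≡ 0 → T * L (f i k) ≤ (T + 1) * ∑ Z (weight (f i k)) + K
      good e = radical Z (f i k) 1≤f (λ p _ p∣f → s≤s (≤-trans (∣⇒≤ {{>-nonZero 1≤f}} p∣f) f-upper)) sq (λ p pp p≤R → bad-zero-pw Y u v bad0 p pp p≤R)
          (λ p pp R<p p∣f → split-from pp (≤-<-trans 2β≤R R<p) u v p∣f (p∤v p pp R<p p∣f))
        where
        u v : ℕ
        u = s₀ + i
        v = suc k
        1≤f : 1 ≤ f i k
        1≤f = ≤-trans 1≤n f-lower
        bad0 : bad Y u v ≡ 0
        bad0 = m+n≡0⇒m≡0 (bad Y u v) e
        p∤v : ∀ p → Prime p → R < p → p ∣ F u v → ¬ p ∣ v
        p∤v p pp R<p p∣f p∣v = <-irrefl (sym (m+n≡0⇒n≡0 (bad Y u v) e)) (≤-trans (1≤ι (common? u v p) ((pp , R<p) , p∣u , p∣v)) (∑-term Y (λ p → ι (common? u v p)) p<Y))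
          where
          p∣u : p ∣ u
          p∣u = ∣n {p} {+ u} (square-∣ pp (+ u) (ℤ∣.∣m+n∣n⇒∣m (n∣ᶻ {p} {form (+ u) (+ v)} p∣f) (ℤ∣.∣n⇒∣m*n b (ℤ∣.∣m⇒∣m*n (+ v) (n∣ᶻ {p} {+ v} p∣v)))))
          p<Y : p < Y
          p<Y = ≤-<-trans (≤-trans (∣⇒≤ p∣v) k<X) (≤-trans (≤-trans (≤-reflexive (+-comm 1 X)) (+-monoʳ-≤ X 1≤X)) (≤-trans (m≤m+n (X + X) ((β + 1) * X)) (≤-reflexive (grid₅ β X))))
        sq : ∀ p → Prime p → R < p → ¬ p * p ∣ f i k
        sq p pp R<p h = bad-zero-sq Y u v bad0 1≤f f<Y² p pp R<p (p∤v p pp R<p (∣-trans (m∣m*n p) h)) h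

      Lf≤ : L (f i k) ≤ Λ
      Lf≤ = L-mono (≤-trans f-upper (n≤1+n (C * n)))

      -- At an exceptional point the last summand pays for the trivial bound by `T * Λ`.
      pointwise : T * (2 * L X) ≤ (T + 1) * ∑ Z (weight (f i k)) + K + T * Λ * exc i k
      pointwise = ≤-trans (*-monoʳ-≤ T lower) (cases (exc i k ≟ 0))
        where
        lower : 2 * L X ≤ L (f i k)
        lower = ≤-trans (≤-reflexive (cong (λ t → L X + t) (+-identityʳ (L X)))) (≤-trans (L-sup 1≤X 1≤X) (L-mono f-lower))
        cases : Dec (exc i k ≡ 0) → T * L (f i k) ≤ (T + 1) * ∑ Z (weight (f i k)) + K + T * Λ * exc i k
        cases (yes e) = ≤-trans (good e) (m≤m+n _ (T * Λ * exc i k))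
        cases (no e) = ≤-trans (≤-trans (*-monoʳ-≤ T Lf≤) (≤-trans (≤-reflexive (sym (*-identityʳ (T * Λ)))) (*-monoʳ-≤ (T * Λ) (n≢0⇒n>0 e)))) (m≤n+m _ ((T + 1) * ∑ Z (weight (f i k)) + K))

    SW EX : ℕ
    SW = ∑ X (λ i → ∑ X (λ k → ∑ Z (weight (f i k))))
    EX = ∑ X (λ i → ∑ X (λ k → exc i k))

    summed : n * (T * (2 * L X)) ≤ (T + 1) * SW + n * K + T * Λ * EX
    summed = begin
      n * (T * (2 * L X)) ≡⟨ trans (*-assoc X X _) (sym (trans (∑-cong X (λ _ _ → ∑-const X (T * (2 * L X)))) (∑-const X _))) ⟩
      ∑ X (λ i → ∑ X (λ k → T * (2 * L X))) ≤⟨ ∑-mono X (λ i i<X → ∑-mono X (λ k k<X → pointwise i k i<X k<X)) ⟩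
      ∑ X (λ i → ∑ X (λ k → (T + 1) * w i k + K + T * Λ * exc i k)) ≡⟨ split₂ (λ i k → (T + 1) * w i k + K) (λ i k → T * Λ * exc i k) ⟩
      ∑ X (λ i → ∑ X (λ k → (T + 1) * w i k + K)) + ∑ X (λ i → ∑ X (λ k → T * Λ * exc i k)) ≡⟨ cong₂ _+_ (split₂ (λ i k → (T + 1) * w i k) (λ i k → K)) (pull (T * Λ) exc) ⟩
      ∑ X (λ i → ∑ X (λ k → (T + 1) * w i k)) + ∑ X (λ i → ∑ X (λ k → K)) + T * Λ * EX ≡⟨ cong (λ t → t + T * Λ * EX) (cong₂ _+_ (pull (T + 1) w) (trans (trans (∑-cong X (λ _ _ → ∑-const X K)) (∑-const X _)) (sym (*-assoc X X K)))) ⟩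
      (T + 1) * SW + n * K + T * Λ * EX ∎
      where
      open ≤-Reasoning
      w : ℕ → ℕ → ℕ
      w i k = ∑ Z (weight (f i k))
      split₂ : ∀ (a c : ℕ → ℕ → ℕ) → ∑ X (λ i → ∑ X (λ k → a i k + c i k)) ≡ ∑ X (λ i → ∑ X (a i)) + ∑ X (λ i → ∑ X (c i))
      split₂ a c = trans (∑-cong X (λ i _ → ∑-+ X (a i) (c i))) (∑-+ X _ _)
      pull : ∀ c (a : ℕ → ℕ → ℕ) → ∑ X (λ i → ∑ X (λ k → c * a i k)) ≡ c * ∑ X (λ i → ∑ X (a i))
      pull c a = trans (∑-cong X (λ i _ → ∑-* X c (a i))) (∑-* X c _)

    exc-bound : (∀ s v → E * ∑ X (λ i → bad Y (s + i) v) ≤ X) → E * EX ≤ 2 * n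
    exc-bound h = begin
      E * EX ≡⟨ cong (E *_) (trans (∑-cong X (λ i _ → ∑-+ X (λ k → bad Y (s₀ + i) (suc k)) _)) (∑-+ X _ _)) ⟩
      E * (B + Cm) ≡⟨ *-distribˡ-+ E B Cm ⟩
      E * B + E * Cm ≤⟨ +-mono-≤ b₁ b₂ ⟩
      n + n ≡⟨ cong (λ t → n + t) (sym (+-identityʳ n)) ⟩
      2 * n ∎
      where
      open ≤-Reasoning
      B Cm : ℕ
      B = ∑ X (λ i → ∑ X (λ k → bad Y (s₀ + i) (suc k)))
      Cm = ∑ X (λ i → ∑ X (λ k → ∑ Y (λ p → ι (common? (s₀ + i) (suc k) p))))
      b₁ : E * B ≤ n
      b₁ = ≤-trans (≤-reflexive (trans (cong (E *_) (∑-swap X X (λ i k → bad Y (s₀ + i) (suc k)))) (sym (∑-* X E _)))) (∑-≤const X X (λ k _ → h s₀ (suc k)))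
      b₂ : E * Cm ≤ n
      b₂ = *-cancelˡ-≤ 2 (begin
        2 * (E * Cm) ≤⟨ lin {0} {6 * (E * Cm)} z≤n (r E Cm) ⟩
        8 * E * Cm ≤⟨ *-monoˡ-≤ Cm (m≤m+n (8 * E) (2 * β)) ⟩
        R * Cm ≤⟨ common-bound s₀ X Y ⟩
        2 * n ∎)
        where
        r : ∀ E c → 2 * (E * c) + 6 * (E * c) ≡ 8 * E * c + 0
        r = solve-∀

    Err : ℕ
    Err = ∑ Z (λ p → σ p * (L p * (3 * quot X (len (split? p)) + 4)))

    -- This is `box-count` summed over the split primes; `Err` collects the boundary terms `X / a`
    -- of the strips.
    counted : ∀ Q q → CommonMultiple Z Q q → Q * SW ≤ n * S q Z + 2 * (Q * Err)
    counted Q q cm = begin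
      Q * SW ≡⟨ cong (Q *_) swap ⟩
      Q * ∑ Z (λ p → σ p * (L p * cnt p)) ≡⟨ sym (∑-* Z Q _) ⟩
      ∑ Z (λ p → Q * (σ p * (L p * cnt p))) ≤⟨ ∑-mono Z (λ p p<Z → each p p<Z (split? p)) ⟩
      ∑ Z (λ p → n * (σ p * (2 * (L p * q p))) + 2 * Q * (σ p * (L p * (3 * quot X (len (split? p)) + 4)))) ≡⟨ trans (∑-+ Z _ _) (cong₂ _+_ (∑-* Z n _) (∑-* Z (2 * Q) _)) ⟩
      n * S q Z + 2 * Q * Err ≡⟨ cong (λ t → n * S q Z + t) (*-assoc 2 Q Err) ⟩
      n * S q Z + 2 * (Q * Err) ∎
      where
      open ≤-Reasoning
      cnt : ℕ → ℕ
      cnt p = ∑ X (λ i → ∑ X (λ k → ι (p ∣? f i k)))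
      swap : SW ≡ ∑ Z (λ p → σ p * (L p * cnt p))
      swap = trans (∑-cong X (λ i _ → ∑-swap X Z (λ k p → weight (f i k) p))) (trans (∑-swap X Z (λ i p → ∑ X (λ k → weight (f i k) p))) (∑-cong Z (λ p _ → pull p)))
        where
        r : ∀ a c l → a * (c * l) ≡ a * l * c
        r = solve-∀
        pull : ∀ p → ∑ X (λ i → ∑ X (λ k → weight (f i k) p)) ≡ σ p * (L p * cnt p)
        pull p = trans (∑-cong X (λ i _ → trans (∑-cong X (λ k _ → r (σ p) (ι (p ∣? f i k)) (L p))) (∑-* X (σ p * L p) _))) (trans (∑-* X (σ p * L p) _) (*-assoc (σ p) (L p) (cnt p)))
      each : ∀ p → p < Z → (d : Dec (Split p)) → Q * (ι d * (L p * cnt p)) ≤ n * (ι d * (2 * (L p * q p))) + 2 * Q * (ι d * (L p * (3 * quot X (len d) + 4)))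
      each p p<Z (no _) = ≤-trans (≤-reflexive (*-zeroʳ Q)) z≤n
      each p p<Z (yes s) = begin
        Q * (1 * (L p * cnt p)) ≡⟨ cong (λ t → t * (1 * (L p * cnt p))) (sym qp) ⟩
        q p * p * (1 * (L p * cnt p)) ≡⟨ grid₆ (q p) p (L p) (cnt p) ⟩
        q p * L p * (p * cnt p) ≤⟨ *-monoʳ-≤ (q p * L p) (ShortVector.box-count s s₀ 1 X) ⟩
        q p * L p * (2 * (n + p * (3 * (X / a) + 4))) ≡⟨ cong (λ t → q p * L p * (2 * (n + p * (3 * t + 4)))) (quot-≡ X a) ⟩
        q p * L p * (2 * (n + p * (3 * quot X a + 4))) ≡⟨ grid₇ (q p) (L p) n p (3 * quot X a + 4) ⟩
        n * (1 * (2 * (L p * q p))) + 2 * (q p * p) * (1 * (L p * (3 * quot X a + 4))) ≡⟨ cong (λ t → n * (1 * (2 * (L p * q p))) + 2 * t * (1 * (L p * (3 * quot X a + 4)))) qp ⟩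
        n * (1 * (2 * (L p * q p))) + 2 * Q * (1 * (L p * (3 * quot X a + 4))) ∎
        where
        open ShortVector s using (a; a≢0)
        qp : q p * p ≡ Q
        qp = cm p (prime≥1 (Split.isPrime s)) p<Z

    -- Both parts are small against `n * Λ`: the first because primes have density zero, the second
    -- once `H` is large.
    err-bound : ∀ H → 1 ≤ H → Err ≤ (3 * H + 4) * (π Z * Λ) + 12 * (suc (quot X H) * X) * Λ
    err-bound H 1≤H = begin
      Err ≡⟨ trans (∑-cong Z (λ p _ → grid₈ (σ p) (L p) (quot X (len (split? p))))) (trans (∑-+ Z _ _) (cong₂ _+_ (∑-* Z 3 _) (∑-* Z 4 _))) ⟩
      3 * ∑ Z (λ p → σ p * (L p * quot X (len (split? p)))) + 4 * W ≤⟨ +-monoˡ-≤ (4 * W) (*-monoʳ-≤ 3 (ShortSum.short-sum X H Z Λ 1≤H Λ≥)) ⟩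
      3 * (H * W + 4 * (suc (quot X H) * X) * Λ) + 4 * W ≡⟨ grid₉ H W (suc (quot X H) * X) Λ ⟩
      (3 * H + 4) * W + 12 * (suc (quot X H) * X) * Λ ≤⟨ +-monoˡ-≤ _ (*-monoʳ-≤ (3 * H + 4) (∑-σL≤ Z)) ⟩
      (3 * H + 4) * (π Z * Λ) + 12 * (suc (quot X H) * X) * Λ ∎
      where
      open ≤-Reasoning
      W : ℕ
      W = ∑ Z (λ p → σ p * L p)
      Λ≥ : L ((1 + β) * n) ≤ Λ
      Λ≥ = L-mono (≤-trans (≤-trans (m≤m+n ((1 + β) * n) ((3 + 4 * β + β * β) * n)) (≤-reflexive (grid₁₀ β X))) (n≤1+n (C * n)))

  module LowerMertens where

    -- `E` is chosen so that `T * EX ≤ n`, and `H` so that the part of the error due to very short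
    -- vectors stays below `n * Λ` after multiplication by `4 * T`.
    E H C : ℕ
    E = 2 * T
    H = 96 * T
    C = (β + 2) * (β + 2) + β

    1≤H : 1 ≤ H
    1≤H = *-mono-≤ {1} {96} (s≤s z≤n) 1≤T

    1≤C : 1 ≤ C
    1≤C = ≤-trans (*-mono-≤ {1} {β + 2} {1} {β + 2} (≤-trans (s≤s z≤n) (m≤n+m 2 β)) (≤-trans (s≤s z≤n) (m≤n+m 2 β))) (m≤m+n _ β)

    K₂ : ℕ
    K₂ = L (2 * C) + 2

    size : ℕ → ℕ
    size X = suc (C * (X * X))

    size≥ : ∀ X → X ≤ size X
    size≥ zero = z≤n
    size≥ X@(suc _) = ≤-trans (≤-trans (m≤m*n X X) (≤-trans (≤-reflexive (sym (*-identityˡ (X * X)))) (*-monoˡ-≤ (X * X) 1≤C))) (n≤1+n _)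

    module _ (X : ℕ) (1≤X : 1 ≤ X) where

      open Grid X 1≤X E hiding (C; 1≤n)

      -- Six units `Q * Λ` are lost: one for the constants, one for exceptional points, two for
      -- `T + 1` in place of `T`, two for the errors of the lattice point counts.
      core : H ≤ X →
        (∀ s v → E * ∑ X (λ i → Rare.bad E (β + 3) (≤-trans (s≤s z≤n) (m≤n+m 3 β)) ((β + 3) * X) (s + i) v) ≤ X) →
        4 * T * (3 * H + 4) * (2 * C) * π (size X) ≤ size X →
        K + T * K₂ ≤ L X →
        (∀ Q q → CommonMultiple (size X) Q q → T * S q (size X) ≤ (T + 1) * (Q * L (size X))) →
        ∀ Q q → CommonMultiple (size X) Q q → T * (Q * L (size X)) ≤ T * S q (size X) + 6 * (Q * L (size X))
      core H≤X rare hπ hK upper Q q cm = *-cancelˡ-≤ n {{m*n≢0 X X {{>-nonZero 1≤X}} {{>-nonZero 1≤X}}}} (begin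
        n * (T * (Q * Λ)) ≤⟨ *-monoʳ-≤ n (*-monoʳ-≤ T (*-monoʳ-≤ Q Λ≤)) ⟩
        n * (T * (Q * (2 * L X + K₂))) ≡⟨ core₁ n T Q (L X) K₂ ⟩
        Q * (n * (T * (2 * L X))) + n * Q * (T * K₂) ≤⟨ +-monoˡ-≤ (n * Q * (T * K₂)) (*-monoʳ-≤ Q summed) ⟩
        Q * ((T + 1) * SW + n * K + T * Λ * EX) + n * Q * (T * K₂) ≡⟨ core₂ Q T SW n K Λ EX K₂ ⟩
        (T + 1) * (Q * SW) + n * Q * (K + T * K₂) + Q * Λ * (T * EX) ≤⟨ +-mono-≤ (+-mono-≤ (*-monoʳ-≤ (T + 1) (counted Q q cm)) (*-monoʳ-≤ (n * Q) (≤-trans hK (L-mono (size≥ X))))) (*-monoʳ-≤ (Q * Λ) TEX≤) ⟩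
        (T + 1) * (n * Sz + 2 * (Q * Err)) + n * Q * Λ + Q * Λ * n ≡⟨ core₃ T n Sz Q Err Λ ⟩
        n * (T * Sz) + n * Sz + Q * (2 * (T + 1) * Err) + 2 * (n * (Q * Λ)) ≤⟨ +-monoˡ-≤ (2 * (n * (Q * Λ))) (+-mono-≤ (+-monoʳ-≤ (n * (T * Sz)) (*-monoʳ-≤ n S≤)) (*-monoʳ-≤ Q Err≤)) ⟩
        n * (T * Sz) + n * (2 * (Q * Λ)) + Q * (2 * (n * Λ)) + 2 * (n * (Q * Λ)) ≡⟨ core₄ n T Sz Q Λ ⟩
        n * (T * Sz + 6 * (Q * Λ)) ∎)
        where
        open ≤-Reasoning
        Sz A : ℕ
        Sz = S q Z
        A = suc (quot X H)
        1≤n : 1 ≤ n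
        1≤n = *-mono-≤ 1≤X 1≤X
        Z≤ : Z ≤ 2 * C * n
        Z≤ = ≤-trans (+-monoˡ-≤ (C * n) (*-mono-≤ 1≤C 1≤n)) (≤-reflexive (core₅ C n))
        Λ≤ : Λ ≤ 2 * L X + K₂
        Λ≤ = ≤-trans (L-mono Z≤) (≤-trans (L-sub (2 * C) n) (≤-trans (+-monoˡ-≤ 1 (+-monoʳ-≤ (L (2 * C)) (L-sub X X))) (≤-reflexive (core₆ (L (2 * C)) (L X)))))
        TEX≤ : T * EX ≤ n
        TEX≤ = *-cancelˡ-≤ 2 (≤-trans (≤-reflexive (sym (*-assoc 2 T EX))) (exc-bound rare))
        S≤ : Sz ≤ 2 * (Q * Λ)
        S≤ = *-cancelˡ-≤ T {{>-nonZero 1≤T}} (≤-trans (upper Q q cm) (≤-trans (*-monoˡ-≤ (Q * Λ) (+-monoʳ-≤ T 1≤T)) (≤-reflexive (core₇ T (Q * Λ)))))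
        πn : 4 * T * (3 * H + 4) * π Z ≤ n
        πn = *-cancelˡ-≤ (2 * C) {{m*n≢0 2 C {{_}} {{>-nonZero 1≤C}}}} (≤-trans (≤-reflexive (core₈ (2 * C) (4 * T * (3 * H + 4)) (π Z))) (≤-trans hπ Z≤))
        AX : 48 * T * (A * X) ≤ n
        AX = *-cancelˡ-≤ 2 (begin
          2 * (48 * T * (A * X)) ≡⟨ core₉ T (quot X H) X ⟩
          (H + quot X H * H) * X ≤⟨ *-monoˡ-≤ X (+-mono-≤ H≤X (quot-* X H)) ⟩
          (X + X) * X ≡⟨ core₁₀ X ⟩
          2 * n ∎)
        Err≤ : 2 * (T + 1) * Err ≤ 2 * (n * Λ)
        Err≤ = begin
          2 * (T + 1) * Err ≤⟨ *-monoˡ-≤ Err (≤-trans (*-monoʳ-≤ 2 (+-monoʳ-≤ T 1≤T)) (≤-reflexive (core₁₁ T))) ⟩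
          4 * T * Err ≤⟨ *-monoʳ-≤ (4 * T) (err-bound H 1≤H) ⟩
          4 * T * ((3 * H + 4) * (π Z * Λ) + 12 * (A * X) * Λ) ≡⟨ core₁₂ T (3 * H + 4) (π Z) Λ (A * X) ⟩
          4 * T * (3 * H + 4) * π Z * Λ + 48 * T * (A * X) * Λ ≤⟨ +-mono-≤ (*-monoˡ-≤ Λ πn) (*-monoˡ-≤ Λ AX) ⟩
          n * Λ + n * Λ ≡⟨ cong (λ t → n * Λ + t) (sym (+-identityʳ (n * Λ))) ⟩
          2 * (n * Λ) ∎

    LowerAt : ℕ → Set
    LowerAt X = ∀ Q q → CommonMultiple (size X) Q q → T * (Q * L (size X)) ≤ T * S q (size X) + 6 * (Q * L (size X))

    lower-sizes : Ev (λ X → 1 ≤ X × LowerAt X)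
    lower-sizes = ev-map (λ X (1≤X , H≤X , h₁ , h₂ , h₃ , h₄) → 1≤X , core X 1≤X H≤X h₁ h₂ h₃ h₄)
      (ev-≥ 1 & ev-≥ H & Rare.rare E (β + 3) (≤-trans (s≤s z≤n) (m≤n+m 3 β)) & ev-∘ size∞ (π-sublinear (4 * T * (3 * H + 4) * (2 * C))) & L-unbounded (K + T * K₂) & ev-∘ size∞ mertens-upper)
      where
      -- `K` is the same for every side of the box, so the side 1 can serve to name it.
      open Grid 1 (s≤s z≤n) E using (K)
      size∞ : Unbounded size
      size∞ M = M , λ X M≤X → ≤-trans M≤X (size≥ X)

    -- Every large `z` is less than four times some `size X` below it; the resulting change of `L`
    -- by `2 * T` costs a seventh unit.
    mertens-lower : Ev (λ z → ∀ Q q → CommonMultiple z Q q → T * (Q * L z) ≤ T * S q z + 7 * (Q * L z))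
    mertens-lower = transfer lower-sizes (L-unbounded (T * (2 * T)))
      where
      transfer : Ev (λ X → 1 ≤ X × LowerAt X) → Ev (λ z → T * (2 * T) ≤ L z) → Ev (λ z → ∀ Q q → CommonMultiple z Q q → T * (Q * L z) ≤ T * S q z + 7 * (Q * L z))
      transfer (X₀ , hX) (z₁ , hz) = suc (C * (X₀ * X₀)) ⊔ z₁ , λ z h → at z (≤-trans (m≤m⊔n _ z₁) h) (hz z (≤-trans (m≤n⊔m (suc (C * (X₀ * X₀))) z₁) h))
        where
        instance
          C≢0 : NonZero C
          C≢0 = >-nonZero 1≤C
        at : ∀ z → suc (C * (X₀ * X₀)) ≤ z → T * (2 * T) ≤ L z → ∀ Q q → CommonMultiple z Q q → T * (Q * L z) ≤ T * S q z + 7 * (Q * L z)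
        at (suc z) (s≤s h) hL Q q cm = go (isqrt (z / C))
          where
          go : (∃ λ r → r * r ≤ z / C × z / C < suc r * suc r) → T * (Q * L (suc z)) ≤ T * S q (suc z) + 7 * (Q * L (suc z))
          go (X , lo , hi) = begin
            T * (Q * L (suc z)) ≤⟨ *-monoʳ-≤ T (*-monoʳ-≤ Q Lz≤) ⟩
            T * (Q * (2 * T + L Z)) ≡⟨ transfer₁ T Q (L Z) ⟩
            T * (Q * L Z) + Q * (T * (2 * T)) ≤⟨ +-mono-≤ (proj₂ X-good Q q (λ p 1≤p p<Z → cm p 1≤p (<-≤-trans p<Z Z≤z))) (*-monoʳ-≤ Q hL) ⟩
            T * S q Z + 6 * (Q * L Z) + Q * L (suc z) ≤⟨ +-monoˡ-≤ (Q * L (suc z)) (+-mono-≤ (*-monoʳ-≤ T (∑-monoˡ _ Z≤z)) (*-monoʳ-≤ 6 (*-monoʳ-≤ Q (L-mono Z≤z)))) ⟩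
            T * S q (suc z) + 6 * (Q * L (suc z)) + Q * L (suc z) ≡⟨ transfer₂ (T * S q (suc z)) (Q * L (suc z)) ⟩
            T * S q (suc z) + 7 * (Q * L (suc z)) ∎
            where
            open ≤-Reasoning
            Z : ℕ
            Z = size X
            X₀≤X : X₀ ≤ X
            X₀≤X with X₀ ≤? X
            ... | yes q = q
            ... | no q = ⊥-elim (<-irrefl refl (<-≤-trans hi (≤-trans (*-mono-≤ (≰⇒> q) (≰⇒> q)) (≤-trans (≤-reflexive (sym (m*n/n≡m (X₀ * X₀) C))) (/-monoˡ-≤ C (≤-trans (≤-reflexive (*-comm (X₀ * X₀) C)) h))))))
            X-good : 1 ≤ X × LowerAt X
            X-good = hX X X₀≤X
            Z≤z : Z ≤ suc z
            Z≤z = s≤s (≤-trans (*-monoʳ-≤ C lo) (≤-trans (≤-reflexive (*-comm C (z / C))) (m/n*n≤m z C)))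
            z<4Z : suc z ≤ 2 * (2 * Z)
            z<4Z = begin
              suc z ≡⟨ cong suc (m≡m%n+[m/n]*n z C) ⟩
              suc (z % C) + z / C * C ≤⟨ +-monoˡ-≤ (z / C * C) (m%n<n z C) ⟩
              suc (z / C) * C ≤⟨ *-monoˡ-≤ C hi ⟩
              suc X * suc X * C ≤⟨ *-monoˡ-≤ C (*-mono-≤ X+1≤ X+1≤) ⟩
              (X + X) * (X + X) * C ≡⟨ transfer₃ X C ⟩
              2 * (2 * (C * (X * X))) ≤⟨ *-monoʳ-≤ 2 (*-monoʳ-≤ 2 (n≤1+n (C * (X * X)))) ⟩
              2 * (2 * Z) ∎
              where
              X+1≤ : suc X ≤ X + X
              X+1≤ = +-monoˡ-≤ X (proj₁ X-good)
            Lz≤ : L (suc z) ≤ 2 * T + L Z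
            Lz≤ = ≤-trans (L-mono z<4Z) (≤-trans (L-double (2 * Z)) (≤-trans (+-monoʳ-≤ T (L-double Z)) (≤-reflexive (transfer₄ T (L Z)))))

  open LowerMertens using (mertens-lower)

  -- Abel summation

  ∑-id : ∀ n → 2 * ∑ n (λ t → t) + n ≡ n * n
  ∑-id zero = refl
  ∑-id (suc n) = trans (abel₁ (∑ n (λ t → t)) n) (trans (cong (λ k → k + (2 * n + 1)) (∑-id n)) (abel₂ n))

  complement : ∀ n l → l ≤ n → l + ∑ n (λ t → ι (l ≤? t)) ≡ n
  complement zero l l≤n = trans (+-identityʳ l) (n≤0⇒n≡0 l≤n)
  complement (suc n) l l≤n with l ≤? n
  ... | yes h = trans (sym (+-assoc l (∑ n (λ t → ι (l ≤? t))) 1)) (trans (cong (_+ 1) (complement n l h)) (+-comm n 1))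
  ... | no h = trans (cong (λ k → l + (k + 0)) (trans (∑-cong n (λ t t<n → ι-no (l ≤? t) (λ q → h (≤-trans q (<⇒≤ t<n))))) (∑-zero n))) (trans (+-identityʳ l) (≤-antisym l≤n (≰⇒> h)))

  -- `Q` times the sum of 2 (log p)² / p, the contribution of equal primes to the second moment. Its
  -- expected size is half of `Q * (L z * L z)`.
  D : (ℕ → ℕ) → ℕ → ℕ
  D q z = ∑ z (λ p → σ p * (2 * (L p * q p)) * L p)

  instance
    T≢0 : NonZero T
    T≢0 = >-nonZero 1≤T

  -- Abel summation over the level sets L p ≤ t, each of which contains all primes below 2 ^ (t / T).
  abel : Ev (λ z → ∀ Q q → CommonMultiple z Q q → 2 * (T * D q z) ≤ (T + 10) * (Q * (L z * L z)))
  abel = combine mertens-lower mertens-upper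
    where
    combine : Ev (λ z → ∀ Q q → CommonMultiple z Q q → T * (Q * L z) ≤ T * S q z + 7 * (Q * L z)) →
      Ev (λ z → ∀ Q q → CommonMultiple z Q q → T * S q z ≤ (T + 1) * (Q * L z)) →
      Ev (λ z → ∀ Q q → CommonMultiple z Q q → 2 * (T * D q z) ≤ (T + 10) * (Q * (L z * L z)))
    combine (z₀ , lower) up = ev-map (λ z (hu , hL) Q q cm → at z hu hL Q q cm) (up & L-unbounded (T * (2 * t₁ + 1)))
      where
      -- Covers the rounding of `t` down to `L y` and the levels below `z₀ * T`, where the lower
      -- Mertens bound is not yet available.
      t₁ : ℕ
      t₁ = T + z₀ * T
      at : ∀ z → (∀ Q q → CommonMultiple z Q q → T * S q z ≤ (T + 1) * (Q * L z)) → T * (2 * t₁ + 1) ≤ L z →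
        ∀ Q q → CommonMultiple z Q q → 2 * (T * D q z) ≤ (T + 10) * (Q * (L z * L z))
      at z hu hL Q q cm = lin
        ((2 ⊗ (l ⊗ hu Q q cm)) ⊕ (2 ⊗ levels) ⊕ (7 * Q ⊗ ≤-reflexive (∑-id l)) ⊕ (T * Q ⊗ ≤-reflexive (sym (∑-id l))) ⊕ (7 * Q * l ⊗ z≤n {1}) ⊕ (l * Q ⊗ hL) ⊕ (2 * T ⊗ ≤-reflexive layered))
        (abel₃ T Q l (S q z) (D q z) (∑ l part) (∑ l (λ t → t)) t₁)
        where
        l : ℕ
        l = L z
        c : ℕ → ℕ
        c p = σ p * (2 * (L p * q p))
        part : ℕ → ℕ
        part t = ∑ z (λ p → c p * ι (L p ≤? t))
        -- `L p` plus the number of levels from `L p` up to `l` is `l`. Hence an upper bound for `D`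
        -- combines the upper bound for `S` with lower bounds at the single levels.
        layered : D q z + ∑ l part ≡ l * S q z
        layered = begin
          D q z + ∑ l part ≡⟨ cong (λ k → D q z + k) (∑-swap l z (λ t p → c p * ι (L p ≤? t))) ⟩
          D q z + ∑ z (λ p → ∑ l (λ t → c p * ι (L p ≤? t))) ≡⟨ sym (∑-+ z (λ p → c p * L p) _) ⟩
          ∑ z (λ p → c p * L p + ∑ l (λ t → c p * ι (L p ≤? t))) ≡⟨ ∑-cong z (λ p p<z → trans (cong (λ k → c p * L p + k) (∑-* l (c p) _)) (trans (sym (*-distribˡ-+ (c p) (L p) _)) (trans (cong (c p *_) (complement l (L p) (L-mono (<⇒≤ p<z)))) (*-comm (c p) l)))) ⟩
          ∑ z (λ p → l * c p) ≡⟨ ∑-* z l c ⟩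
          l * S q z ∎
          where open ≡-Reasoning
        level : ∀ t → t < l → T * (Q * t) ≤ T * part t + (7 * (Q * t) + T * (Q * t₁))
        level t t<l = cases (z₀ * T ≤? t)
          where
          open ≤-Reasoning
          k y : ℕ
          k = t / T
          y = 2 ^ k
          Ly≤t : L y ≤ t
          Ly≤t = ≤-trans (L-2^ k) (m/n*n≤m t T)
          t≤ : t ≤ L y + T
          t≤ = begin
            t ≡⟨ m≡m%n+[m/n]*n t T ⟩
            t % T + k * T ≤⟨ +-mono-≤ (<⇒≤ (m%n<n t T)) (≤-trans (*-monoʳ-≤ k (L-≥T ≤-refl)) (L-^-lower k (s≤s z≤n))) ⟩
            T + L y ≡⟨ +-comm T (L y) ⟩
            L y + T ∎
          y≤z : y ≤ z
          y≤z with y ≤? z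
          ... | yes h = h
          ... | no h = ⊥-elim (<-irrefl refl (<-≤-trans t<l (≤-trans (L-mono (<⇒≤ (≰⇒> h))) Ly≤t)))
          S≤part : S q y ≤ part t
          S≤part = ≤-trans (∑-mono y (λ p p<y → ≤-reflexive (sym (trans (cong (c p *_) (ι-yes (L p ≤? t) (≤-trans (L-mono (<⇒≤ p<y)) Ly≤t))) (*-identityʳ (c p)))))) (∑-monoˡ (λ p → c p * ι (L p ≤? t)) y≤z)
          cases : Dec (z₀ * T ≤ t) → T * (Q * t) ≤ T * part t + (7 * (Q * t) + T * (Q * t₁))
          cases (no h) = ≤-trans (*-monoʳ-≤ T (*-monoʳ-≤ Q (≤-trans (<⇒≤ (≰⇒> h)) (m≤n+m (z₀ * T) T)))) (≤-trans (m≤n+m _ (7 * (Q * t))) (m≤n+m _ (T * part t)))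
          cases (yes h) = begin
            T * (Q * t) ≤⟨ *-monoʳ-≤ T (*-monoʳ-≤ Q t≤) ⟩
            T * (Q * (L y + T)) ≡⟨ abel₄ T Q (L y) ⟩
            T * (Q * L y) + T * (Q * T) ≤⟨ +-monoˡ-≤ (T * (Q * T)) (lower y z₀≤y Q q (λ p 1≤p p<y → cm p 1≤p (<-≤-trans p<y y≤z))) ⟩
            T * S q y + 7 * (Q * L y) + T * (Q * T) ≤⟨ +-mono-≤ (+-mono-≤ (*-monoʳ-≤ T S≤part) (*-monoʳ-≤ 7 (*-monoʳ-≤ Q Ly≤t))) (*-monoʳ-≤ T (*-monoʳ-≤ Q (m≤m+n T (z₀ * T)))) ⟩
            T * part t + 7 * (Q * t) + T * (Q * t₁) ≡⟨ +-assoc (T * part t) _ _ ⟩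
            T * part t + (7 * (Q * t) + T * (Q * t₁)) ∎
            where
            z₀≤y : z₀ ≤ y
            z₀≤y = ≤-trans (≤-trans (≤-reflexive (sym (m*n/n≡m z₀ T))) (/-monoˡ-≤ T h)) (n≤2^n k)
        levels : T * (Q * ∑ l (λ t → t)) ≤ T * ∑ l part + (7 * (Q * ∑ l (λ t → t)) + l * (T * (Q * t₁)))
        levels = begin
          T * (Q * ∑ l (λ t → t)) ≡⟨ sym (trans (∑-* l T _) (cong (T *_) (∑-* l Q _))) ⟩
          ∑ l (λ t → T * (Q * t)) ≤⟨ ∑-mono l level ⟩
          ∑ l (λ t → T * part t + (7 * (Q * t) + T * (Q * t₁))) ≡⟨ trans (∑-+ l _ _) (cong₂ _+_ (∑-* l T part) (trans (∑-+ l _ _) (cong₂ _+_ (trans (∑-* l 7 _) (cong (7 *_) (∑-* l Q _))) (∑-const l _)))) ⟩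
          T * ∑ l part + (7 * (Q * ∑ l (λ t → t)) + l * (T * (Q * t₁))) ∎
          where open ≤-Reasoning

  -- First and second moments of the prime weights

  N : ℕ → ℕ
  N n = F n 1

  module Classes {p : ℕ} (s : Split p) where

    open Split s
    r₀ : ℕ
    r₀ = proj₁ hasRoot
    open Root isPrime 2β<p r₀ (proj₁ (proj₂ hasRoot)) (proj₂ (proj₂ hasRoot))
    module Conj = Root isPrime 2β<p conj conj<p (conj-root isPrime 2β<p r₀ (proj₁ (proj₂ hasRoot)) (proj₂ (proj₂ hasRoot)))

    r₁ : ℕ
    r₁ = conj

    cast : ∀ n r → + n ℤ.+ + r ℤ.* + 1 ≡ + (n + r)
    cast n r = cong (λ t → + n ℤ.+ t) (ℤₚ.*-identityʳ (+ r))

    uncast : ∀ n r → p ∣ n + r → + p ∣ᶻ + n ℤ.+ + r ℤ.* + 1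
    uncast n r h = ∣ᶻ-by (sym (cast n r)) (n∣ᶻ {p} {+ (n + r)} h)

    cover : ∀ n → ι (p ∣? N n) ≤ ι (p ∣? n + r₀) + ι (p ∣? n + r₁)
    cover n = cases (p ∣? N n)
      where
      cases : (d : Dec (p ∣ N n)) → ι d ≤ ι (p ∣? n + r₀) + ι (p ∣? n + r₁)
      cases (no _) = z≤n
      cases (yes h) = [ (λ q → ≤-trans (1≤ι (p ∣? n + r₀) (∣n {p} {+ (n + r₀)} (∣ᶻ-by (cast n r₀) q))) (m≤m+n _ _))
                      , (λ q → ≤-trans (1≤ι (p ∣? n + r₁) (∣n {p} {+ (n + r₁)} (∣ᶻ-by (cast n r₁) q))) (m≤n+m _ (ι (p ∣? n + r₀)))) ]′
                      (factors (+ n) (+ 1) (n∣ᶻ {p} {form (+ n) (+ 1)} h))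

    -- An `n` in both classes would make `p` divide 1. Disjointness turns the class counts into a
    -- lower bound for the number of solutions.
    disjoint : ∀ n → ι (p ∣? n + r₀) + ι (p ∣? n + r₁) ≤ ι (p ∣? N n)
    disjoint n = cases (p ∣? n + r₀) (p ∣? n + r₁)
      where
      cases : (d : Dec (p ∣ n + r₀)) (d′ : Dec (p ∣ n + r₁)) → ι d + ι d′ ≤ ι (p ∣? N n)
      cases (no _) (no _) = z≤n
      cases (yes h) (no _) = 1≤ι (p ∣? N n) (∣n {p} {form (+ n) (+ 1)} (form-∣ (+ n) (+ 1) (uncast n r₀ h)))
      cases (no _) (yes h) = 1≤ι (p ∣? N n) (∣n {p} {form (+ n) (+ 1)} (Conj.form-∣ (+ n) (+ 1) (uncast n r₁ h)))
      cases (yes h) (yes h′) = ⊥-elim (<-irrefl (sym (∣1⇒≡1 (∣n {p} {+ 1} (proj₂ (both (+ n) (+ 1) (uncast n r₀ h) (uncast n r₁ h′)))))) (prime≥2 isPrime))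

    module _ (X : ℕ) where

      count : ℕ
      count = ∑ X (λ n → ι (p ∣? N n))

      c₀ c₁ : ℕ
      c₀ = ∑ X (λ n → ι (p ∣? n + r₀))
      c₁ = ∑ X (λ n → ι (p ∣? n + r₁))

      count-upper : p * count ≤ 2 * (X + p)
      count-upper = begin
        p * count ≤⟨ *-monoʳ-≤ p (≤-trans (∑-mono X (λ n _ → cover n)) (≤-reflexive (∑-+ X _ _))) ⟩
        p * (c₀ + c₁) ≡⟨ *-distribˡ-+ p c₀ c₁ ⟩
        p * c₀ + p * c₁ ≤⟨ +-mono-≤ (class-upper p r₀ X) (class-upper p r₁ X) ⟩
        (X + p) + (X + p) ≡⟨ cong (λ t → (X + p) + t) (sym (+-identityʳ (X + p))) ⟩
        2 * (X + p) ∎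
        where open ≤-Reasoning

      count-lower : 2 * X ≤ p * count + 2 * p
      count-lower = begin
        2 * X ≡⟨ cong (λ t → X + t) (+-identityʳ X) ⟩
        X + X ≤⟨ +-mono-≤ (class-lower p {{prime⇒nonZero isPrime}} r₀ X) (class-lower p {{prime⇒nonZero isPrime}} r₁ X) ⟩
        (p * c₀ + p) + (p * c₁ + p) ≡⟨ moment₁ p c₀ c₁ ⟩
        p * (c₀ + c₁) + 2 * p ≤⟨ +-monoˡ-≤ (2 * p) (*-monoʳ-≤ p (≤-trans (≤-reflexive (sym (∑-+ X _ _))) (∑-mono X (λ n _ → disjoint n)))) ⟩
        p * count + 2 * p ∎
        where open ≤-Reasoning

  -- Two classes for each prime combine to four classes modulo `p * p′`.
  pair-count : ∀ {p p′} (s : Split p) (s′ : Split p′) → p ≢ p′ → ∀ X →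
    p * p′ * ∑ X (λ n → ι (p ∣? N n) * ι (p′ ∣? N n)) ≤ 4 * (X + p * p′)
  pair-count {p} {p′} s s′ p≢p′ X = begin
    d * ∑ X (λ n → ι (p ∣? N n) * ι (p′ ∣? N n)) ≤⟨ *-monoʳ-≤ d (∑-mono X (λ n _ → *-mono-≤ (A.cover n) (B.cover n))) ⟩
    d * ∑ X (λ n → (a₀ n + a₁ n) * (b₀ n + b₁ n)) ≡⟨ cong (d *_) (∑-cong X (λ n _ → moment₂ (a₀ n) (a₁ n) (b₀ n) (b₁ n))) ⟩
    d * ∑ X (λ n → (a₀ n * b₀ n + a₀ n * b₁ n) + (a₁ n * b₀ n + a₁ n * b₁ n)) ≡⟨ cong (d *_) (trans (∑-+ X _ _) (cong₂ _+_ (∑-+ X _ _) (∑-+ X _ _))) ⟩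
    d * ((∑ X (λ n → a₀ n * b₀ n) + ∑ X (λ n → a₀ n * b₁ n)) + (∑ X (λ n → a₁ n * b₀ n) + ∑ X (λ n → a₁ n * b₁ n))) ≡⟨ moment₃ d (∑ X (λ n → a₀ n * b₀ n)) (∑ X (λ n → a₀ n * b₁ n)) (∑ X (λ n → a₁ n * b₀ n)) (∑ X (λ n → a₁ n * b₁ n)) ⟩
    (d * ∑ X (λ n → a₀ n * b₀ n) + d * ∑ X (λ n → a₀ n * b₁ n)) + (d * ∑ X (λ n → a₁ n * b₀ n) + d * ∑ X (λ n → a₁ n * b₁ n))
      ≤⟨ +-mono-≤ (+-mono-≤ (pc A.r₀ B.r₀) (pc A.r₀ B.r₁)) (+-mono-≤ (pc A.r₁ B.r₀) (pc A.r₁ B.r₁)) ⟩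
    ((X + d) + (X + d)) + ((X + d) + (X + d)) ≡⟨ moment₄ (X + d) ⟩
    4 * (X + d) ∎
    where
    open ≤-Reasoning
    module A = Classes s
    module B = Classes s′
    d : ℕ
    d = p * p′
    a₀ a₁ b₀ b₁ : ℕ → ℕ
    a₀ n = ι (p ∣? n + A.r₀)
    a₁ n = ι (p ∣? n + A.r₁)
    b₀ n = ι (p′ ∣? n + B.r₀)
    b₁ n = ι (p′ ∣? n + B.r₁)
    pc : ∀ a c → d * ∑ X (λ n → ι (p ∣? n + a) * ι (p′ ∣? n + c)) ≤ X + d
    pc a c = pair-class-upper (Split.isPrime s) (Split.isPrime s′) p≢p′ a c X

  -- Divided by `L X`, this is m for `z` near the square root of `X` and M for `z = 2 X`, with the
  -- primes up to `2 * β` left out.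
  mass : ℕ → ℕ → ℕ
  mass z n = ∑ z (λ p → σ p * (ι (p ∣? N n) * L p))

  module Moments (X z Q : ℕ) (q : ℕ → ℕ) (cm : CommonMultiple z Q q) where

    W : ℕ
    W = ∑ z (λ p → σ p * L p)

    cnt : ℕ → ℕ
    cnt p = ∑ X (λ n → ι (p ∣? N n))

    qp : ∀ {p} → Split p → p < z → q p * p ≡ Q
    qp s p<z = cm _ (prime≥1 (Split.isPrime s)) p<z

    ∑-mass : ∑ X (mass z) ≡ ∑ z (λ p → σ p * (L p * cnt p))
    ∑-mass = trans (∑-swap X z (λ n p → σ p * (ι (p ∣? N n) * L p))) (∑-cong z (λ p _ → trans (∑-* X (σ p) _) (cong (σ p *_) (trans (∑-*ʳ X _ (L p)) (*-comm (cnt p) (L p))))))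

    first-upper : Q * ∑ X (mass z) ≤ X * S q z + 2 * (Q * W)
    first-upper = begin
      Q * ∑ X (mass z) ≡⟨ trans (cong (Q *_) ∑-mass) (sym (∑-* z Q _)) ⟩
      ∑ z (λ p → Q * (σ p * (L p * cnt p))) ≤⟨ ∑-mono z (λ p p<z → each p p<z (split? p)) ⟩
      ∑ z (λ p → X * (σ p * (2 * (L p * q p))) + 2 * Q * (σ p * L p)) ≡⟨ trans (∑-+ z _ _) (cong₂ _+_ (∑-* z X _) (∑-* z (2 * Q) _)) ⟩
      X * S q z + 2 * Q * W ≡⟨ cong (λ t → X * S q z + t) (*-assoc 2 Q W) ⟩
      X * S q z + 2 * (Q * W) ∎
      where
      open ≤-Reasoning
      each : ∀ p → p < z → (d : Dec (Split p)) → Q * (ι d * (L p * cnt p)) ≤ X * (ι d * (2 * (L p * q p))) + 2 * Q * (ι d * L p)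
      each p p<z (no _) = ≤-trans (≤-reflexive (*-zeroʳ Q)) z≤n
      each p p<z (yes s) = begin
        Q * (1 * (L p * cnt p)) ≡⟨ cong (λ t → t * (1 * (L p * cnt p))) (sym (qp s p<z)) ⟩
        q p * p * (1 * (L p * cnt p)) ≡⟨ grid₆ (q p) p (L p) (cnt p) ⟩
        q p * L p * (p * cnt p) ≤⟨ *-monoʳ-≤ (q p * L p) (Classes.count-upper s X) ⟩
        q p * L p * (2 * (X + p)) ≡⟨ moment₅ (q p) (L p) X p ⟩
        X * (1 * (2 * (L p * q p))) + 2 * (q p * p) * (1 * L p) ≡⟨ cong (λ t → X * (1 * (2 * (L p * q p))) + 2 * t * (1 * L p)) (qp s p<z) ⟩
        X * (1 * (2 * (L p * q p))) + 2 * Q * (1 * L p) ∎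

    first-lower : X * S q z ≤ Q * ∑ X (mass z) + 2 * (Q * W)
    first-lower = begin
      X * S q z ≡⟨ sym (∑-* z X _) ⟩
      ∑ z (λ p → X * (σ p * (2 * (L p * q p)))) ≤⟨ ∑-mono z (λ p p<z → each p p<z (split? p)) ⟩
      ∑ z (λ p → Q * (σ p * (L p * cnt p)) + 2 * Q * (σ p * L p)) ≡⟨ trans (∑-+ z _ _) (cong₂ _+_ (trans (∑-* z Q _) (cong (Q *_) (sym ∑-mass))) (∑-* z (2 * Q) _)) ⟩
      Q * ∑ X (mass z) + 2 * Q * W ≡⟨ cong (λ t → Q * ∑ X (mass z) + t) (*-assoc 2 Q W) ⟩
      Q * ∑ X (mass z) + 2 * (Q * W) ∎
      where
      open ≤-Reasoning
      each : ∀ p → p < z → (d : Dec (Split p)) → X * (ι d * (2 * (L p * q p))) ≤ Q * (ι d * (L p * cnt p)) + 2 * Q * (ι d * L p)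
      each p p<z (no _) = ≤-trans (≤-reflexive (*-zeroʳ X)) z≤n
      each p p<z (yes s) = begin
        X * (1 * (2 * (L p * q p))) ≡⟨ moment₆ X (L p) (q p) ⟩
        q p * L p * (2 * X) ≤⟨ *-monoʳ-≤ (q p * L p) (Classes.count-lower s X) ⟩
        q p * L p * (p * cnt p + 2 * p) ≡⟨ moment₇ (q p) (L p) p (cnt p) ⟩
        q p * p * (1 * (L p * cnt p)) + 2 * (q p * p) * (1 * L p) ≡⟨ cong (λ t → t * (1 * (L p * cnt p)) + 2 * t * (1 * L p)) (qp s p<z) ⟩
        Q * (1 * (L p * cnt p)) + 2 * Q * (1 * L p) ∎

    -- Distinct primes give the square of the first moment, equal primes give `D`. The error of the
    -- four classes sums to `W * W`, which is small against `X` only for `z` up to about the square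
    -- root of `X`.
    second-upper : Q * Q * ∑ X (λ n → mass z n * mass z n) ≤ X * (S q z * S q z) + 4 * (Q * Q) * (W * W) + (Q * X * D q z + 2 * (Q * Q) * (L z * W))
    second-upper = begin
      Q * Q * ∑ X (λ n → mass z n * mass z n) ≡⟨ cong (Q * Q *_) swap ⟩
      Q * Q * ∑ z (λ p → ∑ z (λ p′ → σ p * L p * (σ p′ * L p′) * cc p p′)) ≡⟨ pull (Q * Q) _ ⟩
      ∑ z (λ p → ∑ z (λ p′ → Q * Q * (σ p * L p * (σ p′ * L p′) * cc p p′))) ≤⟨ ∑-mono z (λ p p<z → ∑-mono z (λ p′ p′<z → each p p′ p<z p′<z (split? p) (split? p′) (p ≟ p′))) ⟩
      ∑ z (λ p → ∑ z (λ p′ → (X * (a p * a p′) + 4 * (Q * Q) * (σ p * L p * (σ p′ * L p′))) + ι (p ≟ p′) * g p)) ≡⟨ split₂ _ _ ⟩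
      ∑ z (λ p → ∑ z (λ p′ → X * (a p * a p′) + 4 * (Q * Q) * (σ p * L p * (σ p′ * L p′)))) + ∑ z (λ p → ∑ z (λ p′ → ι (p ≟ p′) * g p)) ≤⟨ +-mono-≤ (≤-reflexive off) diag ⟩
      (X * (S q z * S q z) + 4 * (Q * Q) * (W * W)) + (Q * X * D q z + 2 * (Q * Q) * (L z * W)) ∎
      where
      open ≤-Reasoning
      a : ℕ → ℕ
      a p = σ p * (2 * (L p * q p))
      cc : ℕ → ℕ → ℕ
      cc p p′ = ∑ X (λ n → ι (p ∣? N n) * ι (p′ ∣? N n))
      g : ℕ → ℕ
      g p = Q * X * (a p * L p) + 2 * (Q * Q) * (σ p * L p * L p)
      split₂ : ∀ (f h : ℕ → ℕ → ℕ) → ∑ z (λ i → ∑ z (λ k → f i k + h i k)) ≡ ∑ z (λ i → ∑ z (f i)) + ∑ z (λ i → ∑ z (h i))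
      split₂ f h = trans (∑-cong z (λ i _ → ∑-+ z (f i) (h i))) (∑-+ z _ _)
      pull : ∀ c (f : ℕ → ℕ → ℕ) → c * ∑ z (λ i → ∑ z (f i)) ≡ ∑ z (λ i → ∑ z (λ k → c * f i k))
      pull c f = sym (trans (∑-cong z (λ i _ → ∑-* z c (f i))) (∑-* z c _))
      swap : ∑ X (λ n → mass z n * mass z n) ≡ ∑ z (λ p → ∑ z (λ p′ → σ p * L p * (σ p′ * L p′) * cc p p′))
      swap = trans (∑-cong X (λ n _ → ∑-*-∑ z z (λ p → σ p * (ι (p ∣? N n) * L p)) (λ p → σ p * (ι (p ∣? N n) * L p))))
        (trans (∑-swap X z (λ n p → ∑ z (λ p′ → σ p * (ι (p ∣? N n) * L p) * (σ p′ * (ι (p′ ∣? N n) * L p′)))))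
        (∑-cong z (λ p _ → trans (∑-swap X z (λ n p′ → σ p * (ι (p ∣? N n) * L p) * (σ p′ * (ι (p′ ∣? N n) * L p′))))
          (∑-cong z (λ p′ _ → trans (∑-cong X (λ n _ → moment₈ (σ p) (ι (p ∣? N n)) (L p) (σ p′) (ι (p′ ∣? N n)) (L p′))) (∑-* X (σ p * L p * (σ p′ * L p′)) _))))))
      off : ∑ z (λ p → ∑ z (λ p′ → X * (a p * a p′) + 4 * (Q * Q) * (σ p * L p * (σ p′ * L p′)))) ≡ X * (S q z * S q z) + 4 * (Q * Q) * (W * W)
      off = trans (split₂ (λ p p′ → X * (a p * a p′)) (λ p p′ → 4 * (Q * Q) * (σ p * L p * (σ p′ * L p′))))
        (cong₂ _+_ (trans (sym (pull X (λ p p′ → a p * a p′))) (cong (X *_) (sym (∑-*-∑ z z a a))))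
                   (trans (sym (pull (4 * (Q * Q)) (λ p p′ → σ p * L p * (σ p′ * L p′)))) (cong (4 * (Q * Q) *_) (sym (∑-*-∑ z z (λ p → σ p * L p) (λ p → σ p * L p))))))
      diag : ∑ z (λ p → ∑ z (λ p′ → ι (p ≟ p′) * g p)) ≤ Q * X * D q z + 2 * (Q * Q) * (L z * W)
      diag = begin
        ∑ z (λ p → ∑ z (λ p′ → ι (p ≟ p′) * g p)) ≤⟨ ∑-mono z (λ p _ → ≤-trans (≤-reflexive (∑-*ʳ z (λ p′ → ι (p ≟ p′)) (g p))) (≤-trans (*-monoˡ-≤ (g p) (exclusive z (λ p′ → p ≟ p′) (λ i j e e′ → trans (sym e) e′))) (≤-reflexive (*-identityˡ (g p))))) ⟩
        ∑ z g ≡⟨ trans (∑-+ z _ _) (cong₂ _+_ (∑-* z (Q * X) _) (∑-* z (2 * (Q * Q)) _)) ⟩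
        Q * X * D q z + 2 * (Q * Q) * ∑ z (λ p → σ p * L p * L p) ≤⟨ +-monoʳ-≤ (Q * X * D q z) (*-monoʳ-≤ (2 * (Q * Q)) (≤-trans (∑-mono z (λ p p<z → *-monoʳ-≤ (σ p * L p) (L-mono (<⇒≤ p<z)))) (≤-reflexive (trans (∑-*ʳ z _ (L z)) (*-comm W (L z)))))) ⟩
        Q * X * D q z + 2 * (Q * Q) * (L z * W) ∎
      each : ∀ p p′ → p < z → p′ < z → (d : Dec (Split p)) (d′ : Dec (Split p′)) (e : Dec (p ≡ p′)) →
        Q * Q * (ι d * L p * (ι d′ * L p′) * cc p p′) ≤
          (X * (ι d * (2 * (L p * q p)) * (ι d′ * (2 * (L p′ * q p′)))) + 4 * (Q * Q) * (ι d * L p * (ι d′ * L p′))) + ι e * (Q * X * (ι d * (2 * (L p * q p)) * L p) + 2 * (Q * Q) * (ι d * L p * L p))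
      each p p′ _ _ (no _) d′ e = ≤-trans (≤-reflexive (*-zeroʳ (Q * Q))) z≤n
      each p p′ _ _ (yes _) (no _) e = ≤-trans (≤-reflexive (trans (cong (λ t → Q * Q * (t * cc p p′)) (*-zeroʳ (1 * L p))) (*-zeroʳ (Q * Q)))) z≤n
      each p p′ p<z p′<z (yes s) (yes s′) (no p≢p′) = ≤-trans (begin
        Q * Q * (1 * L p * (1 * L p′) * cc p p′) ≡⟨ cong₂ (λ x y → x * y * (1 * L p * (1 * L p′) * cc p p′)) (sym (qp s p<z)) (sym (qp s′ p′<z)) ⟩
        q p * p * (q p′ * p′) * (1 * L p * (1 * L p′) * cc p p′) ≡⟨ moment₉ (q p) p (q p′) p′ (L p) (L p′) (cc p p′) ⟩
        q p * q p′ * (L p * L p′) * (p * p′ * cc p p′) ≤⟨ *-monoʳ-≤ (q p * q p′ * (L p * L p′)) (pair-count s s′ p≢p′ X) ⟩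
        q p * q p′ * (L p * L p′) * (4 * (X + p * p′)) ≡⟨ moment₁₀ (q p) p (q p′) p′ (L p) (L p′) X ⟩
        X * (1 * (2 * (L p * q p)) * (1 * (2 * (L p′ * q p′)))) + 4 * (q p * p * (q p′ * p′)) * (1 * L p * (1 * L p′)) ≡⟨ cong₂ (λ x y → X * (1 * (2 * (L p * q p)) * (1 * (2 * (L p′ * q p′)))) + 4 * (x * y) * (1 * L p * (1 * L p′))) (qp s p<z) (qp s′ p′<z) ⟩
        X * (1 * (2 * (L p * q p)) * (1 * (2 * (L p′ * q p′)))) + 4 * (Q * Q) * (1 * L p * (1 * L p′)) ∎) (m≤m+n _ _)
      each p .p p<z _ (yes s) (yes s′) (yes refl) = ≤-trans (begin
        Q * Q * (1 * L p * (1 * L p) * cc p p) ≤⟨ *-monoʳ-≤ (Q * Q) (*-monoʳ-≤ (1 * L p * (1 * L p)) (∑-mono X (λ n _ → ι-*-drop (p ∣? N n) (ι (p ∣? N n))))) ⟩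
        Q * Q * (1 * L p * (1 * L p) * cnt p) ≡⟨ cong (λ t → Q * t * (1 * L p * (1 * L p) * cnt p)) (sym (qp s p<z)) ⟩
        Q * (q p * p) * (1 * L p * (1 * L p) * cnt p) ≡⟨ moment₁₁ Q (q p) p (L p) (cnt p) ⟩
        Q * (q p * (L p * L p)) * (p * cnt p) ≤⟨ *-monoʳ-≤ (Q * (q p * (L p * L p))) (Classes.count-upper s X) ⟩
        Q * (q p * (L p * L p)) * (2 * (X + p)) ≡⟨ moment₁₂ Q (q p) (L p) X p ⟩
        1 * (Q * X * (1 * (2 * (L p * q p)) * L p) + 2 * (Q * (q p * p)) * (1 * L p * L p)) ≡⟨ cong (λ t → 1 * (Q * X * (1 * (2 * (L p * q p)) * L p) + 2 * (Q * t) * (1 * L p * L p))) (qp s p<z) ⟩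
        1 * (Q * X * (1 * (2 * (L p * q p)) * L p) + 2 * (Q * Q) * (1 * L p * L p)) ∎)
        (m≤n+m _ (X * (1 * (2 * (L p * q p)) * (1 * (2 * (L p * q p)))) + 4 * (Q * Q) * (1 * L p * (1 * L p))))

  factorial-multiple : ∀ P z → z ≤ suc P → CommonMultiple z (P !) (quot (P !))
  factorial-multiple P z z≤ (suc p) _ p<z = m/n*n≡m {P !} {suc p} (∣-trans (m∣m*n (p !)) (m≤n⇒m!∣n! (≤-pred (<-≤-trans p<z z≤))))

  -- Up to errors of order `1 / T`: M has mean at most 1, m has mean at least 1/2 and mean square at
  -- most 3/8. The directions are those dictated by the signs in W.
  Moment₁ Moment₂ Moment₃ : ℕ → ℕ → Set
  Moment₁ X z = T * ∑ X (mass z) ≤ (T + 3) * (X * L X)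
  Moment₂ X z = T * (X * L X) ≤ 2 * (T * ∑ X (mass z)) + 9 * (X * L X)
  Moment₃ X z = 8 * (T * ∑ X (λ n → mass z n * mass z n)) ≤ (3 * T + 21) * (X * (L X * L X))

  Upper Lower Abel : ℕ → Set
  Upper z = ∀ Q q → CommonMultiple z Q q → T * S q z ≤ (T + 1) * (Q * L z)
  Lower z = ∀ Q q → CommonMultiple z Q q → T * (Q * L z) ≤ T * S q z + 7 * (Q * L z)
  Abel z = ∀ Q q → CommonMultiple z Q q → 2 * (T * D q z) ≤ (T + 10) * (Q * (L z * L z))

  module AtScale (X : ℕ) (1≤X : 1 ≤ X) where

    P Q Λ : ℕ
    P = 2 * X
    Q = P !
    Λ = L X

    q : ℕ → ℕ
    q = quot Q

    instance
      Q≢0 : NonZero Q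
      Q≢0 = P !≢0

    mean-large : Upper P → 4 * T * π P ≤ P → (T + 2) * T ≤ Λ → Moment₁ X P
    mean-large up hπ hΛ = *-cancelˡ-≤ Q (begin
      Q * (T * ∑ X (mass P)) ≡⟨ scale₁ Q T (∑ X (mass P)) ⟩
      T * (Q * ∑ X (mass P)) ≤⟨ *-monoʳ-≤ T first-upper ⟩
      T * (X * S q P + 2 * (Q * W)) ≤⟨ *-monoʳ-≤ T (+-monoʳ-≤ (X * S q P) (*-monoʳ-≤ 2 (*-monoʳ-≤ Q (∑-σL≤ P)))) ⟩
      T * (X * S q P + 2 * (Q * (π P * L P))) ≡⟨ scale₂ T X (S q P) Q (π P) (L P) ⟩
      X * (T * S q P) + Q * (2 * T * π P * L P) ≤⟨ +-mono-≤ (*-monoʳ-≤ X (up Q q cm)) (*-monoʳ-≤ Q (*-monoˡ-≤ (L P) 2Tπ≤)) ⟩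
      X * ((T + 1) * (Q * L P)) + Q * (X * L P) ≡⟨ scale₃ X T Q (L P) ⟩
      Q * ((T + 2) * (X * L P)) ≤⟨ *-monoʳ-≤ Q (*-monoʳ-≤ (T + 2) (*-monoʳ-≤ X (L-double X))) ⟩
      Q * ((T + 2) * (X * (T + Λ))) ≡⟨ scale₄ Q T X Λ ⟩
      Q * (X * ((T + 2) * T) + (T + 2) * (X * Λ)) ≤⟨ *-monoʳ-≤ Q (+-monoˡ-≤ ((T + 2) * (X * Λ)) (*-monoʳ-≤ X hΛ)) ⟩
      Q * (X * Λ + (T + 2) * (X * Λ)) ≡⟨ scale₅ Q X Λ T ⟩
      Q * ((T + 3) * (X * Λ)) ∎)
      where
      open ≤-Reasoning
      cm : CommonMultiple P Q q
      cm = factorial-multiple P P (n≤1+n P)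
      open Moments X P Q q cm
      2Tπ≤ : 2 * T * π P ≤ X
      2Tπ≤ = *-cancelˡ-≤ 2 (≤-trans (≤-reflexive (scale₆ T (π P))) hπ)

    module Small (r : ℕ) (1≤r : 1 ≤ r) (lo : r * r ≤ X) (hi : X < suc r * suc r) where

      Y l : ℕ
      Y = suc r
      l = L Y

      Y≤2r : Y ≤ 2 * r
      Y≤2r = ≤-trans (+-monoˡ-≤ r 1≤r) (≤-reflexive (cong (λ t → r + t) (sym (+-identityʳ r))))

      r≤X : r ≤ X
      r≤X = ≤-trans (m≤m*n r r {{>-nonZero 1≤r}}) lo

      Y≤P : Y ≤ P
      Y≤P = ≤-trans Y≤2r (*-monoʳ-≤ 2 r≤X)

      l-upper : 2 * l ≤ 2 * T + Λ
      l-upper = begin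
        2 * l ≤⟨ *-monoʳ-≤ 2 (≤-trans (L-mono Y≤2r) (L-double r)) ⟩
        2 * (T + L r) ≡⟨ scale₇ T (L r) ⟩
        2 * T + (L r + L r) ≤⟨ +-monoʳ-≤ (2 * T) (≤-trans (L-sup 1≤r 1≤r) (L-mono lo)) ⟩
        2 * T + Λ ∎
        where open ≤-Reasoning

      l-lower : Λ ≤ 2 * l + 1
      l-lower = ≤-trans (L-mono (<⇒≤ hi)) (≤-trans (L-sub Y Y) (≤-reflexive (cong (λ t → l + t + 1) (sym (+-identityʳ l)))))

      cm : CommonMultiple Y Q q
      cm = factorial-multiple P Y (≤-trans Y≤P (n≤1+n P))

      open Moments X Y Q q cm

      W≤ : W ≤ π Y * l
      W≤ = ∑-σL≤ Y

      module _ (hπ : 4 * T * π Y ≤ Y) where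

        2Tπ≤r : 2 * T * π Y ≤ r
        2Tπ≤r = *-cancelˡ-≤ 2 (≤-trans (≤-reflexive (scale₆ T (π Y))) (≤-trans hπ Y≤2r))

        2Tπ≤ : 2 * T * π Y ≤ X
        2Tπ≤ = ≤-trans 2Tπ≤r r≤X

        -- Seven units come from `Lower`, one from the class errors, and one absorbs the constants
        -- in comparing `2 * l` with `Λ`: `T` from one direction and `16 * T` from the other, hence
        -- `17 * T`.
        mean-small : Lower Y → 17 * T ≤ Λ → Moment₂ X Y
        mean-small low hΛ = lin
            ((2 ⊗ step) ⊕ (T * X ⊗ l-lower) ⊕ (8 * X ⊗ l-upper) ⊕ (X ⊗ hΛ))
            (scale₈ T X Λ l (∑ X (mass Y)))
          where
          open ≤-Reasoning
          step : X * (T * l) ≤ T * ∑ X (mass Y) + 8 * (X * l)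
          step = *-cancelˡ-≤ Q (begin
            Q * (X * (T * l)) ≡⟨ scale₉ Q X T l ⟩
            X * (T * (Q * l)) ≤⟨ *-monoʳ-≤ X (low Q q cm) ⟩
            X * (T * S q Y + 7 * (Q * l)) ≡⟨ scale₁₀ X T (S q Y) Q l ⟩
            T * (X * S q Y) + 7 * (X * (Q * l)) ≤⟨ +-monoˡ-≤ (7 * (X * (Q * l))) (*-monoʳ-≤ T (≤-trans first-lower (+-monoʳ-≤ (Q * ∑ X (mass Y)) (*-monoʳ-≤ 2 (*-monoʳ-≤ Q W≤))))) ⟩
            T * (Q * ∑ X (mass Y) + 2 * (Q * (π Y * l))) + 7 * (X * (Q * l)) ≡⟨ scale₁₁ T Q (∑ X (mass Y)) (π Y) l X ⟩
            Q * (T * ∑ X (mass Y)) + Q * (2 * T * π Y * l) + 7 * (X * (Q * l)) ≤⟨ +-monoˡ-≤ (7 * (X * (Q * l))) (+-monoʳ-≤ (Q * (T * ∑ X (mass Y))) (*-monoʳ-≤ Q (*-monoˡ-≤ l 2Tπ≤))) ⟩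
            Q * (T * ∑ X (mass Y)) + Q * (X * l) + 7 * (X * (Q * l)) ≡⟨ scale₁₂ Q (T * ∑ X (mass Y)) X l ⟩
            Q * (T * ∑ X (mass Y) + 8 * (X * l)) ∎)

        -- The square of the mean gives `l * l` and equal primes give half of it; since `2 * l` is
        -- close to `Λ`, the sum is 3/8 of `Λ * Λ`.
        square-small : Upper Y → Abel Y → (3 * T + 20) * (8 * T) ≤ Λ → Moment₃ X Y
        square-small up ab hΛ = begin
          8 * (T * M₂) ≡⟨ scale₁₃ T M₂ ⟩
          4 * (2 * (T * M₂)) ≤⟨ *-monoʳ-≤ 4 step₂ ⟩
          4 * ((3 * T + 20) * (X * (l * l))) ≡⟨ scale₁₄ (3 * T + 20) X l ⟩
          (3 * T + 20) * X * (2 * l * (2 * l)) ≤⟨ *-monoʳ-≤ ((3 * T + 20) * X) (*-mono-≤ l-upper l-upper) ⟩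
          (3 * T + 20) * X * ((2 * T + Λ) * (2 * T + Λ)) ≡⟨ scale₁₅ (3 * T + 20) X T Λ ⟩
          (3 * T + 20) * X * (4 * T * Λ + 4 * T * T) + (3 * T + 20) * (X * (Λ * Λ)) ≤⟨ +-monoˡ-≤ ((3 * T + 20) * (X * (Λ * Λ))) (*-monoʳ-≤ ((3 * T + 20) * X) (+-monoʳ-≤ (4 * T * Λ) (*-monoʳ-≤ (4 * T) T≤Λ))) ⟩
          (3 * T + 20) * X * (4 * T * Λ + 4 * T * Λ) + (3 * T + 20) * (X * (Λ * Λ)) ≡⟨ cong (λ t → t + (3 * T + 20) * (X * (Λ * Λ))) (scale₁₆ (3 * T + 20) X T Λ) ⟩
          (3 * T + 20) * (8 * T) * (X * Λ) + (3 * T + 20) * (X * (Λ * Λ)) ≤⟨ +-monoˡ-≤ ((3 * T + 20) * (X * (Λ * Λ))) (*-monoˡ-≤ (X * Λ) hΛ) ⟩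
          Λ * (X * Λ) + (3 * T + 20) * (X * (Λ * Λ)) ≡⟨ scale₁₇ Λ X T ⟩
          (3 * T + 21) * (X * (Λ * Λ)) ∎
          where
          open ≤-Reasoning
          M₂ : ℕ
          M₂ = ∑ X (λ n → mass Y n * mass Y n)
          T≤Λ : T ≤ Λ
          T≤Λ = ≤-trans (≤-trans (m≤n*m T 8) (m≤n*m (8 * T) (3 * T + 20) {{>-nonZero (≤-trans (s≤s z≤n) (m≤n+m 20 (3 * T)))}})) hΛ
          -- Since `2 * T * π Y ≤ r`, the squared prime count is at most the fraction `1 / (4 T²)`
          -- of `X`; the cutoff at the square root makes this possible.
          π²≤ : 4 * T * T * (π Y * π Y) ≤ X
          π²≤ = ≤-trans (≤-reflexive (scale₁₈ T (π Y))) (≤-trans (*-mono-≤ 2Tπ≤r 2Tπ≤r) lo)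
          step₁ : 2 * (T * (T * M₂)) ≤ T * ((3 * T + 20) * (X * (l * l)))
          step₁ = *-cancelˡ-≤ (Q * Q) {{m*n≢0 Q Q}} (begin
            Q * Q * (2 * (T * (T * M₂))) ≡⟨ scale₁₉ Q T M₂ ⟩
            2 * (T * T) * (Q * Q * M₂) ≤⟨ *-monoʳ-≤ (2 * (T * T)) second-upper ⟩
            2 * (T * T) * (X * (s * s) + 4 * (Q * Q) * (W * W) + (Q * X * d + 2 * (Q * Q) * (l * W)))
              ≤⟨ *-monoʳ-≤ (2 * (T * T)) (+-mono-≤ (+-monoʳ-≤ (X * (s * s)) (*-monoʳ-≤ (4 * (Q * Q)) (*-mono-≤ W≤ W≤))) (+-monoʳ-≤ (Q * X * d) (*-monoʳ-≤ (2 * (Q * Q)) (*-monoʳ-≤ l W≤)))) ⟩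
            2 * (T * T) * (X * (s * s) + 4 * (Q * Q) * (π Y * l * (π Y * l)) + (Q * X * d + 2 * (Q * Q) * (l * (π Y * l)))) ≡⟨ scale₂₀ T X s Q (π Y) l d ⟩
            2 * X * (T * s * (T * s)) + 2 * (Q * Q * (l * l)) * (4 * T * T * (π Y * π Y)) + Q * X * T * (2 * (T * d)) + 2 * T * (Q * Q * (l * l)) * (2 * T * π Y)
              ≤⟨ +-mono-≤ (+-mono-≤ (+-mono-≤ (*-monoʳ-≤ (2 * X) (*-mono-≤ (up Q q cm) (up Q q cm))) (*-monoʳ-≤ (2 * (Q * Q * (l * l))) π²≤)) (*-monoʳ-≤ (Q * X * T) (ab Q q cm))) (*-monoʳ-≤ (2 * T * (Q * Q * (l * l))) 2Tπ≤) ⟩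
            2 * X * ((T + 1) * (Q * l) * ((T + 1) * (Q * l))) + 2 * (Q * Q * (l * l)) * X + Q * X * T * ((T + 10) * (Q * (l * l))) + 2 * T * (Q * Q * (l * l)) * X ≡⟨ scale₂₁ X T Q l ⟩
            Q * Q * (X * (l * l)) * (3 * T * T + 16 * T + 4) ≤⟨ *-monoʳ-≤ (Q * Q * (X * (l * l))) (+-monoʳ-≤ (3 * T * T + 16 * T) (*-monoʳ-≤ 4 1≤T)) ⟩
            Q * Q * (X * (l * l)) * (3 * T * T + 16 * T + 4 * T) ≡⟨ scale₂₂ Q X l T ⟩
            Q * Q * (T * ((3 * T + 20) * (X * (l * l)))) ∎)
            where
            s d : ℕ
            s = S q Y
            d = D q Y
          step₂ : 2 * (T * M₂) ≤ (3 * T + 20) * (X * (l * l))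
          step₂ = *-cancelˡ-≤ T (≤-trans (≤-reflexive (scale₂₃ T (T * M₂))) step₁)

  root : ℕ → ℕ
  root X = proj₁ (isqrt X)

  root-unbounded : Unbounded (λ X → suc (root X))
  root-unbounded M = M * M , λ X h → go X h (isqrt X)
    where
    go : ∀ X → M * M ≤ X → (i : ∃ λ r → r * r ≤ X × X < suc r * suc r) → M ≤ suc (proj₁ i)
    go X h (r , _ , hi) with M ≤? suc r
    ... | yes q = q
    ... | no q = ⊥-elim (<-irrefl refl (<-≤-trans hi (≤-trans (*-mono-≤ (<⇒≤ (≰⇒> q)) (<⇒≤ (≰⇒> q))) h)))

  moments : Ev (λ X → Moment₁ X (2 * X) × Moment₂ X (suc (root X)) × Moment₃ X (suc (root X)) × suc (root X) ≤ 2 * X)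
  moments = ev-map at
      (ev-≥ 1 & ev-∘ double (mertens-upper & π-sublinear (4 * T)) &
       ev-∘ root-unbounded (mertens-upper & mertens-lower & abel & π-sublinear (4 * T)) &
       L-unbounded ((T + 2) * T) & L-unbounded (17 * T) & L-unbounded ((3 * T + 20) * (8 * T)))
    where
    double : Unbounded (2 *_)
    double K = K , λ n K≤n → ≤-trans K≤n (m≤m+n n (1 * n))
    at : ∀ X → _ → Moment₁ X (2 * X) × Moment₂ X (suc (root X)) × Moment₃ X (suc (root X)) × suc (root X) ≤ 2 * X
    at X (1≤X , (up₁ , π₁) , (up₂ , low , ab , π₂) , h₁ , h₂ , h₃) =
        AtScale.mean-large X 1≤X up₁ π₁ h₁ , mean-small π₂ low h₂ , square-small π₂ up₂ ab h₃ , Y≤P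
      where
      lo : root X * root X ≤ X
      lo = proj₁ (proj₂ (isqrt X))
      hi : X < suc (root X) * suc (root X)
      hi = proj₂ (proj₂ (isqrt X))
      1≤r : 1 ≤ root X
      1≤r = n≢0⇒n>0 (λ e → <-irrefl refl (<-≤-trans (subst (λ r → X < suc r * suc r) e hi) 1≤X))
      open AtScale.Small X 1≤X (root X) 1≤r lo hi

  -- The pointwise inequality and the density

  Large : ℕ → Set
  Large n = 1 ≤ n × ∃ λ p → p < suc (N n) × Prime p × 2 * n < p × (p ∣ N n)

  -- The bound `p < suc (N n)` makes the search finite and excludes no divisor of a positive `N n`.
  large? : ∀ n → Dec (Large n)
  large? n = (1 ≤? n) ×-dec anyUpTo? (λ p → prime? p ×-dec ((2 * n <? p) ×-dec (p ∣? N n))) (suc (N n))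

  open Rare T 2 (s≤s z≤n)
  open Radical R (j + j) split?

  module Pointwise (X : ℕ) (1≤X : 1 ≤ X) (z : ℕ) (z≤ : z ≤ 2 * X) where

    Λ : ℕ
    Λ = L X

    K : ℕ
    K = suc R * cost + T * (T + 2 * L T + 2)

    -- For `n` below `X / T` the logarithm of `N n` may fall well short of `2 * Λ`; these `n` are
    -- few and join the exceptional ones.
    exceptional : ℕ → ℕ
    exceptional n = bad (2 * X) n 1 + ι (n * T <? X)

    mass-mono : ∀ n → mass z n ≤ mass (2 * X) n
    mass-mono n = ∑-monoˡ _ z≤

    module _ (n : ℕ) (n<X : n < X) where

      m M : ℕ
      m = mass z n
      M = mass (2 * X) n

      -- 2 Λ² - 20 m Λ + 50 m² = 2 (Λ - 5 m)².
      always : 98 * (Λ * Λ) + 89 * (m * Λ) ≤ 50 * (m * m) + 69 * (M * Λ) + 100 * (Λ * Λ)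
      always = lin ((2 ⊗ 2ab≤a²+b² (5 * m) Λ) ⊕ (69 ⊗ *-monoˡ-≤ Λ (mass-mono n))) (point₁ m M Λ)

      -- 7921 Λ² - 17800 m Λ + 10000 m² = (89 Λ - 100 m)².
      smooth : 689 ≤ T → 2 * T * Λ ≤ (T + 1) * M + Λ → 98 * (Λ * Λ) + 89 * (m * Λ) ≤ 50 * (m * m) + 69 * (M * Λ)
      smooth hT h = *-cancelˡ-≤ 200 (lin ((20 * Λ ⊗ M≥) ⊕ 2ab≤a²+b² (100 * m) (89 * Λ) ⊕ (19 * (Λ * Λ) ⊗ z≤n {1})) (point₂ m M Λ))
        where
        -- `h` gives `M` at least `(2 T - 1) / (T + 1)` times `Λ`, which is 1377 / 690 at `T = 689`.
        -- The quadratic in `m` requires 69 M ≥ 137.605 Λ, and 69 · 1377 / 690 = 137.7.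
        M≥ : 1377 * Λ ≤ 690 * M
        M≥ = *-cancelˡ-≤ (T + 1) {{>-nonZero (m≤n+m 1 T)}} (lin ((690 ⊗ h) ⊕ (3 * Λ ⊗ hT)) (point₃ T Λ M))

      module _ (2β≤n : 2 * β ≤ n) (N<Y² : N n < 2 * X * (2 * X)) (X≤nT : X ≤ n * T) (notLarge : ¬ Large n) (bad0 : bad (2 * X) n 1 ≡ 0) (1≤n : 1 ≤ n) where

        1≤N : 1 ≤ N n
        1≤N = F-pos n 1 (inj₁ 1≤n)

        n²≤2N : n * n ≤ 2 * N n
        n²≤2N = lin ((2 ⊗ F-lower n 1) ⊕ (n ⊗ 2β≤n) ⊕ (2 * β ⊗ 1≤n)) (point₄ n (N n) β)

        rad : T * L (N n) ≤ (T + 1) * M + suc R * cost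
        rad = radical (2 * X) (N n) 1≤N below (λ p pp R<p → bad-zero-sq (2 * X) n 1 bad0 1≤N N<Y² p pp R<p (p∤1 p pp))
            (bad-zero-pw (2 * X) n 1 bad0) (λ p pp R<p p∣N → split-from pp (≤-<-trans 2β≤R R<p) n 1 p∣N (p∤1 p pp))
          where
          p∤1 : ∀ p → Prime p → ¬ p ∣ 1
          p∤1 p pp h = <-irrefl (sym (∣1⇒≡1 h)) (prime≥2 pp)
          -- Without a prime factor above `2 * n` all prime factors lie below `2 * X`, so `M`
          -- registers every split one.
          below : ∀ p → Prime p → p ∣ N n → p < 2 * X
          below p pp p∣N with p ≤? 2 * n
          ... | yes h = ≤-<-trans h (*-monoʳ-< 2 n<X)
          ... | no h = ⊥-elim (notLarge (1≤n , p , s≤s (∣⇒≤ {{>-nonZero 1≤N}} p∣N) , pp , ≰⇒> h , p∣N))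

        -- `M` carries essentially the whole logarithm of `N n`, about `2 * Λ`; one `Λ` absorbs all
        -- constants.
        heavy : K ≤ Λ → 2 * T * Λ ≤ (T + 1) * M + Λ
        heavy hK = lin ((2 * T ⊗ Λ≤) ⊕ (T ⊗ L-sup 1≤n 1≤n) ⊕ (T ⊗ L-mono n²≤2N) ⊕ (T ⊗ L-double (N n)) ⊕ rad ⊕ hK)
            (point₅ T Λ (L n) (L T) (L (n * n)) (L (2 * N n)) (L (N n)) M (suc R * cost))
          where
          Λ≤ : Λ ≤ L n + L T + 1
          Λ≤ = ≤-trans (L-mono X≤nT) (L-sub n T)

      -- `smooth` settles the ordinary `n` without a large prime factor. For every other `n` the
      -- last summand is at least `100 * (Λ * Λ)`, and `always` applies.
      pointwise : 689 ≤ T → K ≤ Λ → 2 * β * T ≤ X → β < X →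
        98 * (Λ * Λ) + 89 * (m * Λ) ≤ 50 * (m * m) + 69 * (M * Λ) + 100 * (Λ * Λ) * (ι (large? n) + exceptional n)
      pointwise hT hK hβT hβ = cases (large? n) (bad (2 * X) n 1 ≟ 0) (n * T <? X)
        where
        B : ℕ
        B = bad (2 * X) n 1
        exc : ∀ k → 1 ≤ k → 98 * (Λ * Λ) + 89 * (m * Λ) ≤ 50 * (m * m) + 69 * (M * Λ) + 100 * (Λ * Λ) * k
        exc k 1≤k = ≤-trans always (+-monoʳ-≤ (50 * (m * m) + 69 * (M * Λ)) (≤-trans (≤-reflexive (sym (*-identityʳ (100 * (Λ * Λ))))) (*-monoʳ-≤ (100 * (Λ * Λ)) 1≤k)))
        cases : (d : Dec (Large n)) → Dec (B ≡ 0) → (e : Dec (n * T < X)) →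
          98 * (Λ * Λ) + 89 * (m * Λ) ≤ 50 * (m * m) + 69 * (M * Λ) + 100 * (Λ * Λ) * (ι d + (B + ι e))
        cases (yes _) _ e = exc (1 + (B + ι e)) (s≤s z≤n)
        cases (no _) _ (yes _) = exc (0 + (B + 1)) (m≤n+m 1 B)
        cases (no _) (no B≢0) (no _) = exc (0 + (B + 0)) (≤-trans (n≢0⇒n>0 B≢0) (≤-reflexive (sym (+-identityʳ B))))
        cases (no nl) (yes bad0) (no nT≮X) = ≤-trans (smooth hT (heavy 2β≤n N<Y² (≮⇒≥ nT≮X) nl bad0 1≤n hK)) (m≤m+n _ _)
          where
          2β≤n : 2 * β ≤ n
          2β≤n = *-cancelʳ-≤ (2 * β) n T (≤-trans hβT (≮⇒≥ nT≮X))
          1≤n : 1 ≤ n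
          1≤n = ≤-trans (*-mono-≤ {1} {2} (s≤s z≤n) 1≤β) 2β≤n
          N<Y² : N n < 2 * X * (2 * X)
          N<Y² = begin-strict
            N n ≤⟨ F-upper n 1 ⟩
            n * n + β * 1 <⟨ +-mono-≤-< (*-mono-≤ (<⇒≤ n<X) (<⇒≤ n<X)) (subst (_< X) (sym (*-identityʳ β)) hβ) ⟩
            X * X + X ≤⟨ +-monoʳ-≤ (X * X) (≤-trans (m≤m*n X X {{>-nonZero 1≤X}}) (m≤m+n (X * X) (2 * (X * X)))) ⟩
            X * X + (X * X + 2 * (X * X)) ≡⟨ point₆ X ⟩
            2 * X * (2 * X) ∎
            where open ≤-Reasoning

  -- The gain in the averaged inequality is 438 T X, the accumulated errors are 8310 X.
  module _ (hT : 8310 ≤ T) where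

    count : ℕ → ℕ
    count X = ∑ X (λ n → ι (large? n))

    density : Ev (λ X → 437 * X ≤ 800 * count X)
    density = ev-map at (ev-≥ 1 & moments & rare & L-unbounded K₀ & L-unbounded 1 & ev-≥ (2 * β * T) & ev-≥ (suc β) & ev-≥ T)
      where
      K₀ : ℕ
      K₀ = suc R * cost + T * (T + 2 * L T + 2)
      at : ∀ X → _ → 437 * X ≤ 800 * count X
      at X (1≤X , (m₁ , m₂ , m₃ , Y≤) , rareX , hK , 1≤Λ , hβT , hβ , T≤X) =
          *-cancelˡ-≤ (Λ * Λ * T) {{m*n≢0 (Λ * Λ) T {{m*n≢0 Λ Λ {{>-nonZero 1≤Λ}} {{>-nonZero 1≤Λ}}}}}}
            -- The factor 8 clears the denominators of the moments: 356 = 8 · 89 / 2 and 552 = 8 ·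
            -- 69. The errors add up to 9 · 356 + 21 · 50 + 3 · 552 + 3 · 800 = 8310.
            (lin ((8 * T ⊗ summed) ⊕ (356 * Λ ⊗ m₂) ⊕ (50 ⊗ m₃) ⊕ (552 * Λ ⊗ m₁) ⊕ (800 * (Λ * Λ) ⊗ Exc≤) ⊕ (X * (Λ * Λ) ⊗ hT))
              (final₁ T X Λ Σm Σm² ΣM (count X) Exc))
        where
        open Pointwise X 1≤X (suc (root X)) Y≤
        Σm Σm² ΣM Exc : ℕ
        Σm = ∑ X (mass (suc (root X)))
        Σm² = ∑ X (λ n → mass (suc (root X)) n * mass (suc (root X)) n)
        ΣM = ∑ X (mass (2 * X))
        Exc = ∑ X exceptional
        summed : X * (98 * (Λ * Λ)) + 89 * (Σm * Λ) ≤ 50 * Σm² + 69 * (ΣM * Λ) + 100 * (Λ * Λ) * (count X + Exc)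
        summed = begin
          X * (98 * (Λ * Λ)) + 89 * (Σm * Λ) ≡⟨ sym (trans (∑-+ X _ _) (cong₂ _+_ (∑-const X _) (trans (∑-* X 89 _) (cong (89 *_) (∑-*ʳ X _ Λ))))) ⟩
          ∑ X (λ n → 98 * (Λ * Λ) + 89 * (m₀ n * Λ)) ≤⟨ ∑-mono X (λ n n<X → pointwise n n<X (≤-trans (m≤n+m 689 7621) hT) hK hβT hβ) ⟩
          ∑ X (λ n → 50 * (m₀ n * m₀ n) + 69 * (mass (2 * X) n * Λ) + 100 * (Λ * Λ) * (ι (large? n) + exceptional n)) ≡⟨ trans (∑-+ X _ _) (cong₂ _+_ (trans (∑-+ X _ _) (cong₂ _+_ (∑-* X 50 _) (trans (∑-* X 69 _) (cong (69 *_) (∑-*ʳ X _ Λ))))) (trans (∑-* X (100 * (Λ * Λ)) _) (cong (100 * (Λ * Λ) *_) (∑-+ X _ _)))) ⟩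
          50 * Σm² + 69 * (ΣM * Λ) + 100 * (Λ * Λ) * (count X + Exc) ∎
          where
          open ≤-Reasoning
          m₀ : ℕ → ℕ
          m₀ = mass (suc (root X))
        Exc≤ : T * Exc ≤ 3 * X
        Exc≤ = begin
          T * Exc ≡⟨ trans (cong (T *_) (∑-+ X _ _)) (*-distribˡ-+ T (∑ X (λ n → bad (2 * X) n 1)) _) ⟩
          T * ∑ X (λ n → bad (2 * X) n 1) + T * ∑ X (λ n → ι (n * T <? X)) ≤⟨ +-mono-≤ (rareX 0 1) tiny ⟩
          X + (X + X) ≡⟨ cong (λ t → X + (X + t)) (sym (+-identityʳ X)) ⟩
          3 * X ∎
          where
          open ≤-Reasoning
          tiny : T * ∑ X (λ n → ι (n * T <? X)) ≤ X + X
          tiny = begin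
            T * ∑ X (λ n → ι (n * T <? X)) ≤⟨ *-monoʳ-≤ T (∑-mono X (λ n _ → ι-mono (n * T <? X) (n ≤? X / T) (λ h → ≤-trans (≤-reflexive (sym (m*n/n≡m n T))) (/-monoˡ-≤ T (<⇒≤ h))))) ⟩
            T * ∑ X (λ n → ι (n ≤? X / T)) ≤⟨ *-monoʳ-≤ T (∑-ι≤ (X / T) X) ⟩
            T * suc (X / T) ≡⟨ trans (*-suc T (X / T)) (cong (λ t → T + t) (*-comm T (X / T))) ⟩
            T + X / T * T ≤⟨ +-mono-≤ T≤X (m/n*n≤m X T) ⟩
            X + X ∎

  -- Large prime factors are primitive divisors

  open import Defs using (A; HasPrimitiveDivisor)

  N≡∣A∣ : ∀ n → N n ≡ ∣ A b n ∣
  N≡∣A∣ n = cong (λ t → ∣ + n ℤ.* + n ℤ.+ t ∣) (ℤₚ.*-identityʳ b)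

  -- p ∣ n² - m² = (n - m)(n + m) is impossible for a prime p > 2 n > n + m.
  large⇒primitive : ∀ n → Large n → HasPrimitiveDivisor b n
  large⇒primitive n (1≤n , p , _ , pp , 2n<p , p∣N) = + p , ℤ.+<+ (prime≥2 pp) , subst (p ∣_) (N≡∣A∣ n) p∣N , coprime
    where
    p∤Nm : ∀ m → 1 ≤ m → m < n → ¬ p ∣ N m
    p∤Nm m 1≤m m<n p∣Nm = [ minus , plus ]′ (euclidsLemma ∣ + n ℤ.- + m ∣ (n + m) pp (F-difference p n m 1 p∣N p∣Nm))
      where
      n+m<p : n + m < p
      n+m<p = <-trans (+-monoʳ-< n (subst (m <_) (sym (+-identityʳ n)) m<n)) 2n<p
      plus : ¬ p ∣ n + m
      plus h = <-irrefl refl (<-≤-trans n+m<p (∣⇒≤ {{>-nonZero (≤-trans 1≤n (m≤m+n n m))}} h))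
      n-m≡ : ∣ + n ℤ.- + m ∣ ≡ n ∸ m
      n-m≡ = cong ∣_∣ (trans (ℤₚ.m-n≡m⊖n n m) (ℤₚ.⊖-≥ (<⇒≤ m<n)))
      minus : ¬ p ∣ ∣ + n ℤ.- + m ∣
      minus h = <-irrefl refl (<-≤-trans n+m<p (≤-trans
        (∣⇒≤ {{>-nonZero (m<n⇒0<n∸m m<n)}} (subst (p ∣_) n-m≡ h)) (≤-trans (m∸n≤m n m) (m≤m+n n m))))
    coprime : ∀ m → 1 ≤ m → m < n → A b m ≢ ℤ.0ℤ → + gcd p ∣ A b m ∣ ≡ ℤ.1ℤ
    coprime m 1≤m m<n _ = cong +_ ([ (λ e → e) , (λ e → ⊥-elim (p∤Nm m 1≤m m<n (subst (p ∣_) (sym (N≡∣A∣ m)) (subst (_∣ ∣ A b m ∣) e (gcd[m,n]∣n p ∣ A b m ∣))))) ]′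
      (prime⇒irreducible pp (gcd[m,n]∣m p ∣ A b m ∣)))

open import Defs
open import Data.Rational using (ℚ; _/_; _*_; _<_)
open import Data.Rational using () renaming (_≤_ to _≤ℚ_)
open import Data.List using (List; length)
open import Data.List.Relation.Unary.All using (All)
open import Data.List.Relation.Unary.Unique.Propositional using (Unique)
open import Data.Product using (Σ; _×_)

open import Data.Nat as ℕ using (zero; suc; s≤s; z≤n)
import Data.Nat.Properties as ℕₚ
import Data.Nat.DivMod as ℕ÷
import Data.Nat.Coprimality as Coprimality
open import Data.Integer as ℤ using ()
import Data.Integer.Properties as ℤₚ
open import Data.Rational using (mkℚ; *≤*; toℚᵘ)
import Data.Rational.Properties as ℚₚ
import Data.Rational.Unnormalised as ℚᵘ
import Data.Rational.Unnormalised.Properties as ℚᵘₚ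
open import Data.List using ([]; _∷_)
import Data.List.Relation.Unary.All as All
open import Data.List.Relation.Unary.AllPairs using ([]; _∷_)
open import Data.Product using (∃; _,_; proj₁; proj₂)
open import Data.Empty using (⊥-elim)
open import Relation.Nullary using (Dec; yes; no)
open import Relation.Binary.PropositionalEquality
open Identities
open Sums

-- From natural number counts to lists and rational bounds

record Collected (P : ℕ → Set) (P? : ∀ n → Dec (P n)) (X : ℕ) : Set where
  field
    elements : List ℕ
    unique : Unique elements
    members : All (λ n → n ℕ.< X × P n) elements
    size : length elements ≡ ∑ X (λ n → ι (P? n))

collect : ∀ {P : ℕ → Set} (P? : ∀ n → Dec (P n)) X → Collected P P? X
collect P? zero = record { elements = [] ; unique = [] ; members = All.[] ; size = refl }
collect {P} P? (suc X) = add (P? X) refl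
  where
  open Collected (collect P? X)
  weaken : All (λ n → n ℕ.< suc X × P n) elements
  weaken = All.map (λ (h , p) → ℕₚ.m<n⇒m<1+n h , p) members
  add : (d : Dec (P X)) → P? X ≡ d → Collected P P? (suc X)
  add (yes p) e = record
    { elements = X ∷ elements
    ; unique = All.map (λ (n<X , _) X≡n → ℕₚ.<-irrefl (sym X≡n) n<X) members ∷ unique
    ; members = (ℕₚ.≤-refl , p) All.∷ weaken
    ; size = trans (cong suc size) (trans (ℕₚ.+-comm 1 _) (cong (λ d → ∑ X (λ n → ι (P? n)) ℕ.+ ι d) (sym e))) }
  add (no _) e = record
    { elements = elements ; unique = unique ; members = weaken
    ; size = trans size (trans (sym (ℕₚ.+-identityʳ _)) (cong (λ d → ∑ X (λ n → ι (P? n)) ℕ.+ ι d) (sym e))) }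

ℕ→ℚ≡ : ∀ n → ℕ→ℚ n ≡ mkℚ (+ n) 0 (Coprimality.sym (Coprimality.1-coprimeTo n))
ℕ→ℚ≡ n = ℚₚ.normalize-coprime (Coprimality.sym (Coprimality.1-coprimeTo n))

-- Any `T` from 8310 on serves; 10000 is a round choice.
count-bound : ∀ (b : ℤ) → ¬ IsSquare (- b) → ∃ λ (P : ℕ → Set) → ∃ λ (P? : ∀ n → Dec (P n)) →
  (∀ n → P n → 1 ≤ n × HasPrimitiveDivisor b n) × Ev (λ X → 437 ℕ.* X ≤ 800 ℕ.* ∑ X (λ n → ι (P? n)))
count-bound b nonsquare = bound 10000 (s≤s z≤n) (ℕₚ.m≤n+m 8310 1690)
  where
  bound : ∀ T (1≤T : 1 ≤ T) → 8310 ≤ T → ∃ λ (P : ℕ → Set) → ∃ λ (P? : ∀ n → Dec (P n)) →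
    (∀ n → P n → 1 ≤ n × HasPrimitiveDivisor b n) × Ev (λ X → 437 ℕ.* X ≤ 800 ℕ.* ∑ X (λ n → ι (P? n)))
  bound T 1≤T hT = Large , large? , (λ n h → proj₁ h , large⇒primitive n h) , density hT
    where open Form T 1≤T b nonsquare

-- Passing to unnormalised fractions reduces the claim to the cross-multiplied inequality between
-- naturals.
ratio-< : ∀ n m′ a d′ .(c : Coprimality.Coprime a (suc d′)) k → n ℕ.* a ℕ.< k ℕ.* (suc m′ ℕ.* suc d′) →
  ((+ n) / suc m′) * mkℚ (+ a) d′ c < ℕ→ℚ k
ratio-< n m′ a d′ c k h = subst (((+ n) / suc m′) * x <_) (sym (ℕ→ℚ≡ k))
    (ℚₚ.toℚᵘ-cancel-< (ℚᵘₚ.<-respˡ-≃ (ℚᵘₚ.≃-sym product) (ℚᵘ.*<* cross)))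
  where
  x : ℚ
  x = mkℚ (+ a) d′ c
  product : toℚᵘ (((+ n) / suc m′) * x) ℚᵘ.≃ ℚᵘ.mkℚᵘ (+ n) m′ ℚᵘ.* toℚᵘ x
  product = ℚᵘₚ.≃-trans (ℚₚ.toℚᵘ-homo-* ((+ n) / suc m′) x) (ℚᵘₚ.*-congʳ {toℚᵘ x} (ℚₚ.toℚᵘ-fromℚᵘ (ℚᵘ.mkℚᵘ (+ n) m′)))
  cross : (+ n ℤ.* + a) ℤ.* + 1 ℤ.< + k ℤ.* + (suc m′ ℕ.* suc d′)
  cross = subst₂ ℤ._<_ (trans (ℤₚ.pos-* n a) (sym (ℤₚ.*-identityʳ (+ n ℤ.* + a)))) (ℤₚ.pos-* k (suc m′ ℕ.* suc d′)) (ℤ.+<+ h)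

module _ (b : ℤ) (P : ℕ → Set) (P? : ∀ n → Dec (P n)) (sound : ∀ n → P n → 1 ≤ n × HasPrimitiveDivisor b n)
  (X₀ : ℕ) (large : ∀ X → X₀ ≤ X → 437 ℕ.* X ≤ 800 ℕ.* ∑ X (λ n → ι (P? n))) where

  Listed : ℚ → Set
  Listed x = Σ (List ℕ) (λ ns → Unique ns × All (λ n → 1 ≤ n × ℕ→ℚ n ≤ℚ x × HasPrimitiveDivisor b n) ns × ((+ 543) / 1000) * x < ℕ→ℚ (length ns))

  -- For `X ≥ 200` the surplus of 437 / 800 over 0.543 pays for replacing `X` by `X + 1`, that is,
  -- for rounding `x` down to an integer.
  M : ℕ
  M = X₀ ℕ.+ 200

  listed : ∀ x → mkℚ (+ M) 0 (Coprimality.sym (Coprimality.1-coprimeTo M)) ≤ℚ x → Listed x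
  listed (mkℚ (ℤ.-[1+ a ]) d′ c) (*≤* h) = ⊥-elim (negative (ℤₚ.≤-trans (ℤₚ.≤-reflexive (ℤₚ.pos-* M (suc d′))) h))
    where
    negative : ¬ (+ (M ℕ.* suc d′) ℤ.≤ ℤ.-[1+ a ] ℤ.* ℤ.1ℤ)
    negative q = ℤₚ.<-irrefl refl (ℤₚ.<-≤-trans (ℤ.-<+ {_} {M ℕ.* suc d′}) (ℤₚ.≤-trans q (ℤₚ.≤-reflexive (ℤₚ.*-identityʳ ℤ.-[1+ a ]))))
  listed x@(mkℚ (+ a) d′ c) (*≤* h) = elements , unique
      , All.map (λ (n<X , p) → proj₁ (sound _ p) , below _ n<X , proj₂ (sound _ p)) members , ratio-< 543 999 a d′ c k numerators
    where
    d X k : ℕ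
    d = suc d′
    X = a ℕ÷./ d
    open Collected (collect P? X)
    k = length elements
    Md≤a : M ℕ.* d ≤ a
    Md≤a = ℤₚ.drop‿+≤+ (ℤₚ.≤-trans (ℤₚ.≤-reflexive (ℤₚ.pos-* M d)) (ℤₚ.≤-trans h (ℤₚ.≤-reflexive (ℤₚ.*-identityʳ (+ a)))))
    M≤X : M ≤ X
    M≤X = ℕₚ.≤-trans (ℕₚ.≤-reflexive (sym (ℕ÷.m*n/n≡m M d))) (ℕ÷./-monoˡ-≤ d Md≤a)
    below : ∀ n → n ℕ.< X → ℕ→ℚ n ≤ℚ x
    below n n<X = subst (_≤ℚ x) (sym (ℕ→ℚ≡ n)) (*≤* (ℤₚ.≤-trans (ℤₚ.≤-reflexive (sym (ℤₚ.pos-* n d))) (ℤₚ.≤-trans (ℤ.+≤+ nd≤a) (ℤₚ.≤-reflexive (sym (ℤₚ.*-identityʳ (+ a)))))))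
      where
      nd≤a : n ℕ.* d ≤ a
      nd≤a = ℕₚ.≤-trans (ℕₚ.*-monoˡ-≤ d (ℕₚ.<⇒≤ n<X)) (ℕ÷.m/n*n≤m a d)
    many : 543 ℕ.* suc X ≤ 1000 ℕ.* k
    many = ℕₚ.*-cancelˡ-≤ 800 (lin ((1000 ⊗ subst (λ t → 437 ℕ.* X ≤ 800 ℕ.* t) (sym size) (large X (ℕₚ.≤-trans (ℕₚ.m≤m+n X₀ 200) M≤X)))
        ⊕ (2172 ⊗ ℕₚ.≤-trans (ℕₚ.m≤n+m 200 X₀) M≤X) ⊕ (428 ⊗ z≤n {X})) (final₂ X k))
    a<[1+X]d : a ℕ.< suc X ℕ.* d
    a<[1+X]d = ℕₚ.≤-<-trans (ℕₚ.≤-reflexive (ℕ÷.m≡m%n+[m/n]*n a d)) (ℕₚ.+-monoˡ-< (X ℕ.* d) (ℕ÷.m%n<n a d))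
    numerators : 543 ℕ.* a ℕ.< k ℕ.* (1000 ℕ.* d)
    numerators = begin-strict
      543 ℕ.* a <⟨ ℕₚ.*-monoʳ-< 543 a<[1+X]d ⟩
      543 ℕ.* (suc X ℕ.* d) ≡⟨ sym (ℕₚ.*-assoc 543 (suc X) d) ⟩
      543 ℕ.* suc X ℕ.* d ≤⟨ ℕₚ.*-monoˡ-≤ d many ⟩
      1000 ℕ.* k ℕ.* d ≡⟨ final₃ k d ⟩
      k ℕ.* (1000 ℕ.* d) ∎
      where open ℕₚ.≤-Reasoning

theorem1p3 : (b : ℤ) → ¬ IsSquare (- b) →
    Σ ℚ (λ x₀ → (x : ℚ) → x₀ ≤ℚ x →
    Σ (List ℕ) (λ ns → Unique ns ×
    All (λ n → 1 ≤ n × ℕ→ℚ n ≤ℚ x × HasPrimitiveDivisor b n) ns ×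
    ((+ 543) / 1000) * x < ℕ→ℚ (length ns)))
theorem1p3 b nonsquare = go (count-bound b nonsquare)
  where
  go : (∃ λ (P : ℕ → Set) → ∃ λ (P? : ∀ n → Dec (P n)) →
    (∀ n → P n → 1 ≤ n × HasPrimitiveDivisor b n) × Ev (λ X → 437 ℕ.* X ≤ 800 ℕ.* ∑ X (λ n → ι (P? n)))) →
    Σ ℚ (λ x₀ → (x : ℚ) → x₀ ≤ℚ x → Σ (List ℕ) (λ ns → Unique ns × All (λ n → 1 ≤ n × ℕ→ℚ n ≤ℚ x × HasPrimitiveDivisor b n) ns × ((+ 543) / 1000) * x < ℕ→ℚ (length ns)))
  go (P , P? , sound , X₀ , large) = ℕ→ℚ (X₀ ℕ.+ 200) , λ x h → listed b P P? sound X₀ large x (subst (_≤ℚ x) (ℕ→ℚ≡ (X₀ ℕ.+ 200)) h)
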